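{- Let $q=2^{2e+1}$ with $e\ge 1$. All Buekenhout-Tits unitals in $\mathrm{PG}(2,q^2)$ are $\mathrm{PGL}$-equivalent; that is, for any two Buekenhout-Tits unitals $U_1,U_2$ in $\mathrm{PG}(2,q^2)$ there is an element of $\mathrm{PGL}(3,q^2)$ mapping $U_1$ onto $U_2$.
   Context: A unital in $\mathrm{PG}(2,q^2)$ is a set of $q^3+1$ points such that every line meets it in $1$ or $q+1$ points. André/Bruck-Bose (ABB) construction: fix a hyperplane $\Sigma$ of $\mathrm{PG}(4,q)$ and a Desarguesian line spread $\mathcal{S}$ of $\Sigma\cong\mathrm{PG}(3,q)$. The plane $\mathrm{PG}(2,q^2)$ is modelled as follows: the points are the points of $\mathrm{PG}(4,q)\setminus\Sigma$ together with the lines of $\mathcal{S}$ (the latter being the points of a line $\ell_\infty$); the lines are $\ell_\infty$ and the planes of $\mathrm{PG}(4,q)$ not contained in $\Sigma$ that meet $\Sigma$ in a line of $\mathcal{S}$; incidence is natural. Let $\sigma=2^{e+1}$. A Tits ovoid of $\mathrm{PG}(3,q)$ is a point set projectively equivalent to $\{(0,0,0,1)\}\cup\{(1,s,t,s^{\sigma+2}+t^\sigma+st) : s,t\in\mathbb{F}_q\}$. An ovoidal cone in $\mathrm{PG}(4,q)$ with vertex a point $V$ and base an ovoid $\mathcal{O}$ (contained in a hyperplane not through $V$) is the union of the lines joining $V$ to the points of $\mathcal{O}$. A Buekenhout-Tits unital in $\mathrm{PG}(2,q^2)$ is a unital arising, via the ABB construction, from an ovoidal cone $\mathcal{C}$ with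 base a Tits ovoid such that $\mathcal{C}\cap\Sigma$ is a line of the spread $\mathcal{S}$: it consists of the points of $\mathcal{C}\setminus\Sigma$ together with the point of $\ell_\infty$ corresponding to the spread line $\mathcal{C}\cap\Sigma$. -}

module Defs where

open import Level using (0ℓ)
open import Algebra.Bundles using (CommutativeRing; Semiring)
open import Algebra.Structures using (IsCommutativeRing)
open import Algebra.Morphism.Structures using (IsRingHomomorphism)
import Algebra.Definitions.RawSemiring as RawSemiringDefinitions
open import Data.Empty using (⊥)
open import Data.Fin.Base using (Fin)
open import Data.Nat.Base using (ℕ; zero; suc)
import Data.Nat.Base as ℕ
open import Data.Product.Base using (Σ; _×_; _,_; proj₁; proj₂; Σ-syntax; ∃-syntax)
open import Data.Sum.Base using (_⊎_; inj₁; inj₂)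
open import Data.Unit.Base using (⊤; tt)
open import Data.Vec.Base using (Vec; []; _∷_; map; zipWith; replicate)
open import Data.Vec.Properties using (map-id; map-cong; map-∘)
open import Function.Base using (id; _∘_)
open import Function.Bundles using (Inverse; _↔_; _⇔_)
open import Relation.Binary.Bundles using (Setoid)
import Relation.Binary.Construct.On as On
open import Relation.Binary.PropositionalEquality
  using (_≡_; _≢_; refl; sym; trans; cong; cong₂; setoid; module ≡-Reasoning)
open import Relation.Nullary.Negation using (¬_)
open import Relation.Unary using (Pred)

record FiniteField (q : ℕ) : Set₁ where
  infixl 7 _*_
  infixl 6 _+_
  infix  8 -_
  field
    Carrier           : Set
    _+_ _*_           : Carrier → Carrier → Carrier
    -_                : Carrier → Carrier
    0# 1#             : Carrier
    isCommutativeRing : IsCommutativeRing _≡_ _+_ _*_ -_ 0# 1#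
    0≢1               : 0# ≢ 1#
    invertible        : ∀ x → x ≢ 0# → ∃[ y ] x * y ≡ 1#
    enumeration       : Carrier ↔ Fin q

  commutativeRing : CommutativeRing 0ℓ 0ℓ
  commutativeRing = record { isCommutativeRing = isCommutativeRing }

  open CommutativeRing commutativeRing public
    using ( rawRing; semiring; *-assoc; *-comm; *-identityˡ; distribˡ; zeroˡ; zeroʳ )
  open RawSemiringDefinitions (Semiring.rawSemiring semiring) public using (_^_)

record Embedding {q r : ℕ} (F : FiniteField q) (K : FiniteField r) : Set where
  private
    module F = FiniteField F
    module K = FiniteField K
  field
    ⟦_⟧            : F.Carrier → K.Carrier
    isHomomorphism : IsRingHomomorphism F.rawRing K.rawRing ⟦_⟧

record IncidenceStructure : Set₁ where
  field
    points lines : Setoid 0ℓ 0ℓ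
  private
    module P = Setoid points
    module L = Setoid lines
  field
    _I_    : P.Carrier → L.Carrier → Set
    I-resp : ∀ {p p′ l l′} → p P.≈ p′ → l L.≈ l′ → p I l → p′ I l′

record IncidenceIsomorphism (A B : IncidenceStructure) : Set where
  private
    module A = IncidenceStructure A
    module B = IncidenceStructure B
  field
    pointBijection : Inverse A.points B.points
    lineBijection  : Inverse A.lines B.lines

  onPoints = Inverse.to pointBijection
  onLines  = Inverse.to lineBijection

  field
    preservesIncidence : ∀ p l → (p A.I l) ⇔ (onPoints p B.I onLines l)

module Projective {q : ℕ} (F : FiniteField q) where
  open FiniteField F

  infixl 6 _⊕_
  infixr 7 _•_

  Vector : ℕ → Set
  Vector n = Vec Carrier n

  _⊕_ : ∀ {n} → Vector n → Vector n → Vector n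
  _⊕_ = zipWith _+_

  _•_ : ∀ {n} → Carrier → Vector n → Vector n
  c • v = map (c *_) v

  0ᵥ : ∀ {n} → Vector n
  0ᵥ = replicate _ 0#

  lincomb : ∀ {m n} → Vector m → Vec (Vector n) m → Vector n
  lincomb []       []       = 0ᵥ
  lincomb (c ∷ cs) (b ∷ bs) = c • b ⊕ lincomb cs bs

  1•v≡v : ∀ {n} (v : Vector n) → 1# • v ≡ v
  1•v≡v v = trans (map-cong *-identityˡ v) (map-id v)

  0•v≡0 : ∀ {n} (v : Vector n) → 0# • v ≡ 0ᵥ
  0•v≡0 []      = refl
  0•v≡0 (x ∷ v) = cong₂ _∷_ (zeroˡ x) (0•v≡0 v)

  c•0≡0 : ∀ {n} c → c • 0ᵥ {n} ≡ 0ᵥ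
  c•0≡0 {zero}  c = refl
  c•0≡0 {suc n} c = cong₂ _∷_ (zeroʳ c) (c•0≡0 c)

  •-assoc : ∀ {n} c d (v : Vector n) → (c * d) • v ≡ c • (d • v)
  •-assoc c d v = trans (map-cong (*-assoc c d) v) (map-∘ (c *_) (d *_) v)

  •-distrib-⊕ : ∀ {n} c (v w : Vector n) → c • (v ⊕ w) ≡ c • v ⊕ c • w
  •-distrib-⊕ c []      []      = refl
  •-distrib-⊕ c (x ∷ v) (y ∷ w) = cong₂ _∷_ (distribˡ c x y) (•-distrib-⊕ c v w)

  lincomb-• : ∀ {m n} c (a : Vector m) (bs : Vec (Vector n) m) →
              lincomb (c • a) bs ≡ c • lincomb a bs
  lincomb-• c []      []       = sym (c•0≡0 c)
  lincomb-• c (x ∷ a) (b ∷ bs) =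
    trans (cong₂ _⊕_ (•-assoc c x b) (lincomb-• c a bs))
          (sym (•-distrib-⊕ c (x • b) (lincomb a bs)))

  *-≢0 : ∀ {c d} → c ≢ 0# → d ≢ 0# → c * d ≢ 0#
  *-≢0 {c} {d} c≢0 d≢0 cd≡0 with invertible c c≢0
  ... | c⁻¹ , cc⁻¹≡1 = d≢0 (begin
    d              ≡⟨ *-identityˡ d ⟨
    1# * d         ≡⟨ cong (_* d) cc⁻¹≡1 ⟨
    c * c⁻¹ * d    ≡⟨ cong (_* d) (*-comm c c⁻¹) ⟩
    c⁻¹ * c * d    ≡⟨ *-assoc c⁻¹ c d ⟩
    c⁻¹ * (c * d)  ≡⟨ cong (c⁻¹ *_) cd≡0 ⟩
    c⁻¹ * 0#       ≡⟨ zeroʳ c⁻¹ ⟩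
    0#             ∎)
    where open ≡-Reasoning

  infix 4 _∝_

  _∝_ : ∀ {n} → Vector n → Vector n → Set
  v ∝ w = ∃[ c ] (c ≢ 0# × c • v ≡ w)

  ∝-refl : ∀ {n} {v : Vector n} → v ∝ v
  ∝-refl {v = v} = 1# , (0≢1 ∘ sym) , 1•v≡v v

  ∝-sym : ∀ {n} {v w : Vector n} → v ∝ w → w ∝ v
  ∝-sym {v = v} {w} (c , c≢0 , cv≡w) with invertible c c≢0
  ... | c⁻¹ , cc⁻¹≡1 = c⁻¹ , c⁻¹≢0 , (begin
    c⁻¹ • w        ≡⟨ cong (c⁻¹ •_) cv≡w ⟨
    c⁻¹ • (c • v)  ≡⟨ •-assoc c⁻¹ c v ⟨
    (c⁻¹ * c) • v  ≡⟨ cong (_• v) (trans (*-comm c⁻¹ c) cc⁻¹≡1) ⟩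
    1# • v         ≡⟨ 1•v≡v v ⟩
    v              ∎)
    where
    open ≡-Reasoning
    c⁻¹≢0 : c⁻¹ ≢ 0#
    c⁻¹≢0 c⁻¹≡0 =
      0≢1 (trans (sym (zeroʳ c)) (trans (cong (c *_) (sym c⁻¹≡0)) cc⁻¹≡1))

  ∝-trans : ∀ {n} {u v w : Vector n} → u ∝ v → v ∝ w → u ∝ w
  ∝-trans {u = u} (c , c≢0 , cu≡v) (d , d≢0 , dv≡w) =
    d * c , *-≢0 d≢0 c≢0 ,
    trans (•-assoc d c u) (trans (cong (d •_) cu≡v) dv≡w)

  record Point (n : ℕ) : Set where
    constructor ⟨_,_⟩
    field
      rep     : Vector (suc n)
      nonzero : rep ≢ 0ᵥ
  open Point public

  infix 4 _~_

  _~_ : ∀ {n} → Point n → Point n → Set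
  P ~ Q = rep P ∝ rep Q

  pointSetoid : ℕ → Setoid 0ℓ 0ℓ
  pointSetoid n = record
    { Carrier = Point n
    ; _≈_     = _~_
    ; isEquivalence = record { refl = ∝-refl ; sym = ∝-sym ; trans = ∝-trans }
    }

  -- A k-dimensional projective subspace of PG(n,q), given by a basis of the
  -- underlying (k+1)-dimensional vector subspace.
  record Flat (k n : ℕ) : Set where
    field
      basis       : Vec (Vector (suc n)) (suc k)
      independent : ∀ c → lincomb c basis ≡ 0ᵥ → c ≡ 0ᵥ
  open Flat public

  Span : ∀ {m n} → Vec (Vector n) m → Vector n → Set
  Span bs v = ∃[ c ] lincomb c bs ≡ v

  infix 4 _∈ᶠ_ _⊆ᶠ_ _≈ᶠ_

  _∈ᶠ_ : ∀ {k n} → Point n → Flat k n → Set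
  P ∈ᶠ X = Span (basis X) (rep P)

  _⊆ᶠ_ : ∀ {k l n} → Flat k n → Flat l n → Set
  X ⊆ᶠ Y = ∀ P → P ∈ᶠ X → P ∈ᶠ Y

  _≈ᶠ_ : ∀ {k n} → Flat k n → Flat k n → Set
  X ≈ᶠ Y = X ⊆ᶠ Y × Y ⊆ᶠ X

  ≈ᶠ-refl : ∀ {k n} (X : Flat k n) → X ≈ᶠ X
  ≈ᶠ-refl _ = (λ _ → id) , (λ _ → id)

  ≈ᶠ-sym : ∀ {k n} (X Y : Flat k n) → X ≈ᶠ Y → Y ≈ᶠ X
  ≈ᶠ-sym _ _ (p , q) = q , p

  ≈ᶠ-trans : ∀ {k n} (X Y Z : Flat k n) → X ≈ᶠ Y → Y ≈ᶠ Z → X ≈ᶠ Z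
  ≈ᶠ-trans _ _ _ (p , q) (r , s) = (λ P → r P ∘ p P) , (λ P → q P ∘ s P)

  flatSetoid : ℕ → ℕ → Setoid 0ℓ 0ℓ
  flatSetoid k n = record
    { Carrier = Flat k n
    ; _≈_     = _≈ᶠ_
    ; isEquivalence = record
      { refl  = λ {X} → ≈ᶠ-refl X
      ; sym   = λ {X} {Y} → ≈ᶠ-sym X Y
      ; trans = λ {X} {Y} {Z} → ≈ᶠ-trans X Y Z
      }
    }

  Span-resp : ∀ {m n} (bs : Vec (Vector n) m) {v w} → v ∝ w → Span bs v → Span bs w
  Span-resp bs (d , _ , dv≡w) (c , cb≡v) =
    d • c , trans (lincomb-• d c bs) (trans (cong (d •_) cb≡v) dv≡w)

  PG2 : IncidenceStructure
  PG2 = record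
    { points = pointSetoid 2
    ; lines  = flatSetoid 1 2
    ; _I_    = _∈ᶠ_
    ; I-resp = λ {_} {p′} {l} p~p′ l≈l′ p∈l →
        proj₁ l≈l′ p′ (Span-resp (basis l) p~p′ p∈l)
    }

  record PointSet (n : ℕ) : Set₁ where
    field
      mem  : Pred (Point n) 0ℓ
      resp : ∀ {P Q} → P ~ Q → mem P → mem Q

  infix 4 _∈_

  _∈_ : ∀ {n} → Point n → PointSet n → Set
  P ∈ U = PointSet.mem U P

  -- The number of points (not of representing vectors) satisfying a predicate.
  HasSize : ∀ {n} → Pred (Point n) 0ℓ → ℕ → Set
  HasSize {n} U m =
    Inverse (On.setoid {B = Σ (Point n) U} (pointSetoid n) proj₁) (setoid (Fin m))

  -- Elements of PGL(n+1,q) are represented by invertible linear maps.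
  record GL (n : ℕ) : Set where
    field
      bijection : Vector n ↔ Vector n
    open Inverse bijection public using (to; from; strictlyInverseʳ)
    field
      additive    : ∀ v w → to (v ⊕ w) ≡ to v ⊕ to w
      homogeneous : ∀ c v → to (c • v) ≡ c • to v

    to-0 : to 0ᵥ ≡ 0ᵥ
    to-0 = trans (cong to (sym (0•v≡0 0ᵥ)))
                 (trans (homogeneous 0# 0ᵥ) (0•v≡0 (to 0ᵥ)))

  infixr 7 _·_

  _·_ : ∀ {n} → GL (suc n) → Point n → Point n
  g · ⟨ v , v≢0 ⟩ = ⟨ to v , gv≢0 ⟩
    where
    open GL g
    gv≢0 : to v ≢ 0ᵥ
    gv≢0 gv≡0 = v≢0 (trans (sym (strictlyInverseʳ v))
      (trans (cong from (trans gv≡0 (sym to-0))) (strictlyInverseʳ 0ᵥ)))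

  _maps_onto_ : ∀ {n} → GL (suc n) → PointSet n → PointSet n → Set
  g maps U onto W = ∀ P → (P ∈ U) ⇔ (g · P ∈ W)

  PGL-Equivalent : ∀ {n} → PointSet n → PointSet n → Set
  PGL-Equivalent {n} U W = Σ[ g ∈ GL (suc n) ] g maps U onto W

IsUnital : (q : ℕ) (K : FiniteField (q ℕ.^ 2)) → Projective.PointSet K 2 → Set
IsUnital q K U =
  HasSize (_∈ U) (q ℕ.^ 3 ℕ.+ 1) ×
  (∀ (l : Flat 1 2) →
    HasSize (λ P → P ∈ U × P ∈ᶠ l) 1 ⊎
    HasSize (λ P → P ∈ U × P ∈ᶠ l) (q ℕ.+ 1))
  where open Projective K

module _ {q : ℕ} (F : FiniteField q) where
  open Projective F

  record IsLineSpread (H : Flat 3 4) (S : Pred (Flat 1 4) 0ℓ) : Set where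
    field
      resp   : ∀ {l m} → l ≈ᶠ m → S l → S m
      inside : ∀ {l} → S l → l ⊆ᶠ H
      covers : ∀ P → P ∈ᶠ H → ∃[ l ] (S l × P ∈ᶠ l)
      unique : ∀ {l m} P → S l → S m → P ∈ᶠ l → P ∈ᶠ m → l ≈ᶠ m

  -- A line spread is Desarguesian if it arises from PG(1,q²) by field
  -- reduction: for some F-linear identification θ of K² with the vector space
  -- underlying H, the spread lines are the images of the points K·w of PG(1,q²).
  record IsDesarguesian (K : FiniteField (q ℕ.^ 2)) (ι : Embedding F K)
                        (H : Flat 3 4) (S : Pred (Flat 1 4) 0ℓ) : Set where
    private
      module K = Projective K
    open Embedding ι
    field
      θ           : K.Vector 2 → Vector 5
      additive    : ∀ v w → θ (v K.⊕ w) ≡ θ v ⊕ θ w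
      homogeneous : ∀ c v → θ (⟦ c ⟧ K.• v) ≡ c • θ v
      injective   : ∀ {v w} → θ v ≡ θ w → v ≡ w
      image       : ∀ v → Span (basis H) v ⇔ (∃[ w ] θ w ≡ v)
      spread      : ∀ l → S l ⇔
        (Σ[ w ∈ K.Point 1 ] (∀ v → Span (basis l) v ⇔ (∃[ k ] θ (k K.• K.rep w) ≡ v)))

  -- H and S play the roles of Σ and 𝒮.
  module _ (H : Flat 3 4) (S : Pred (Flat 1 4) 0ℓ) where

    data ABBPoint : Set where
      affine : (P : Point 4) → ¬ P ∈ᶠ H → ABBPoint
      ideal  : (l : Flat 1 4) → S l → ABBPoint

    record ABBPlane : Set where
      field
        plane      : Flat 2 4
        ⊈H         : ¬ plane ⊆ᶠ H
        spreadLine : Flat 1 4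
        inSpread   : S spreadLine
        meet       : ∀ P → (P ∈ᶠ plane × P ∈ᶠ H) ⇔ P ∈ᶠ spreadLine
    open ABBPlane

    data ABBLine : Set where
      ℓ∞     : ABBLine
      planar : ABBPlane → ABBLine

    _≈ₚ_ : ABBPoint → ABBPoint → Set
    affine P _ ≈ₚ affine Q _ = P ~ Q
    affine _ _ ≈ₚ ideal _ _  = ⊥
    ideal _ _  ≈ₚ affine _ _ = ⊥
    ideal l _  ≈ₚ ideal m _  = l ≈ᶠ m

    _≈ₗ_ : ABBLine → ABBLine → Set
    ℓ∞       ≈ₗ ℓ∞       = ⊤
    ℓ∞       ≈ₗ planar _ = ⊥
    planar _ ≈ₗ ℓ∞       = ⊥
    planar π ≈ₗ planar ρ = plane π ≈ᶠ plane ρ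

    _incident_ : ABBPoint → ABBLine → Set
    affine _ _ incident ℓ∞       = ⊥
    ideal _ _  incident ℓ∞       = ⊤
    affine P _ incident planar π = P ∈ᶠ plane π
    ideal l _  incident planar π = l ⊆ᶠ plane π

    private
      ≈ₚ-refl : ∀ {x} → x ≈ₚ x
      ≈ₚ-refl {affine _ _} = ∝-refl
      ≈ₚ-refl {ideal l _}  = ≈ᶠ-refl l

      ≈ₚ-sym : ∀ {x y} → x ≈ₚ y → y ≈ₚ x
      ≈ₚ-sym {affine _ _} {affine _ _} = ∝-sym
      ≈ₚ-sym {ideal l _}  {ideal m _}  = ≈ᶠ-sym l m

      ≈ₚ-trans : ∀ {x y z} → x ≈ₚ y → y ≈ₚ z → x ≈ₚ z
      ≈ₚ-trans {affine _ _} {affine _ _} {affine _ _} = ∝-trans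
      ≈ₚ-trans {ideal l _}  {ideal m _}  {ideal n _}  = ≈ᶠ-trans l m n

      ≈ₗ-refl : ∀ {x} → x ≈ₗ x
      ≈ₗ-refl {ℓ∞}       = tt
      ≈ₗ-refl {planar π} = ≈ᶠ-refl (plane π)

      ≈ₗ-sym : ∀ {x y} → x ≈ₗ y → y ≈ₗ x
      ≈ₗ-sym {ℓ∞}       {ℓ∞}       = id
      ≈ₗ-sym {planar π} {planar ρ} = ≈ᶠ-sym (plane π) (plane ρ)

      ≈ₗ-trans : ∀ {x y z} → x ≈ₗ y → y ≈ₗ z → x ≈ₗ z
      ≈ₗ-trans {ℓ∞}       {ℓ∞}       {ℓ∞}       = λ _ → id
      ≈ₗ-trans {planar π} {planar ρ} {planar τ} =
        ≈ᶠ-trans (plane π) (plane ρ) (plane τ)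

      incident-resp : ∀ {p p′ l l′} → p ≈ₚ p′ → l ≈ₗ l′ → p incident l → p′ incident l′
      incident-resp {ideal _ _} {ideal _ _} {ℓ∞} {ℓ∞} _ _ = id
      incident-resp {affine P _} {affine Q _} {planar π} {planar ρ} P~Q (π⊆ρ , _) P∈π =
        π⊆ρ Q (Span-resp (basis (plane π)) P~Q P∈π)
      incident-resp {ideal l _} {ideal m _} {planar π} {planar ρ} (_ , m⊆l) (π⊆ρ , _) l⊆π P =
        π⊆ρ P ∘ l⊆π P ∘ m⊆l P

    ABB : IncidenceStructure
    ABB = record
      { points = record
        { Carrier = ABBPoint
        ; _≈_     = _≈ₚ_
        ; isEquivalence = record
          { refl  = λ {x} → ≈ₚ-refl {x}
          ; sym   = λ {x} {y} → ≈ₚ-sym {x} {y}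
          ; trans = λ {x} {y} {z} → ≈ₚ-trans {x} {y} {z}
          }
        }
      ; lines = record
        { Carrier = ABBLine
        ; _≈_     = _≈ₗ_
        ; isEquivalence = record
          { refl  = λ {x} → ≈ₗ-refl {x}
          ; sym   = λ {x} {y} → ≈ₗ-sym {x} {y}
          ; trans = λ {x} {y} {z} → ≈ₗ-trans {x} {y} {z}
          }
        }
      ; _I_    = _incident_
      ; I-resp = λ {p} {p′} {l} {l′} → incident-resp {p} {p′} {l} {l′}
      }

module _ {q : ℕ} (F : FiniteField q) where
  open FiniteField F
  open Projective F

  -- {(0,0,0,1)} ∪ {(1,s,t,s^{σ+2}+t^σ+st)} with σ = 2^{e+1}
  standardTitsOvoid : (e : ℕ) → PointSet 3
  standardTitsOvoid e = record
    { mem  = λ P →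
        (rep P ∝ 0# ∷ 0# ∷ 0# ∷ 1# ∷ []) ⊎
        (∃[ s ] ∃[ t ] rep P ∝ 1# ∷ s ∷ t ∷ (s ^ (σ ℕ.+ 2) + t ^ σ + s * t) ∷ [])
    ; resp = λ where
        P~Q (inj₁ p)           → inj₁ (∝-trans (∝-sym P~Q) p)
        P~Q (inj₂ (s , t , p)) → inj₂ (s , t , ∝-trans (∝-sym P~Q) p)
    }
    where
    σ : ℕ
    σ = 2 ℕ.^ (e ℕ.+ 1)

  IsTitsOvoid : (e : ℕ) → PointSet 3 → Set
  IsTitsOvoid e O = PGL-Equivalent (standardTitsOvoid e) O

  -- A cone in PG(4,q) with vertex a point V and base a Tits ovoid of a
  -- hyperplane not through V; the latter is identified with PG(3,q) by means of
  -- its basis.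
  record TitsCone (e : ℕ) : Set₁ where
    field
      vertex        : Point 4
      hyperplane    : Flat 3 4
      vertex∉       : ¬ vertex ∈ᶠ hyperplane
      ovoid         : PointSet 3
      isTitsOvoid   : IsTitsOvoid e ovoid

    embed : Point 3 → Point 4
    embed X = ⟨ lincomb (rep X) (basis hyperplane)
              , nonzero X ∘ independent hyperplane (rep X) ⟩

    _∈ᶜ : Point 4 → Set
    P ∈ᶜ = Σ[ X ∈ Point 3 ] (X ∈ ovoid × Span (rep vertex ∷ rep (embed X) ∷ []) (rep P))

record IsBuekenhoutTitsUnital
         {q : ℕ} (e : ℕ) (F : FiniteField q) (K : FiniteField (q ℕ.^ 2))
         (ι : Embedding F K) (U : Projective.PointSet K 2) : Set₁ where
  open Projective F
  private
    module K = Projective K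
  field
    isUnital       : IsUnital q K U
    H              : Flat 3 4
    S              : Pred (Flat 1 4) 0ℓ
    isLineSpread   : IsLineSpread F H S
    isDesarguesian : IsDesarguesian F K ι H S
    model          : IncidenceIsomorphism (ABB F H S) K.PG2
    cone           : TitsCone F e
  open IncidenceIsomorphism model
  open TitsCone cone
  field
    axis           : Flat 1 4
    axis∈S         : S axis
    cone∩H         : ∀ P → (P ∈ᶜ × P ∈ᶠ H) ⇔ P ∈ᶠ axis
    affinePart     : ∀ P P∉H → (onPoints (affine P P∉H) K.∈ U) ⇔ P ∈ᶜ
    idealPart      : ∀ l l∈S → (onPoints (ideal l l∈S) K.∈ U) ⇔ l ≈ᶠ axis

{-# OPTIONS --safe #-}
module Submission where

-- Write q = 2^(2e+1), σ = 2^(e+1) and f(s,t) = s^(σ+2) + t^σ + st. In the field F of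
-- order q the map x ↦ x^σ is an automorphism whose square is x ↦ x². It is shown that
-- every Buekenhout-Tits unital is the image under a projectivity of the set of the
-- points (0,0,1) and (1, t + sω₀, v + f(s,t)ω₀) with s, t, v in F, for one fixed
-- ω₀ in K but not in F. The argument has four parts.
--
-- Cone. The vertex V is on H, since otherwise projection from V would map the axis,
-- which is all of the intersection of the cone with H, to a line through three
-- noncollinear points of the ovoid. So H contains exactly one generator of the cone.
-- The Suzuki group is transitive on the ovoid (ovoid-transitive), hence this generator
-- may be taken over the point (0,0,0,1). Then H is the hyperplane w = 0 of the
-- coordinates (v,w,x,y,z) and the cone has the points (v,1,s,t,f(s,t)) outside H
-- (coneCoordinates).
--
-- Multiplication by ω. The spread makes H a vector space over K in which the axis is
-- a line Kw. Given ω in K but not in F, the translations and homotheties in the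
-- stabiliser of the cone, together with changes along V, allow coordinates in which the
-- second pair of unit vectors of H is w, ωw and the first pair is u, ωu. So the affine
-- points of the cone are f₀ + (t + sω)u + (v + f(s,t)ω)w (Normalised). Two
-- of the parameters solve na^σ = m and nκ^σ = 1, where ωf₂ = nf₁ + mf₂ modulo the axis
-- in the original coordinates, and a third one absorbs the last coordinate of ωu.
--
-- Model. An isomorphism of the André/Bruck-Bose plane onto PG(2,q²) is given in
-- coordinates over K by a semilinear map with some companion automorphism τ
-- (model-affine, model-ideal). As usual one moves a frame to the standard frame
-- by a linear map; what remains acts as φ on both coordinate axes, and lines of slope 1
-- and lines through the origin show that φ is additive and multiplicative.
--
-- Conclusion. F consists of the solutions of x^q = x, so τ maps F to itself, and f has
-- coefficients in the prime field, so τ commutes with f. Choosing ω with τ(ω) = ω₀, the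
-- unital is the image under a linear map of the standard one.
--
-- All dimension arguments are made by counting vectors, and since the characteristic
-- is 2, subtraction is addition.

open import Defs
open import Algebra.Bundles using (CommutativeRing; RawRing)
open import Algebra.Morphism.Structures using (IsRingHomomorphism)
import Algebra.Properties.CommutativeMonoid.Sum as Sum
import Algebra.Properties.CommutativeSemiring.Exp as Exp
import Algebra.Properties.Semiring.Mult as Mult
import Algebra.Solver.Ring as RingSolver
open import Algebra.Solver.Ring.AlmostCommutativeRing
  using (AlmostCommutativeRing; fromCommutativeSemiring; _-Raw-AlmostCommutative⟶_)
open import Data.Bool.Base using (Bool; true; false; _xor_; _∧_)
open import Data.Empty using (⊥; ⊥-elim)
open import Data.Fin.Base using (Fin; zero; suc; punchIn; punchOut)
import Data.Fin.Properties as Fin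
open import Data.Maybe.Base using (Maybe; just; nothing)
open import Data.Nat.Base using (ℕ; zero; suc; _<_; _≤_)
import Data.Nat.Base as ℕ
import Data.Nat.Properties as ℕ
open import Data.Product.Base using (_×_; _,_; proj₁; proj₂; ∃-syntax; Σ-syntax)
open import Data.Product.Function.NonDependent.Propositional using (_×-↔_)
open import Data.Sum.Base using (_⊎_; inj₁; inj₂)
open import Data.Unit.Base using (tt)
open import Data.Vec.Base using (Vec; []; _∷_; map)
import Data.Vec.Properties as Vec
open import Data.Vec.Relation.Unary.All as All using (All; []; _∷_)
open import Function.Base using (_∘_; id)
open import Function.Bundles using (Equivalence; Inverse; _↔_; _⇔_; mk↔ₛ′; mk⇔)
open import Function.Construct.Composition using (_↔-∘_)
open import Function.Construct.Symmetry using (↔-sym)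
open import Level using (0ℓ)
open import Relation.Binary.Bundles using (Setoid)
open import Relation.Binary.PropositionalEquality
  using (_≡_; _≢_; refl; sym; trans; cong; cong₂; subst; module ≡-Reasoning)
open import Relation.Nullary.Decidable using (Dec; yes; no; map′; _×-dec_; ¬?)
open import Relation.Nullary.Negation using (¬_; contradiction)
open import Relation.Unary using (Pred)

-- Counting in finite sets

module _ {A : Set} {n : ℕ} (A↔n : A ↔ Fin n) where
  private module A = Inverse A↔n

  index-injective : ∀ {x y} → A.to x ≡ A.to y → x ≡ y
  index-injective {x} {y} eq =
    trans (sym (A.strictlyInverseʳ x)) (trans (cong A.from eq) (A.strictlyInverseʳ y))

  enum-injective : ∀ {i j} → A.from i ≡ A.from j → i ≡ j
  enum-injective {i} {j} eq =
    trans (sym (A.strictlyInverseˡ i)) (trans (cong A.to eq) (A.strictlyInverseˡ j))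

  -- Only the existence of the following decisions and witnesses matters.
  opaque
    finite-≟ : (x y : A) → Dec (x ≡ y)
    finite-≟ x y = map′ index-injective (cong A.to) (A.to x Fin.≟ A.to y)

    finite-any? : {P : A → Set} → (∀ x → Dec (P x)) → Dec (∃[ x ] P x)
    finite-any? {P} P? = map′
      (λ (i , p) → A.from i , p)
      (λ (x , p) → A.to x , subst P (sym (A.strictlyInverseʳ x)) p)
      (Fin.any? (P? ∘ A.from))

    finite-counterexample : {P : A → Set} → (∀ x → Dec (P x)) → ¬ (∀ x → P x) → ∃[ x ] ¬ P x
    finite-counterexample {P} P? ¬∀ =
      let i , ¬p = Fin.¬∀⟶∃¬ n (P ∘ A.from) (P? ∘ A.from)
                     (λ ∀p → ¬∀ λ x → subst P (A.strictlyInverseʳ x) (∀p (A.to x)))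
      in A.from i , ¬p

finite-≤ : {A B : Set} {m n : ℕ} → A ↔ Fin m → B ↔ Fin n →
           (f : A → B) → (∀ {x y} → f x ≡ f y → x ≡ y) → m ≤ n
finite-≤ A↔m B↔n f inj = Fin.injective⇒≤ {f = B.to ∘ f ∘ A.from} λ eq →
  enum-injective A↔m (inj (index-injective B↔n eq))
  where
  module A = Inverse A↔m
  module B = Inverse B↔n

Fin-injective⇒surjective : ∀ {n} (f : Fin n → Fin n) → (∀ {i j} → f i ≡ f j → i ≡ j) →
                           ∀ y → ∃[ x ] f x ≡ y
Fin-injective⇒surjective {suc n} f inj y with Fin.any? (λ x → f x Fin.≟ y)
... | yes found = found
... | no ¬found = contradiction
  (Fin.injective⇒≤ {f = λ i → punchOut (y≢ i)}
    (λ {i} {j} eq → inj (Fin.punchOut-injective (y≢ i) (y≢ j) eq)))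
  ℕ.1+n≰n
  where
  y≢ : ∀ i → y ≢ f i
  y≢ i eq = ¬found (i , sym eq)

opaque
  injective⇒surjective : {A B : Set} {n : ℕ} → A ↔ Fin n → B ↔ Fin n →
    (f : A → B) → (∀ {x y} → f x ≡ f y → x ≡ y) → ∀ y → ∃[ x ] f x ≡ y
  injective⇒surjective A↔n B↔n f inj y =
    let i , eq = Fin-injective⇒surjective (B.to ∘ f ∘ A.from)
                   (λ eq → enum-injective A↔n (inj (index-injective B↔n eq))) (B.to y)
    in A.from i , index-injective B↔n eq
    where
    module A = Inverse A↔n
    module B = Inverse B↔n

Vec-enumeration : {A : Set} {q : ℕ} → A ↔ Fin q → ∀ n → Vec A n ↔ Fin (q ℕ.^ n)
Vec-enumeration A↔q zero    = mk↔ₛ′ (λ _ → zero) (λ _ → []) (λ { zero → refl }) (λ { [] → refl })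
Vec-enumeration {A} A↔q (suc n) =
  ↔-sym Fin.*↔× ↔-∘ ((A↔q ×-↔ Vec-enumeration A↔q n) ↔-∘ uncons)
  where
  uncons : Vec A (suc n) ↔ (A × Vec A n)
  uncons = mk↔ₛ′ (λ { (x ∷ xs) → x , xs }) (λ { (x , xs) → x ∷ xs })
                 (λ _ → refl) (λ { (x ∷ xs) → refl })

-- Finite fields

module FieldProperties {q : ℕ} (F : FiniteField q) where
  open FiniteField F
  open CommutativeRing commutativeRing public
    using (commutativeSemiring; +-assoc; +-comm; +-identityˡ; +-identityʳ; *-identityʳ; distribʳ; -‿inverseʳ)
  open Exp commutativeSemiring public using (^-homo-*; ^-assocʳ; ^-distrib-*)
  open Projective F public using (*-≢0)
  open ≡-Reasoning

  private
    module R = CommutativeRing commutativeRing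
    module Sums = Sum R.+-commutativeMonoid
    module Prods = Sum R.*-commutativeMonoid
    module E = Inverse enumeration
    module M = Mult R.semiring
    open M using () renaming (_×_ to _×ₙ_)

  infix 4 _≟_
  _≟_ : (x y : Carrier) → Dec (x ≡ y)
  _≟_ = finite-≟ enumeration

  1≢0 : 1# ≢ 0#
  1≢0 = 0≢1 ∘ sym

  *-cancelˡ : ∀ {c x y} → c ≢ 0# → c * x ≡ c * y → x ≡ y
  *-cancelˡ {c} {x} {y} c≢0 eq = let d , cd≡1 = invertible c c≢0 in
    let undo : ∀ z → d * (c * z) ≡ z
        undo z = trans (sym (*-assoc d c z))
                       (trans (cong (_* z) (trans (*-comm d c) cd≡1)) (*-identityˡ z))
    in trans (sym (undo x)) (trans (cong (d *_) eq) (undo y))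

  ^-≢0 : ∀ {x} n → x ≢ 0# → x ^ n ≢ 0#
  ^-≢0 zero    x≢0 = 1≢0
  ^-≢0 (suc n) x≢0 = *-≢0 x≢0 (^-≢0 n x≢0)

  ^-≡0 : ∀ {x} n → x ^ n ≡ 0# → x ≡ 0#
  ^-≡0 {x} n eq with x ≟ 0#
  ... | yes x≡0 = x≡0
  ... | no x≢0  = contradiction eq (^-≢0 n x≢0)

  *-≡0 : ∀ {x y} → x * y ≡ 0# → x ≢ 0# → y ≡ 0#
  *-≡0 {x} {y} eq x≢0 = *-cancelˡ x≢0 (trans eq (sym (zeroʳ x)))

  1<q : 1 < q
  1<q = finite-≤ {A = Fin 2} (mk↔ₛ′ id id (λ _ → refl) (λ _ → refl)) enumeration
    (λ { zero → 0# ; (suc _) → 1# })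
    λ { {zero} {zero} _ → refl ; {zero} {suc zero} eq → contradiction eq 0≢1
      ; {suc zero} {zero} eq → contradiction (sym eq) 0≢1 ; {suc zero} {suc zero} _ → refl }

  -- The sum of all elements is invariant under the translation by 1.
  q×1≡0 : q ×ₙ 1# ≡ 0#
  q×1≡0 = begin
    q ×ₙ 1#                        ≡⟨ +-identityˡ _ ⟨
    0# + q ×ₙ 1#                   ≡⟨ cong (_+ q ×ₙ 1#) (trans (+-comm _ _) (-‿inverseʳ S)) ⟨
    - S + S + q ×ₙ 1#              ≡⟨ +-assoc _ _ _ ⟩
    - S + (S + q ×ₙ 1#)            ≡⟨ cong (- S +_) S≡S+q ⟨
    - S + S                        ≡⟨ trans (+-comm _ _) (-‿inverseʳ S) ⟩
    0#                             ∎
    where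
    S : Carrier
    S = Sums.sum E.from
    translate : Carrier ↔ Carrier
    translate = mk↔ₛ′ (_+ 1#) (_+ - 1#)
      (λ x → trans (+-assoc x _ _) (trans (cong (x +_) (trans (+-comm _ _) (-‿inverseʳ 1#))) (+-identityʳ x)))
      (λ x → trans (+-assoc x _ _) (trans (cong (x +_) (-‿inverseʳ 1#)) (+-identityʳ x)))
    S≡S+q : S ≡ S + q ×ₙ 1#
    S≡S+q = begin
      S  ≡⟨ Sums.sum-permute E.from (enumeration ↔-∘ (translate ↔-∘ ↔-sym enumeration)) ⟩
      Sums.sum (λ i → E.from (E.to (E.from i + 1#)))
        ≡⟨ Sums.sum-cong-≗ {n = q} (λ i → E.strictlyInverseʳ (E.from i + 1#)) ⟩
      Sums.sum (λ i → E.from i + 1#)           ≡⟨ Sums.∑-distrib-+ E.from (λ _ → 1#) ⟩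
      S + Sums.sum {q} (λ _ → 1#)              ≡⟨ cong (S +_) (Sums.sum-replicate q) ⟩
      S + q ×ₙ 1#                           ∎

  -- By q×1≡0, (1 + 1)^n = 0.
  characteristic-2 : ∀ n → q ≡ 2 ℕ.^ n → 1# + 1# ≡ 0#
  characteristic-2 n refl with 1# + 1# ≟ 0#
  ... | yes eq = eq
  ... | no 2≢0 = contradiction q×1≡0 (go n)
    where
    go : ∀ m → (2 ℕ.^ m) ×ₙ 1# ≢ 0#
    go zero    eq = 1≢0 (trans (sym (+-identityʳ 1#)) eq)
    go (suc m) eq = *-≢0 (2≢0 ∘ trans (cong (1# +_) (sym (+-identityʳ 1#)))) (go m)
      (trans (sym (M.×1-homo-* 2 (2 ℕ.^ m))) eq)

  -- Multiplication by a nonzero x permutes the nonzero elements; compare their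
  -- products. Here ν turns the factor 0 into 1, and c is the ratio ν(xy)/ν(y).
  ^q≡id : ∀ x → x ^ q ≡ x
  ^q≡id x with x ≟ 0#
  ... | yes refl = case0 q 1<q
    where
    case0 : ∀ n → 1 < n → 0# ^ n ≡ 0#
    case0 (suc n) _ = zeroˡ _
  ... | no x≢0 = fromProduct q enumeration c-product
    where
    x⁻¹ : Carrier
    x⁻¹ = proj₁ (invertible x x≢0)
    xx⁻¹ : x * x⁻¹ ≡ 1#
    xx⁻¹ = proj₂ (invertible x x≢0)

    scale : Carrier ↔ Carrier
    scale = mk↔ₛ′ (x *_) (x⁻¹ *_)
      (λ y → trans (sym (*-assoc x x⁻¹ y)) (trans (cong (_* y) xx⁻¹) (*-identityˡ y)))
      (λ y → trans (sym (*-assoc x⁻¹ x y))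
               (trans (cong (_* y) (trans (*-comm x⁻¹ x) xx⁻¹)) (*-identityˡ y)))

    ν c : Carrier → Carrier
    ν y with y ≟ 0#
    ... | yes _ = 1#
    ... | no _  = y
    c y with y ≟ 0#
    ... | yes _ = 1#
    ... | no _  = x

    ν≢0 : ∀ y → ν y ≢ 0#
    ν≢0 y with y ≟ 0#
    ... | yes _  = 1≢0
    ... | no y≢0 = y≢0

    c≡x : ∀ y → y ≢ 0# → c y ≡ x
    c≡x y y≢0 with y ≟ 0#
    ... | yes y≡0 = contradiction y≡0 y≢0
    ... | no _    = refl

    c0≡1 : c 0# ≡ 1#
    c0≡1 with 0# ≟ 0#
    ... | yes _   = refl
    ... | no 0≢0 = contradiction refl 0≢0

    ν-scale : ∀ y → ν (x * y) ≡ c y * ν y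
    ν-scale y with y ≟ 0# | x * y ≟ 0#
    ... | yes _    | yes _   = sym (*-identityˡ 1#)
    ... | yes refl | no xy≢0 = contradiction (zeroʳ x) xy≢0
    ... | no y≢0   | yes eq  = contradiction eq (*-≢0 x≢0 y≢0)
    ... | no _     | no _    = refl

    product≢0 : ∀ {n} (f : Fin n → Carrier) → (∀ i → f i ≢ 0#) → Prods.sum f ≢ 0#
    product≢0 {zero}  f f≢0 = 1≢0
    product≢0 {suc n} f f≢0 = *-≢0 (f≢0 zero) (product≢0 (f ∘ suc) (f≢0 ∘ suc))

    c-product : Prods.sum (c ∘ E.from) ≡ 1#
    c-product = *-cancelˡ (product≢0 (ν ∘ E.from) (ν≢0 ∘ E.from)) (begin
      P * Prods.sum (c ∘ E.from)                ≡⟨ *-comm _ _ ⟩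
      Prods.sum (c ∘ E.from) * P                ≡⟨ Prods.∑-distrib-+ (c ∘ E.from) (ν ∘ E.from) ⟨
      Prods.sum (λ i → c (E.from i) * ν (E.from i))
        ≡⟨ Prods.sum-cong-≗ {n = q} (λ i → trans (cong ν (E.strictlyInverseʳ _)) (ν-scale (E.from i))) ⟨
      Prods.sum (λ i → ν (E.from (E.to (x * E.from i))))
        ≡⟨ Prods.sum-permute (ν ∘ E.from) (enumeration ↔-∘ (scale ↔-∘ ↔-sym enumeration)) ⟨
      P                                     ≡⟨ *-identityʳ P ⟨
      P * 1#                                ∎)
      where
      P : Carrier
      P = Prods.sum (ν ∘ E.from)

    fromProduct : ∀ n (A↔n : Carrier ↔ Fin n) → Prods.sum (c ∘ Inverse.from A↔n) ≡ 1# → x ^ n ≡ x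
    fromProduct zero    A↔n _  = ⊥-elim (Fin.¬Fin0 (Inverse.to A↔n 0#))
    fromProduct (suc n) A↔n eq = begin
      x * x ^ n                       ≡⟨ cong (x *_) (Prods.sum-replicate n) ⟨
      x * Prods.sum {n} (λ _ → x)         ≡⟨ cong (x *_) (Prods.sum-cong-≗ {n = n} λ j →
        c≡x _ λ from≡0 → Fin.punchInᵢ≢i i₀ j
          (trans (sym (A.strictlyInverseˡ _)) (cong A.to from≡0))) ⟨
      x * Prods.sum (c ∘ A.from ∘ punchIn i₀) ≡⟨ cong (x *_) (*-identityˡ _) ⟨
      x * (1# * Prods.sum (c ∘ A.from ∘ punchIn i₀))
        ≡⟨ cong (λ z → x * (z * Prods.sum (c ∘ A.from ∘ punchIn i₀)))
             (trans (cong c (A.strictlyInverseʳ 0#)) c0≡1) ⟨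
      x * (c (A.from i₀) * Prods.sum (c ∘ A.from ∘ punchIn i₀))
        ≡⟨ cong (x *_) (Prods.sum-remove {i = i₀} (c ∘ A.from)) ⟨
      x * Prods.sum (c ∘ A.from)          ≡⟨ cong (x *_) eq ⟩
      x * 1#                          ≡⟨ *-identityʳ x ⟩
      x                               ∎
      where
      module A = Inverse A↔n
      i₀ : Fin (suc n)
      i₀ = A.to 0#

-- Fields of characteristic 2

module Characteristic2 {q : ℕ} (F : FiniteField q)
                       (1+1≡0 : FiniteField._+_ F (FiniteField.1# F) (FiniteField.1# F) ≡ FiniteField.0# F) where
  open FiniteField F
  open FieldProperties F
  open ≡-Reasoning

  -- A solver for polynomial identities that hold modulo 2.
  private
    𝔽₂ : RawRing 0ℓ 0ℓ
    𝔽₂ = record { Carrier = Bool ; _≈_ = _≡_ ; _+_ = _xor_ ; _*_ = _∧_ ; -_ = id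
                ; 0# = false ; 1# = true }
    ring : AlmostCommutativeRing 0ℓ 0ℓ
    ring = fromCommutativeSemiring commutativeSemiring
    prime-field : Bool → Carrier
    prime-field true  = 1#
    prime-field false = 0#
    morphism : 𝔽₂ -Raw-AlmostCommutative⟶ ring
    morphism = record
      { ⟦_⟧    = prime-field
      ; +-homo = λ { true true → sym 1+1≡0 ; true false → sym (+-identityʳ 1#)
                   ; false y → sym (+-identityˡ _) }
      ; *-homo = λ { true y → sym (*-identityˡ _) ; false y → sym (zeroˡ _) }
      ; -‿homo = λ _ → refl
      ; 0-homo = refl
      ; 1-homo = refl
      }
    weak-≟ : ∀ a b → Maybe (prime-field a ≡ prime-field b)
    weak-≟ true  true  = just refl
    weak-≟ false false = just refl
    weak-≟ _     _     = nothing

  open RingSolver 𝔽₂ ring morphism weak-≟ public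
    using (solve; con; _:=_; _:+_; _:*_)

  x+x≡0 : ∀ x → x + x ≡ 0#
  x+x≡0 = solve 1 (λ x → x :+ x := con false) refl

  +-cancelˡ : ∀ c {x y} → c + x ≡ c + y → x ≡ y
  +-cancelˡ c {x} {y} eq = trans (undo x) (trans (cong (c +_) eq) (sym (undo y)))
    where
    undo : ∀ z → z ≡ c + (c + z)
    undo z = solve 2 (λ c z → z := c :+ (c :+ z)) refl c z

  +≡0⇒≡ : ∀ {x y} → x + y ≡ 0# → x ≡ y
  +≡0⇒≡ {x} {y} eq = +-cancelˡ y (trans (+-comm y x) (trans eq (sym (x+x≡0 y))))

  ^2≡ : ∀ x → x ^ 2 ≡ x * x
  ^2≡ x = cong (x *_) (*-identityʳ x)

  frobenius-+ : ∀ n x y → (x + y) ^ (2 ℕ.^ n) ≡ x ^ (2 ℕ.^ n) + y ^ (2 ℕ.^ n)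
  frobenius-+ zero    x y = trans (*-identityʳ _) (sym (cong₂ _+_ (*-identityʳ x) (*-identityʳ y)))
  frobenius-+ (suc n) x y = begin
    (x + y) ^ (2 ℕ.* N)       ≡⟨ ^-assocʳ (x + y) 2 N ⟨
    ((x + y) ^ 2) ^ N         ≡⟨ cong (_^ N) (solve 2 (λ x y →
                                   (x :+ y) :* ((x :+ y) :* con true) :=
                                   x :* (x :* con true) :+ y :* (y :* con true)) refl x y) ⟩
    (x ^ 2 + y ^ 2) ^ N       ≡⟨ frobenius-+ n (x ^ 2) (y ^ 2) ⟩
    (x ^ 2) ^ N + (y ^ 2) ^ N ≡⟨ cong₂ _+_ (^-assocʳ x 2 N) (^-assocʳ y 2 N) ⟩
    x ^ (2 ℕ.* N) + y ^ (2 ℕ.* N) ∎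
    where
    N : ℕ
    N = 2 ℕ.^ n

  frobenius-surjective : ∀ n y → ∃[ x ] x ^ (2 ℕ.^ n) ≡ y
  frobenius-surjective n = injective⇒surjective enumeration enumeration (_^ (2 ℕ.^ n))
    λ {x} {y} eq → +≡0⇒≡ (^-≡0 (2 ℕ.^ n)
      (trans (frobenius-+ n x y) (trans (cong (_+ _) eq) (x+x≡0 _))))

  -- Monic n f: the function f is given by a monic polynomial of degree n.
  data Monic : ℕ → (Carrier → Carrier) → Set where
    one  : ∀ {f} → (∀ x → f x ≡ 1#) → Monic 0 f
    step : ∀ {n f g} (a : Carrier) → Monic n g → (∀ x → f x ≡ a + x * g x) → Monic (suc n) f

  Monic-add : ∀ {n f g} r → Monic (suc n) f → Monic n g → Monic (suc n) (λ x → f x + r * g x)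
  Monic-add r (step a g₁ eq) (one eq′) = step (a + r) g₁ λ x →
    trans (cong₂ (λ u v → u + r * v) (eq x) (eq′ x))
      (solve 4 (λ a b x r → (a :+ x :* b) :+ r :* con true := (a :+ r) :+ x :* b) refl a _ x r)
  Monic-add r (step a g₁ eq) (step b g₂ eq′) = step (a + r * b) (Monic-add r g₁ g₂) λ x →
    trans (cong₂ (λ u v → u + r * v) (eq x) (eq′ x))
      (solve 6 (λ a b x r g h → (a :+ x :* g) :+ r :* (b :+ x :* h) :=
         (a :+ r :* b) :+ x :* (g :+ r :* h)) refl a b x r _ _)

  -- Division by x - r.
  Monic-divide : ∀ {n f} r → Monic (suc n) f →
                 ∃[ g ] (Monic n g × (∀ x → f x ≡ f r + (x + r) * g x))
  Monic-divide {f = f} r (step {g = g} a (one eq′) eq) = (λ _ → 1#) , one (λ _ → refl) , λ x → begin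
    f x                             ≡⟨ trans (eq x) (cong (λ z → a + x * z) (eq′ x)) ⟩
    a + x * 1#                      ≡⟨ solve 3 (λ a x r → a :+ x :* con true :=
                                         (a :+ r :* con true) :+ (x :+ r) :* con true) refl a x r ⟩
    (a + r * 1#) + (x + r) * 1#     ≡⟨ cong (_+ (x + r) * 1#)
                                         (trans (eq r) (cong (λ z → a + r * z) (eq′ r))) ⟨
    f r + (x + r) * 1#              ∎
  Monic-divide {suc n} {f} r (step {g = g} a G@(step _ _ _) eq) =
    let h , H , gh = Monic-divide r G in
    (λ x → g x + r * h x) , Monic-add r G H , λ x → begin
      f x                                   ≡⟨ eq x ⟩
      a + x * g x                           ≡⟨ cong (λ z → a + x * z) (gh x) ⟩
      a + x * (g r + (x + r) * h x)         ≡⟨ solve 5 (λ a x r u v →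
          a :+ x :* (u :+ (x :+ r) :* v) :=
          (a :+ r :* u) :+ (x :+ r) :* ((u :+ (x :+ r) :* v) :+ r :* v)) refl a x r (g r) (h x) ⟩
      (a + r * g r) + (x + r) * ((g r + (x + r) * h x) + r * h x)
        ≡⟨ cong₂ (λ u v → u + (x + r) * (v + r * h x)) (eq r) (gh x) ⟨
      f r + (x + r) * (g x + r * h x)       ∎

  -- A monic polynomial of degree n does not have n + 1 distinct roots.
  Monic-roots : ∀ {n f} → Monic n f → (r : Fin (suc n) → Carrier) →
                (∀ {i j} → r i ≡ r j → i ≡ j) → (∀ i → f (r i) ≡ 0#) → ⊥
  Monic-roots (one eq) r _ root = 1≢0 (trans (sym (eq (r zero))) (root zero))
  Monic-roots {suc n} {f} M@(step _ _ _) r inj root =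
    let g , G , fg = Monic-divide (r zero) M in
    Monic-roots G (r ∘ suc) (Fin.suc-injective ∘ inj) λ i → *-≡0
      (+-cancelˡ (f (r zero)) (trans (sym (fg (r (suc i))))
        (trans (root (suc i)) (trans (sym (root zero)) (sym (+-identityʳ _))))))
      λ eq → Fin.0≢1+n (sym (inj (+≡0⇒≡ eq)))

  Monic-xⁿ+x : ∀ n → Monic (suc (suc n)) (λ x → x ^ suc (suc n) + x)
  Monic-xⁿ+x n = step 0# (step 1# (power n) (λ _ → refl)) λ x →
    solve 2 (λ x y → x :* (x :* y) :+ x := con false :+ x :* (con true :+ x :* y)) refl x (x ^ n)
    where
    power : ∀ n → Monic n (_^ n)
    power zero    = one λ _ → refl
    power (suc n) = step 0# (power n) λ x → sym (+-identityˡ _)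

  -- As xᵐ + x has at most m roots, a set of m elements fixed under x ↦ xᵐ contains
  -- every such element.
  ^m≡id⇒∈image : ∀ {m} → 1 < m → {A : Set} → A ↔ Fin m → (φ : A → Carrier) →
    (∀ {a b} → φ a ≡ φ b → a ≡ b) → (∀ a → φ a ^ m ≡ φ a) →
    ∀ x → x ^ m ≡ x → ∃[ a ] φ a ≡ x
  ^m≡id⇒∈image {suc (suc n)} _ {A} A↔m φ φ-inj φ-fix x x-fix with finite-any? A↔m (λ a → φ a ≟ x)
  ... | yes found = found
  ... | no ¬found = ⊥-elim (Monic-roots (Monic-xⁿ+x n) r r-inj r-root)
    where
    module A = Inverse A↔m
    r : Fin (suc (suc (suc n))) → Carrier
    r zero    = x
    r (suc i) = φ (A.from i)
    r-inj : ∀ {i j} → r i ≡ r j → i ≡ j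
    r-inj {zero}  {zero}  _  = refl
    r-inj {zero}  {suc j} eq = contradiction (_ , sym eq) ¬found
    r-inj {suc i} {zero}  eq = contradiction (_ , eq) ¬found
    r-inj {suc i} {suc j} eq = cong suc (enum-injective A↔m (φ-inj eq))
    r-root : ∀ i → r i ^ suc (suc n) + r i ≡ 0#
    r-root zero    = trans (cong (_+ x) x-fix) (x+x≡0 x)
    r-root (suc i) = trans (cong (_+ _) (φ-fix (A.from i))) (x+x≡0 _)
  ^m≡id⇒∈image {suc zero} (ℕ.s≤s ())

-- Embeddings of finite fields

module EmbeddingProperties {q r : ℕ} {F : FiniteField q} {K : FiniteField r} (ι : Embedding F K) where
  private
    module F = FiniteField F
    module K = FiniteField K
    module FP = FieldProperties F
    module KP = FieldProperties K
  open Embedding ι public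
  open IsRingHomomorphism isHomomorphism public using (+-homo; *-homo; 0#-homo; 1#-homo; -‿homo)

  ^-homo : ∀ x n → ⟦ x F.^ n ⟧ ≡ ⟦ x ⟧ K.^ n
  ^-homo x zero    = 1#-homo
  ^-homo x (suc n) = trans (*-homo x (x F.^ n)) (cong (⟦ x ⟧ K.*_) (^-homo x n))

  ⟦⟧-≢0 : ∀ {x} → x ≢ F.0# → ⟦ x ⟧ ≢ K.0#
  ⟦⟧-≢0 {x} x≢0 eq = let y , xy≡1 = F.invertible x x≢0 in KP.1≢0
    (trans (sym 1#-homo) (trans (cong ⟦_⟧ (sym xy≡1))
      (trans (*-homo x y) (trans (cong (K._* ⟦ y ⟧) eq) (K.zeroˡ _)))))

  injective : ∀ {x y} → ⟦ x ⟧ ≡ ⟦ y ⟧ → x ≡ y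
  injective {x} {y} eq with x F.+ (F.- y) FP.≟ F.0#
  ... | yes x-y≡0 = begin
    x                           ≡⟨ FP.+-identityʳ x ⟨
    x F.+ F.0#                  ≡⟨ cong (x F.+_) (trans (FP.+-comm _ _) (FP.-‿inverseʳ y)) ⟨
    x F.+ ((F.- y) F.+ y)       ≡⟨ FP.+-assoc x _ y ⟨
    (x F.+ (F.- y)) F.+ y       ≡⟨ cong (F._+ y) x-y≡0 ⟩
    F.0# F.+ y                  ≡⟨ FP.+-identityˡ y ⟩
    y                           ∎
    where open ≡-Reasoning
  ... | no x-y≢0 = contradiction
    (trans (+-homo x (F.- y)) (trans (cong₂ K._+_ eq (-‿homo y)) (KP.-‿inverseʳ ⟦ y ⟧)))
    (⟦⟧-≢0 x-y≢0)

  characteristic-2 : F.1# F.+ F.1# ≡ F.0# → K.1# K.+ K.1# ≡ K.0#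
  characteristic-2 eq = trans (sym (cong₂ K._+_ 1#-homo 1#-homo))
    (trans (sym (+-homo F.1# F.1#)) (trans (cong ⟦_⟧ eq) 0#-homo))

-- Linear algebra by counting: subspaces of dimension n have qⁿ vectors

module LinearAlgebra {q : ℕ} (F : FiniteField q)
                     (1+1≡0 : FiniteField._+_ F (FiniteField.1# F) (FiniteField.1# F) ≡ FiniteField.0# F) where
  open FiniteField F
  open FieldProperties F
  open Characteristic2 F 1+1≡0
  open Projective F hiding (*-≢0) public
  open ≡-Reasoning

  ⊕-comm : ∀ {n} (u v : Vector n) → u ⊕ v ≡ v ⊕ u
  ⊕-comm = Vec.zipWith-comm +-comm

  ⊕-assoc : ∀ {n} (u v w : Vector n) → (u ⊕ v) ⊕ w ≡ u ⊕ (v ⊕ w)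
  ⊕-assoc = Vec.zipWith-assoc +-assoc

  ⊕-identityˡ : ∀ {n} (v : Vector n) → 0ᵥ ⊕ v ≡ v
  ⊕-identityˡ = Vec.zipWith-identityˡ +-identityˡ

  ⊕-identityʳ : ∀ {n} (v : Vector n) → v ⊕ 0ᵥ ≡ v
  ⊕-identityʳ = Vec.zipWith-identityʳ +-identityʳ

  v⊕v≡0 : ∀ {n} (v : Vector n) → v ⊕ v ≡ 0ᵥ
  v⊕v≡0 []      = refl
  v⊕v≡0 (x ∷ v) = cong₂ _∷_ (x+x≡0 x) (v⊕v≡0 v)

  ⊕-self-inverse : ∀ {n} (u v : Vector n) → u ⊕ (u ⊕ v) ≡ v
  ⊕-self-inverse u v = trans (sym (⊕-assoc u u v)) (trans (cong (_⊕ v) (v⊕v≡0 u)) (⊕-identityˡ v))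

  ⊕≡0⇒≡ : ∀ {n} {u v : Vector n} → u ⊕ v ≡ 0ᵥ → u ≡ v
  ⊕≡0⇒≡ {u = u} {v} eq = begin
    u            ≡⟨ ⊕-identityʳ u ⟨
    u ⊕ 0ᵥ       ≡⟨ cong (u ⊕_) eq ⟨
    u ⊕ (u ⊕ v)  ≡⟨ ⊕-self-inverse u v ⟩
    v            ∎

  ⊕-interchange : ∀ {n} (a b c d : Vector n) → (a ⊕ b) ⊕ (c ⊕ d) ≡ (a ⊕ c) ⊕ (b ⊕ d)
  ⊕-interchange a b c d = begin
    (a ⊕ b) ⊕ (c ⊕ d)  ≡⟨ ⊕-assoc a b _ ⟩
    a ⊕ (b ⊕ (c ⊕ d))  ≡⟨ cong (a ⊕_) (trans (sym (⊕-assoc b c d))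
                           (trans (cong (_⊕ d) (⊕-comm b c)) (⊕-assoc c b d))) ⟩
    a ⊕ (c ⊕ (b ⊕ d))  ≡⟨ ⊕-assoc a c _ ⟨
    (a ⊕ c) ⊕ (b ⊕ d)  ∎

  •-distribʳ : ∀ {n} c d (v : Vector n) → (c + d) • v ≡ c • v ⊕ d • v
  •-distribʳ c d []      = refl
  •-distribʳ c d (x ∷ v) = cong₂ _∷_ (distribʳ x c d) (•-distribʳ c d v)

  •-cancel : ∀ {n c} {v : Vector n} → c ≢ 0# → c • v ≡ 0ᵥ → v ≡ 0ᵥ
  •-cancel {c = c} {v} c≢0 eq = let d , cd≡1 = invertible c c≢0 in begin
    v            ≡⟨ 1•v≡v v ⟨
    1# • v       ≡⟨ cong (_• v) (trans (*-comm d c) cd≡1) ⟨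
    (d * c) • v  ≡⟨ •-assoc d c v ⟩
    d • (c • v)  ≡⟨ cong (d •_) eq ⟩
    d • 0ᵥ       ≡⟨ c•0≡0 d ⟩
    0ᵥ           ∎

  record IsLinear {m n} (T : Vector m → Vector n) : Set where
    field
      additive    : ∀ v w → T (v ⊕ w) ≡ T v ⊕ T w
      homogeneous : ∀ c v → T (c • v) ≡ c • T v

    zero-homo : T 0ᵥ ≡ 0ᵥ
    zero-homo = trans (cong T (sym (0•v≡0 0ᵥ))) (trans (homogeneous 0# 0ᵥ) (0•v≡0 (T 0ᵥ)))

    kernel⇒injective : (∀ v → T v ≡ 0ᵥ → v ≡ 0ᵥ) → ∀ {v w} → T v ≡ T w → v ≡ w
    kernel⇒injective ker {v} {w} eq = ⊕≡0⇒≡ (ker _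
      (trans (additive v w) (trans (cong (_⊕ T w) eq) (v⊕v≡0 (T w)))))

  lincomb-⊕ : ∀ {m n} (c d : Vector m) (bs : Vec (Vector n) m) →
              lincomb (c ⊕ d) bs ≡ lincomb c bs ⊕ lincomb d bs
  lincomb-⊕ []      []      []       = sym (v⊕v≡0 0ᵥ)
  lincomb-⊕ (x ∷ c) (y ∷ d) (b ∷ bs) =
    trans (cong₂ _⊕_ (•-distribʳ x y b) (lincomb-⊕ c d bs)) (⊕-interchange (x • b) (y • b) _ _)

  lincomb-linear : ∀ {m n} (bs : Vec (Vector n) m) → IsLinear (λ c → lincomb c bs)
  lincomb-linear bs = record
    { additive    = λ c d → lincomb-⊕ c d bs
    ; homogeneous = λ c d → lincomb-• c d bs
    }

  linear-lincomb : ∀ {k m n} {T : Vector m → Vector n} → IsLinear T →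
                   ∀ c (us : Vec (Vector m) k) → T (lincomb c us) ≡ lincomb c (map T us)
  linear-lincomb lin []      []       = IsLinear.zero-homo lin
  linear-lincomb lin (x ∷ c) (u ∷ us) = trans (IsLinear.additive lin _ _)
    (cong₂ _⊕_ (IsLinear.homogeneous lin x u) (linear-lincomb lin c us))

  lincomb-0 : ∀ {m n} (bs : Vec (Vector n) m) → lincomb 0ᵥ bs ≡ 0ᵥ
  lincomb-0 bs = IsLinear.zero-homo (lincomb-linear bs)

  -- The images of the unit vectors.
  columns : ∀ {m n} → (Vector m → Vector n) → Vec (Vector n) m
  columns {zero}  T = []
  columns {suc m} T = T (1# ∷ 0ᵥ) ∷ columns (T ∘ (0# ∷_))

  lincomb-columns : ∀ {m n} {T : Vector m → Vector n} → IsLinear T →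
                    ∀ v → lincomb v (columns T) ≡ T v
  lincomb-columns {T = T} lin []      = sym (IsLinear.zero-homo lin)
  lincomb-columns {T = T} lin (x ∷ v) = begin
    x • T (1# ∷ 0ᵥ) ⊕ lincomb v (columns (T ∘ (0# ∷_)))
      ≡⟨ cong₂ _⊕_ (sym (homogeneous x _)) (lincomb-columns tail-linear v) ⟩
    T (x • (1# ∷ 0ᵥ)) ⊕ T (0# ∷ v)     ≡⟨ additive _ _ ⟨
    T ((x * 1# + 0#) ∷ (x • 0ᵥ ⊕ v))
      ≡⟨ cong T (cong₂ _∷_ (trans (+-identityʳ _) (*-identityʳ x))
           (trans (cong (_⊕ v) (c•0≡0 x)) (⊕-identityˡ v))) ⟩
    T (x ∷ v)                          ∎
    where
    open IsLinear lin
    tail-linear : IsLinear (T ∘ (0# ∷_))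
    tail-linear = record
      { additive    = λ v w → trans (cong (λ z → T (z ∷ _)) (sym (+-identityʳ 0#))) (additive _ _)
      ; homogeneous = λ c v → trans (cong (λ z → T (z ∷ _)) (sym (zeroʳ c))) (homogeneous c _)
      }

  -- The condition on the basis of a flat.
  Independent : ∀ {m n} → Vec (Vector n) m → Set
  Independent bs = ∀ c → lincomb c bs ≡ 0ᵥ → c ≡ 0ᵥ

  lincomb-injective : ∀ {m n} {bs : Vec (Vector n) m} → Independent bs →
                      ∀ {c d} → lincomb c bs ≡ lincomb d bs → c ≡ d
  lincomb-injective {bs = bs} ind = IsLinear.kernel⇒injective (lincomb-linear bs) ind

  linear-independent : ∀ {k m n} {T : Vector m → Vector n} → IsLinear T → (∀ v → T v ≡ 0ᵥ → v ≡ 0ᵥ) →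
                       {us : Vec (Vector m) k} → Independent us → Independent (map T us)
  linear-independent lin ker ind c eq = ind c (ker _ (trans (linear-lincomb lin c _) eq))

  ∷≡₅ : ∀ {v w x y z v′ w′ x′ y′ z′ : Carrier} → v ≡ v′ → w ≡ w′ → x ≡ x′ → y ≡ y′ → z ≡ z′ →
        _≡_ {A = Vector 5} (v ∷ w ∷ x ∷ y ∷ z ∷ []) (v′ ∷ w′ ∷ x′ ∷ y′ ∷ z′ ∷ [])
  ∷≡₅ refl refl refl refl refl = refl

  vectors : ∀ n → Vector n ↔ Fin (q ℕ.^ n)
  vectors = Vec-enumeration enumeration

  _≟ᵥ_ : ∀ {n} (v w : Vector n) → Dec (v ≡ w)
  _≟ᵥ_ {n} = finite-≟ (vectors n)

  Span? : ∀ {m n} (bs : Vec (Vector n) m) v → Dec (Span bs v)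
  Span? {m} bs v = finite-any? (vectors m) (λ c → lincomb c bs ≟ᵥ v)

  Span-0 : ∀ {m n} (bs : Vec (Vector n) m) → Span bs 0ᵥ
  Span-0 bs = 0ᵥ , lincomb-0 bs

  Span-⊕ : ∀ {m n} (bs : Vec (Vector n) m) {v w} → Span bs v → Span bs w → Span bs (v ⊕ w)
  Span-⊕ bs (c , refl) (d , refl) = c ⊕ d , lincomb-⊕ c d bs

  Span-• : ∀ {m n} (bs : Vec (Vector n) m) c {v} → Span bs v → Span bs (c • v)
  Span-• bs c (d , refl) = c • d , lincomb-• c d bs

  Span-cancel : ∀ {m n} (bs : Vec (Vector n) m) {v w} → Span bs v → Span bs (v ⊕ w) → Span bs w
  Span-cancel bs {v} {w} v∈ vw∈ = subst (Span bs) (⊕-self-inverse v w) (Span-⊕ bs v∈ vw∈)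

  Span-•-cancel : ∀ {m n} (bs : Vec (Vector n) m) {c v} → c ≢ 0# → Span bs (c • v) → Span bs v
  Span-•-cancel bs {c} {v} c≢0 cv∈ = Span-resp bs (∝-sym (c , c≢0 , refl)) cv∈

  Span-trans : ∀ {k m n} {bs : Vec (Vector n) m} {cs : Vec (Vector n) k} →
               All (Span cs) bs → ∀ {v} → Span bs v → Span cs v
  Span-trans {cs = cs} bs⊆cs (c , refl) = go bs⊆cs c
    where
    go : ∀ {m} {bs : Vec (Vector _) m} → All (Span cs) bs → ∀ c → Span cs (lincomb c bs)
    go []         []      = Span-0 cs
    go (b∈ ∷ bs∈) (x ∷ c) = Span-⊕ cs (Span-• cs x b∈) (go bs∈ c)

  Span-basis₀ : ∀ {m n} {b} (bs : Vec (Vector n) m) → Span (b ∷ bs) b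
  Span-basis₀ {b = b} bs = 1# ∷ 0ᵥ , trans (cong₂ _⊕_ (1•v≡v b) (lincomb-0 bs)) (⊕-identityʳ b)

  Span-basis : ∀ {m n} (bs : Vec (Vector n) m) → All (Span bs) bs
  Span-basis []       = []
  Span-basis (b ∷ bs) =
    (1# ∷ 0ᵥ , trans (cong₂ _⊕_ (1•v≡v b) (lincomb-0 bs)) (⊕-identityʳ b)) ∷ weaken (Span-basis bs)
    where
    weaken : ∀ {k} {cs : Vec (Vector _) k} → All (Span bs) cs → All (Span (b ∷ bs)) cs
    weaken []              = []
    weaken ((c , eq) ∷ cs) =
      (0# ∷ c , trans (cong₂ _⊕_ (0•v≡0 b) eq) (⊕-identityˡ _)) ∷ weaken cs

  private
    -- The coordinates with respect to cs of the vectors spanned by bs.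
    recoordinate : ∀ {k m n} {bs : Vec (Vector n) m} {cs : Vec (Vector n) k} →
                   All (Span cs) bs → ∀ c → Span cs (lincomb c bs)
    recoordinate bs⊆cs c = Span-trans bs⊆cs (c , refl)

    recoordinate-injective : ∀ {k m n} {bs : Vec (Vector n) m} {cs : Vec (Vector n) k} →
      (bs⊆cs : All (Span cs) bs) → Independent bs →
      ∀ {c d} → proj₁ (recoordinate bs⊆cs c) ≡ proj₁ (recoordinate bs⊆cs d) → c ≡ d
    recoordinate-injective {cs = cs} bs⊆cs ind {c} {d} eq = lincomb-injective ind
      (trans (sym (proj₂ (recoordinate bs⊆cs c)))
        (trans (cong (λ z → lincomb z cs) eq) (proj₂ (recoordinate bs⊆cs d))))

  -- Taking coordinates maps q^m vectors injectively to q^k vectors.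
  dimension-≤ : ∀ {k m n} {bs : Vec (Vector n) m} {cs : Vec (Vector n) k} →
                Independent bs → All (Span cs) bs → m ≤ k
  dimension-≤ {k} {m} ind bs⊆cs = ℕ.≮⇒≥ λ k<m → ℕ.<⇒≱ (ℕ.^-monoʳ-< q 1<q k<m)
    (finite-≤ (vectors m) (vectors k) (proj₁ ∘ recoordinate bs⊆cs) (recoordinate-injective bs⊆cs ind))

  -- Independent vectors in a span of the same dimension span it.
  Span-exchange : ∀ {m n} {bs cs : Vec (Vector n) m} → Independent bs → All (Span cs) bs →
                  ∀ {v} → Span cs v → Span bs v
  Span-exchange {m} {bs = bs} {cs} ind bs⊆cs (d , refl) =
    let c , eq = injective⇒surjective (vectors m) (vectors m)
                   (proj₁ ∘ recoordinate bs⊆cs) (recoordinate-injective bs⊆cs ind) d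
    in c , trans (sym (proj₂ (recoordinate bs⊆cs c))) (cong (λ z → lincomb z cs) eq)

  independent⇒spanning : ∀ {n} {bs : Vec (Vector n) n} → Independent bs → ∀ v → Span bs v
  independent⇒spanning {n} {bs} ind =
    injective⇒surjective (vectors n) (vectors n) (λ c → lincomb c bs) (lincomb-injective ind)

  independent-∷ : ∀ {m n} {b} {bs : Vec (Vector n) m} →
                  ¬ Span bs b → Independent bs → Independent (b ∷ bs)
  independent-∷ {b = b} {bs} b∉ ind (x ∷ c) eq with x ≟ 0#
  ... | yes refl = cong (0# ∷_) (ind c (begin
    lincomb c bs           ≡⟨ ⊕-identityˡ _ ⟨
    0ᵥ ⊕ lincomb c bs      ≡⟨ cong (_⊕ lincomb c bs) (0•v≡0 b) ⟨
    0# • b ⊕ lincomb c bs  ≡⟨ eq ⟩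
    0ᵥ                     ∎))
  ... | no x≢0   = contradiction (Span-•-cancel bs x≢0 (c , sym (⊕≡0⇒≡ eq))) b∉

  independent-singleton : ∀ {n} {v : Vector n} → v ≢ 0ᵥ → Independent (v ∷ [])
  independent-singleton v≢0 = independent-∷ (λ { ([] , eq) → v≢0 (sym eq) }) λ { [] _ → refl }

  -- A line with a direction v outside a hyperplane meets it.
  hyperplane-coset : ∀ {n} {v : Vector (suc n)} {bs : Vec (Vector (suc n)) n} →
    Independent bs → ¬ Span bs v → ∀ u → ∃[ s ] Span bs (u ⊕ s • v)
  hyperplane-coset {v = v} {bs} ind v∉ u with independent⇒spanning (independent-∷ v∉ ind) u
  ... | s ∷ c , refl = s , c , (begin
    lincomb c bs                         ≡⟨ ⊕-self-inverse (s • v) _ ⟨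
    s • v ⊕ (s • v ⊕ lincomb c bs)       ≡⟨ ⊕-comm _ _ ⟩
    (s • v ⊕ lincomb c bs) ⊕ s • v       ∎)

  GL-linear : ∀ {n} (g : GL n) → IsLinear (GL.to g)
  GL-linear g = record { additive = GL.additive g ; homogeneous = GL.homogeneous g }

  linear⇒GL : ∀ {n} {T : Vector n → Vector n} → IsLinear T → (∀ v → T v ≡ 0ᵥ → v ≡ 0ᵥ) → GL n
  linear⇒GL {n} {T} lin ker = record
    { bijection   = mk↔ₛ′ T (proj₁ ∘ surj) (proj₂ ∘ surj) (λ v → inj (proj₂ (surj (T v))))
    ; additive    = IsLinear.additive lin
    ; homogeneous = IsLinear.homogeneous lin
    }
    where
    inj : ∀ {v w} → T v ≡ T w → v ≡ w
    inj = IsLinear.kernel⇒injective lin ker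
    surj : ∀ w → ∃[ v ] T v ≡ w
    surj = injective⇒surjective (vectors n) (vectors n) T inj

  ∝-linear : ∀ {m n} {T : Vector m → Vector n} → IsLinear T → ∀ {v w} → v ∝ w → T v ∝ T w
  ∝-linear {T = T} lin (c , c≢0 , eq) = c , c≢0 , trans (sym (IsLinear.homogeneous lin c _)) (cong T eq)

  inverse : ∀ {n} → GL n → GL n
  inverse g = record
    { bijection   = ↔-sym (GL.bijection g)
    ; additive    = λ v w → trans (cong from (trans (cong₂ _⊕_ (sym (strictlyInverseˡ v)) (sym (strictlyInverseˡ w)))
                      (sym (additive _ _)))) (strictlyInverseʳ _)
    ; homogeneous = λ c v → trans (cong from (trans (cong (c •_) (sym (strictlyInverseˡ v)))
                      (sym (homogeneous c _)))) (strictlyInverseʳ _)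
    }
    where
    open GL g
    open Inverse bijection using (strictlyInverseˡ)

  infixr 9 _∘ᴳ_
  _∘ᴳ_ : ∀ {n} → GL n → GL n → GL n
  g ∘ᴳ h = record
    { bijection   = g.bijection ↔-∘ h.bijection
    ; additive    = λ v w → trans (cong g.to (h.additive v w)) (g.additive _ _)
    ; homogeneous = λ c v → trans (cong g.to (h.homogeneous c v)) (g.homogeneous _ _)
    }
    where
    module g = GL g
    module h = GL h

  ≡⇒∝ : ∀ {n} {v w : Vector n} → v ≡ w → v ∝ w
  ≡⇒∝ eq = 1# , 1≢0 , trans (1•v≡v _) eq

  maps-∘ : ∀ {n} {U V W : PointSet n} (g h : GL (suc n)) →
           g maps V onto W → h maps U onto V → (g ∘ᴳ h) maps U onto W
  maps-∘ {W = W} g h gVW hUV P = mk⇔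
    (PointSet.resp W {g · (h · P)} {(g ∘ᴳ h) · P} (≡⇒∝ refl) ∘ Equivalence.to (gVW (h · P)) ∘ Equivalence.to (hUV P))
    (Equivalence.from (hUV P) ∘ Equivalence.from (gVW (h · P)) ∘
     PointSet.resp W {(g ∘ᴳ h) · P} {g · (h · P)} (≡⇒∝ refl))

  maps-inverse : ∀ {n} {U V : PointSet n} (g : GL (suc n)) → g maps U onto V → inverse g maps V onto U
  maps-inverse {U = U} {V} g gUV P = mk⇔
    (Equivalence.from (gUV (inverse g · P)) ∘ PointSet.resp V {P} {g · (inverse g · P)} (≡⇒∝ (sym gg⁻¹)))
    (PointSet.resp V {g · (inverse g · P)} {P} (≡⇒∝ gg⁻¹) ∘ Equivalence.to (gUV (inverse g · P)))
    where
    gg⁻¹ : GL.to g (GL.from g (rep P)) ≡ rep P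
    gg⁻¹ = Inverse.strictlyInverseˡ (GL.bijection g) (rep P)

-- Tits ovoids

-- f(s,t) = s^(σ+2) + t^σ + st with σ = 2^(e+1), the last coordinate of the
-- affine points of the standard Tits ovoid.
tits : {q : ℕ} (F : FiniteField q) (e : ℕ) (s t : FiniteField.Carrier F) → FiniteField.Carrier F
tits F e s t = s ^ (2 ℕ.^ (e ℕ.+ 1) ℕ.+ 2) + t ^ (2 ℕ.^ (e ℕ.+ 1)) + s * t
  where open FiniteField F

tits-homo : ∀ {q r} {F : FiniteField q} {K : FiniteField r} (ι : Embedding F K) e s t →
            Embedding.⟦_⟧ ι (tits F e s t) ≡ tits K e (Embedding.⟦_⟧ ι s) (Embedding.⟦_⟧ ι t)
tits-homo {K = K} ι e s t =
  trans (+-homo _ _) (cong₂ K._+_ (trans (+-homo _ _) (cong₂ K._+_ (^-homo s (2 ℕ.^ (e ℕ.+ 1) ℕ.+ 2)) (^-homo t (2 ℕ.^ (e ℕ.+ 1))))) (*-homo s t))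
  where
  module K = FiniteField K
  open EmbeddingProperties ι

module TitsOvoid (e : ℕ) (F : FiniteField (2 ℕ.^ (2 ℕ.* e ℕ.+ 1))) where
  open FiniteField F
  open FieldProperties F

  1+1≡0 : 1# + 1# ≡ 0#
  1+1≡0 = characteristic-2 (2 ℕ.* e ℕ.+ 1) refl

  open Characteristic2 F 1+1≡0
  open LinearAlgebra F 1+1≡0
  open ≡-Reasoning

  private
    σ : ℕ
    σ = 2 ℕ.^ (e ℕ.+ 1)

    f : Carrier → Carrier → Carrier
    f = tits F e

  -- The automorphism x ↦ x^σ, whose square is x ↦ x².
  φ : Carrier → Carrier
  φ x = x ^ σ

  φ-+ : ∀ x y → φ (x + y) ≡ φ x + φ y
  φ-+ = frobenius-+ (e ℕ.+ 1)

  φ-* : ∀ x y → φ (x * y) ≡ φ x * φ y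
  φ-* x y = ^-distrib-* x y σ

  φ-φ : ∀ x → φ (φ x) ≡ x * x
  φ-φ x = begin
    (x ^ σ) ^ σ                                ≡⟨ ^-assocʳ x σ σ ⟩
    x ^ (σ ℕ.* σ)                              ≡⟨ cong (x ^_) σ² ⟩
    x ^ ((2 ℕ.^ (2 ℕ.* e ℕ.+ 1)) ℕ.* 2)        ≡⟨ ^-assocʳ x (2 ℕ.^ (2 ℕ.* e ℕ.+ 1)) 2 ⟨
    (x ^ (2 ℕ.^ (2 ℕ.* e ℕ.+ 1))) ^ 2          ≡⟨ cong (_^ 2) (^q≡id x) ⟩
    x ^ 2                                      ≡⟨ ^2≡ x ⟩
    x * x                                      ∎
    where
    exponents : ((e ℕ.+ 1) ℕ.+ (e ℕ.+ 1)) ≡ (2 ℕ.* e ℕ.+ 1) ℕ.+ 1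
    exponents = trans (sym (ℕ.+-assoc (e ℕ.+ 1) e 1)) (cong (ℕ._+ 1)
      (trans (ℕ.+-assoc e 1 e) (trans (cong (e ℕ.+_) (ℕ.+-comm 1 e))
        (trans (sym (ℕ.+-assoc e e 1)) (cong (λ n → e ℕ.+ n ℕ.+ 1) (sym (ℕ.+-identityʳ e)))))))
    σ² : σ ℕ.* σ ≡ (2 ℕ.^ (2 ℕ.* e ℕ.+ 1)) ℕ.* 2
    σ² = trans (sym (ℕ.^-distribˡ-+-* 2 (e ℕ.+ 1) (e ℕ.+ 1)))
      (trans (cong (2 ℕ.^_) exponents) (ℕ.^-distribˡ-+-* 2 (2 ℕ.* e ℕ.+ 1) 1))

  φ-surjective : ∀ y → ∃[ x ] φ x ≡ y
  φ-surjective = frobenius-surjective (e ℕ.+ 1)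

  φ-0 : φ 0# ≡ 0#
  φ-0 = +-cancelˡ (φ 0#) (trans (sym (φ-+ 0# 0#)) (trans (cong φ (+-identityʳ 0#)) (sym (+-identityʳ _))))

  φ-1 : φ 1# ≡ 1#
  φ-1 = *-cancelˡ (^-≢0 σ 1≢0) (trans (sym (φ-* 1# 1#))
    (trans (cong φ (*-identityʳ 1#)) (sym (*-identityʳ _))))

  f≡ : ∀ s t → f s t ≡ φ s * (s * s) + φ t + s * t
  f≡ s t = cong (λ z → z + φ t + s * t) (trans (^-homo-* s σ 2) (cong (φ s *_) (^2≡ s)))

  -- The identities behind the translations, the homotheties and the involution
  -- that preserve the ovoid.
  f-shift : ∀ a b s t →
    f (a + s) (b + t + φ a * s) ≡ f s t + (a * t + (b + a * φ a) * s + f a b)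
  f-shift a b s t = begin
    f (a + s) (b + t + φ a * s)
      ≡⟨ f≡ _ _ ⟩
    φ (a + s) * ((a + s) * (a + s)) + φ (b + t + φ a * s) + (a + s) * (b + t + φ a * s)
      ≡⟨ cong₂ (λ u v → u * ((a + s) * (a + s)) + v + (a + s) * (b + t + φ a * s)) (φ-+ a s)
           (trans (φ-+ _ _) (cong₂ _+_ (φ-+ b t) (trans (φ-* _ _) (cong (_* φ s) (φ-φ a))))) ⟩
    (φ a + φ s) * ((a + s) * (a + s)) + (φ b + φ t + a * a * φ s) + (a + s) * (b + t + φ a * s)
      ≡⟨ solve 8 (λ a b s t a′ b′ s′ t′ →
           (a′ :+ s′) :* ((a :+ s) :* (a :+ s)) :+ (b′ :+ t′ :+ a :* a :* s′)
             :+ (a :+ s) :* (b :+ t :+ a′ :* s) :=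
           (s′ :* (s :* s) :+ t′ :+ s :* t) :+
             (a :* t :+ (b :+ a :* a′) :* s :+ (a′ :* (a :* a) :+ b′ :+ a :* b)))
           refl a b s t (φ a) (φ b) (φ s) (φ t) ⟩
    (φ s * (s * s) + φ t + s * t) +
      (a * t + (b + a * φ a) * s + (φ a * (a * a) + φ b + a * b))
      ≡⟨ cong₂ (λ u v → u + (a * t + (b + a * φ a) * s + v)) (f≡ s t) (f≡ a b) ⟨
    f s t + (a * t + (b + a * φ a) * s + f a b)  ∎

  f-scale : ∀ κ s t → f (κ * s) (κ * φ κ * t) ≡ κ * κ * φ κ * f s t
  f-scale κ s t = begin
    f (κ * s) (κ * φ κ * t)
      ≡⟨ f≡ _ _ ⟩
    φ (κ * s) * (κ * s * (κ * s)) + φ (κ * φ κ * t) + κ * s * (κ * φ κ * t)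
      ≡⟨ cong₂ (λ u v → u * (κ * s * (κ * s)) + v + κ * s * (κ * φ κ * t)) (φ-* κ s)
           (trans (φ-* _ t) (cong (_* φ t) (trans (φ-* κ _) (cong (φ κ *_) (φ-φ κ))))) ⟩
    φ κ * φ s * (κ * s * (κ * s)) + φ κ * (κ * κ) * φ t + κ * s * (κ * φ κ * t)
      ≡⟨ solve 6 (λ κ κ′ s s′ t t′ →
           κ′ :* s′ :* (κ :* s :* (κ :* s)) :+ κ′ :* (κ :* κ) :* t′ :+ κ :* s :* (κ :* κ′ :* t) :=
           κ :* κ :* κ′ :* (s′ :* (s :* s) :+ t′ :+ s :* t)) refl κ (φ κ) s (φ s) t (φ t) ⟩
    κ * κ * φ κ * (φ s * (s * s) + φ t + s * t)
      ≡⟨ cong (κ * κ * φ κ *_) (f≡ s t) ⟨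
    κ * κ * φ κ * f s t  ∎

  φ-f : ∀ s t → φ (f s t) ≡ s * s * (φ s * φ s) + t * t + φ s * φ t
  φ-f s t = begin
    φ (f s t)                                    ≡⟨ cong φ (f≡ s t) ⟩
    φ (φ s * (s * s) + φ t + s * t)              ≡⟨ φ-+ _ _ ⟩
    φ (φ s * (s * s) + φ t) + φ (s * t)          ≡⟨ cong₂ _+_ (φ-+ _ _) (φ-* s t) ⟩
    φ (φ s * (s * s)) + φ (φ t) + φ s * φ t      ≡⟨ cong₂ (λ u v → u + v + φ s * φ t)
      (trans (φ-* _ _) (cong₂ _*_ (φ-φ s) (φ-* s s))) (φ-φ t) ⟩
    s * s * (φ s * φ s) + t * t + φ s * φ t      ∎

  -- Division by φ(z)z² with z = f(s,t) gives f(t/z, s/z) = 1/z.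
  f-swap-identity : ∀ s t →
    φ t * (t * t) + φ s * (f s t * f s t) + s * t * φ (f s t) ≡ f s t * φ (f s t)
  f-swap-identity s t = begin
    φ t * (t * t) + φ s * (f s t * f s t) + s * t * φ (f s t)
      ≡⟨ cong₂ (λ u v → φ t * (t * t) + φ s * (u * u) + s * t * v) (f≡ s t) (φ-f s t) ⟩
    φ t * (t * t) + φ s * ((φ s * (s * s) + φ t + s * t) * (φ s * (s * s) + φ t + s * t))
      + s * t * (s * s * (φ s * φ s) + t * t + φ s * φ t)
      ≡⟨ solve 4 (λ s s′ t t′ →
           t′ :* (t :* t) :+ s′ :* ((s′ :* (s :* s) :+ t′ :+ s :* t) :* (s′ :* (s :* s) :+ t′ :+ s :* t))
             :+ s :* t :* (s :* s :* (s′ :* s′) :+ t :* t :+ s′ :* t′) :=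
           (s′ :* (s :* s) :+ t′ :+ s :* t) :* (s :* s :* (s′ :* s′) :+ t :* t :+ s′ :* t′))
           refl s (φ s) t (φ t) ⟩
    (φ s * (s * s) + φ t + s * t) * (s * s * (φ s * φ s) + t * t + φ s * φ t)
      ≡⟨ cong₂ _*_ (f≡ s t) (φ-f s t) ⟨
    f s t * φ (f s t) ∎

  f≡0⇒ : ∀ s t → f s t ≡ 0# → s ≡ 0# × t ≡ 0#
  f≡0⇒ s t eq = s≡0 , t≡0
    where
    φ0 : ∀ {x} → x ≡ 0# → φ x ≡ 0#
    φ0 x≡0 = trans (cong φ x≡0) φ-0
    t≡0 : t ≡ 0#
    t≡0 with t ≟ 0#
    ... | yes t≡0 = t≡0
    ... | no t≢0 = contradiction (begin
      φ t * (t * t)  ≡⟨ solve 3 (λ a b c → a := a :+ b :* (con false :* con false) :+ c :* con false)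
                          refl (φ t * (t * t)) (φ s) (s * t) ⟩
      φ t * (t * t) + φ s * (0# * 0#) + s * t * 0#
        ≡⟨ cong₂ (λ u v → φ t * (t * t) + φ s * (u * u) + s * t * v) eq (φ0 eq) ⟨
      φ t * (t * t) + φ s * (f s t * f s t) + s * t * φ (f s t)  ≡⟨ f-swap-identity s t ⟩
      f s t * φ (f s t)  ≡⟨ trans (cong (_* φ (f s t)) eq) (zeroˡ _) ⟩
      0#  ∎) (*-≢0 (^-≢0 σ t≢0) (*-≢0 t≢0 t≢0))
    s≡0 : s ≡ 0#
    s≡0 with s ≟ 0#
    ... | yes s≡0 = s≡0
    ... | no s≢0 = contradiction (begin
      φ s * (s * s)                    ≡⟨ solve 2 (λ a s → a := a :+ con false :+ s :* con false)
                                            refl (φ s * (s * s)) s ⟩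
      φ s * (s * s) + 0# + s * 0#      ≡⟨ cong₂ (λ u v → φ s * (s * s) + u + s * v) (φ0 t≡0) t≡0 ⟨
      φ s * (s * s) + φ t + s * t      ≡⟨ trans (sym (f≡ s t)) eq ⟩
      0#  ∎) (*-≢0 (^-≢0 σ s≢0) (*-≢0 s≢0 s≢0))

  f-00 : f 0# 0# ≡ 0#
  f-00 = trans (f≡ 0# 0#) (trans (cong (λ z → z * (0# * 0#) + z + 0# * 0#) φ-0)
    (solve 0 (con false :* (con false :* con false) :+ con false :+ con false :* con false := con false) refl))

  f-swap : ∀ s t z → f s t * z ≡ 1# → f (t * z) (s * z) ≡ z
  f-swap s t z eq = begin
    f (t * z) (s * z)
      ≡⟨ f≡ _ _ ⟩
    φ (t * z) * (t * z * (t * z)) + φ (s * z) + t * z * (s * z)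
      ≡⟨ cong₂ (λ u v → u * (t * z * (t * z)) + v + t * z * (s * z)) (φ-* t z) (φ-* s z) ⟩
    φ t * φ z * (t * z * (t * z)) + φ s * φ z + t * z * (s * z)
      ≡⟨ solve 7 (λ s t z s′ t′ z′ o →
           t′ :* z′ :* (t :* z :* (t :* z)) :+ s′ :* z′ :+ t :* z :* (s :* z) :=
           t′ :* (t :* t) :* (z′ :* (z :* z)) :+ s′ :* (con true :* con true) :* z′
             :+ s :* t :* con true :* (z :* z)) refl s t z (φ s) (φ t) (φ z) 1# ⟩
    φ t * (t * t) * (φ z * (z * z)) + φ s * (1# * 1#) * φ z + s * t * 1# * (z * z)
      ≡⟨ cong₂ (λ u v → φ t * (t * t) * (φ z * (z * z)) + φ s * (u * u) * φ z + s * t * v * (z * z))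
           eq φeq ⟨
    φ t * (t * t) * (φ z * (z * z)) + φ s * (w * z * (w * z)) * φ z + s * t * (φ w * φ z) * (z * z)
      ≡⟨ solve 8 (λ s t z s′ t′ z′ w w′ →
           t′ :* (t :* t) :* (z′ :* (z :* z)) :+ s′ :* (w :* z :* (w :* z)) :* z′
             :+ s :* t :* (w′ :* z′) :* (z :* z) :=
           (t′ :* (t :* t) :+ s′ :* (w :* w) :+ s :* t :* w′) :* (z′ :* (z :* z)))
           refl s t z (φ s) (φ t) (φ z) w (φ w) ⟩
    (φ t * (t * t) + φ s * (w * w) + s * t * φ w) * (φ z * (z * z))
      ≡⟨ cong (_* (φ z * (z * z))) (f-swap-identity s t) ⟩
    w * φ w * (φ z * (z * z))
      ≡⟨ solve 4 (λ w w′ z z′ → w :* w′ :* (z′ :* (z :* z)) := w :* z :* (w′ :* z′) :* z)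
           refl w (φ w) z (φ z) ⟩
    w * z * (φ w * φ z) * z
      ≡⟨ cong₂ (λ u v → u * v * z) eq φeq ⟩
    1# * 1# * z
      ≡⟨ solve 1 (λ z → con true :* con true :* z := z) refl z ⟩
    z  ∎
    where
    w : Carrier
    w = f s t
    φeq : φ w * φ z ≡ 1#
    φeq = trans (sym (φ-* w z)) (trans (cong φ eq) φ-1)

  private
    std : PointSet 3
    std = standardTitsOvoid F e

    P∞ : Vector 4
    P∞ = 0# ∷ 0# ∷ 0# ∷ 1# ∷ []

    affinePoint : Carrier → Carrier → Vector 4
    affinePoint s t = 1# ∷ s ∷ t ∷ f s t ∷ []

  private
    -- The translation below, with a^σ and f(a,b) replaced by arbitrary a′ and c.
    shear : Carrier → Carrier → Carrier → Carrier → Vector 4 → Vector 4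
    shear a b a′ c (w ∷ x ∷ y ∷ z ∷ []) =
      w ∷ x + a * w ∷ y + b * w + a′ * x ∷ z + a * y + (b + a * a′) * x + c * w ∷ []

    ∷≡ : ∀ {w x y z w′ x′ y′ z′ : Carrier} → w ≡ w′ → x ≡ x′ → y ≡ y′ → z ≡ z′ →
         _≡_ {A = Vector 4} (w ∷ x ∷ y ∷ z ∷ []) (w′ ∷ x′ ∷ y′ ∷ z′ ∷ [])
    ∷≡ refl refl refl refl = refl

    shear-shear : ∀ a b a′ c c′ → c + c′ ≡ 0# → ∀ v →
                  shear a b a′ c (shear a (b + a * a′) a′ c′ v) ≡ v
    shear-shear a b a′ c c′ eq (w ∷ x ∷ y ∷ z ∷ []) = ∷≡ refl
      (solve 3 (λ w x a → x :+ a :* w :+ a :* w := x) refl w x a)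
      (solve 6 (λ w x y a b a′ → y :+ (b :+ a :* a′) :* w :+ a′ :* x :+ b :* w :+ a′ :* (x :+ a :* w) := y)
        refl w x y a b a′)
      (trans (solve 9 (λ w x y z a b a′ c c′ →
          z :+ a :* y :+ (b :+ a :* a′ :+ a :* a′) :* x :+ c′ :* w
            :+ a :* (y :+ (b :+ a :* a′) :* w :+ a′ :* x)
            :+ (b :+ a :* a′) :* (x :+ a :* w) :+ c :* w :=
          z :+ (c :+ c′) :* w) refl w x y z a b a′ c c′)
        (trans (cong (λ u → z + u * w) eq)
          (solve 2 (λ z w → z :+ con false :* w := z) refl z w)))

    -- The translation by (a, b + a^(σ+1)) is the inverse of the one by (a, b).
    c+c′ : ∀ a b → f a b + f a (b + a * φ a) ≡ 0#
    c+c′ a b = trans (cong₂ _+_ (f≡ a b)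
        (trans (f≡ a _) (cong (λ u → φ a * (a * a) + u + a * (b + a * φ a))
          (trans (φ-+ b _) (cong (φ b +_) (trans (φ-* a _) (cong (φ a *_) (φ-φ a))))))))
      (solve 4 (λ a b a′ b′ → (a′ :* (a :* a) :+ b′ :+ a :* b) :+
          (a′ :* (a :* a) :+ (b′ :+ a′ :* (a :* a)) :+ a :* (b :+ a :* a′)) := con false)
        refl a b (φ a) (φ b))

  -- The elements of the Suzuki group that fix (0,0,0,1) and act regularly on
  -- the remaining points of the ovoid, by (s,t) ↦ (a + s, b + t + a^σ s).
  translation : Carrier → Carrier → GL 4
  translation a b = record
    { bijection   = mk↔ₛ′ (shear a b (φ a) (f a b)) (shear a b⁻ (φ a) (f a b⁻))
                      (shear-shear a b (φ a) (f a b) (f a b⁻) (c+c′ a b))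
                      (λ v → trans (cong (λ z → shear a b⁻ (φ a) (f a b⁻) (shear a z (φ a) (f a z) v))
                                      (sym b⁻⁻))
                               (shear-shear a b⁻ (φ a) (f a b⁻) (f a _) (c+c′ a b⁻) v))
    ; additive    = λ { (w ∷ x ∷ y ∷ z ∷ []) (w′ ∷ x′ ∷ y′ ∷ z′ ∷ []) → ∷≡ refl
        (solve 5 (λ w x w′ x′ a → (x :+ x′) :+ a :* (w :+ w′) := (x :+ a :* w) :+ (x′ :+ a :* w′))
          refl w x w′ x′ a)
        (solve 8 (λ w x y w′ x′ y′ b a → (y :+ y′) :+ b :* (w :+ w′) :+ a :* (x :+ x′) :=
          (y :+ b :* w :+ a :* x) :+ (y′ :+ b :* w′ :+ a :* x′)) refl w x y w′ x′ y′ b (φ a))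
        (solve 11 (λ w x y z w′ x′ y′ z′ a b c →
          (z :+ z′) :+ a :* (y :+ y′) :+ b :* (x :+ x′) :+ c :* (w :+ w′) :=
          (z :+ a :* y :+ b :* x :+ c :* w) :+ (z′ :+ a :* y′ :+ b :* x′ :+ c :* w′))
          refl w x y z w′ x′ y′ z′ a (b + a * φ a) (f a b)) }
    ; homogeneous = λ { k (w ∷ x ∷ y ∷ z ∷ []) → ∷≡ refl
        (solve 4 (λ w x a k → k :* x :+ a :* (k :* w) := k :* (x :+ a :* w)) refl w x a k)
        (solve 6 (λ w x y b a k → k :* y :+ b :* (k :* w) :+ a :* (k :* x) :=
          k :* (y :+ b :* w :+ a :* x)) refl w x y b (φ a) k)
        (solve 8 (λ w x y z a b c k →
          k :* z :+ a :* (k :* y) :+ b :* (k :* x) :+ c :* (k :* w) :=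
          k :* (z :+ a :* y :+ b :* x :+ c :* w)) refl w x y z a (b + a * φ a) (f a b) k) }
    }
    where
    b⁻ : Carrier
    b⁻ = b + a * φ a
    b⁻⁻ : b⁻ + a * φ a ≡ b
    b⁻⁻ = solve 2 (λ b c → b :+ c :+ c := b) refl b (a * φ a)

  -- The involution that interchanges (0,0,0,1) and (1,0,0,0).
  swap : GL 4
  swap = record
    { bijection   = mk↔ₛ′ reverse reverse reverse-reverse reverse-reverse
    ; additive    = λ { (_ ∷ _ ∷ _ ∷ _ ∷ []) (_ ∷ _ ∷ _ ∷ _ ∷ []) → refl }
    ; homogeneous = λ { _ (_ ∷ _ ∷ _ ∷ _ ∷ []) → refl }
    }
    where
    reverse : Vector 4 → Vector 4
    reverse (w ∷ x ∷ y ∷ z ∷ []) = z ∷ y ∷ x ∷ w ∷ []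
    reverse-reverse : ∀ v → reverse (reverse v) ≡ v
    reverse-reverse (_ ∷ _ ∷ _ ∷ _ ∷ []) = refl

  private
    translation-affine : ∀ a b s t →
      GL.to (translation a b) (affinePoint s t) ≡ affinePoint (a + s) (b + t + φ a * s)
    translation-affine a b s t = ∷≡ refl
      (solve 2 (λ a s → s :+ a :* con true := a :+ s) refl a s)
      (solve 4 (λ b t a s → t :+ b :* con true :+ a :* s := b :+ t :+ a :* s) refl b t (φ a) s)
      (trans (solve 6 (λ z a t b s c → z :+ a :* t :+ b :* s :+ c :* con true :=
                z :+ (a :* t :+ b :* s :+ c)) refl (f s t) a t (b + a * φ a) s (f a b))
        (sym (f-shift a b s t)))

    translation-∞ : ∀ a b → GL.to (translation a b) P∞ ≡ P∞
    translation-∞ a b = ∷≡ refl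
      (solve 1 (λ a → con false :+ a :* con false := con false) refl a)
      (solve 2 (λ a b → con false :+ b :* con false :+ a :* con false := con false) refl (φ a) b)
      (solve 3 (λ a b c → con true :+ a :* con false :+ b :* con false :+ c :* con false := con true)
        refl a (b + a * φ a) (f a b))

    -- The images of the two kinds of points determine whether std is preserved.
    preserves : (g : GL 4) → GL.to g P∞ ∝ P∞ ⊎ (∃[ s ] ∃[ t ] GL.to g P∞ ∝ affinePoint s t) →
      (∀ s t → GL.to g (affinePoint s t) ∝ P∞ ⊎ (∃[ s′ ] ∃[ t′ ] GL.to g (affinePoint s t) ∝ affinePoint s′ t′)) →
      ∀ P → P ∈ std → (g · P) ∈ std
    preserves g p∞ paff P (inj₁ P∝) with p∞
    ... | inj₁ r           = inj₁ (∝-trans (∝-linear (GL-linear g) P∝) r)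
    ... | inj₂ (s , t , r) = inj₂ (s , t , ∝-trans (∝-linear (GL-linear g) P∝) r)
    preserves g p∞ paff P (inj₂ (s , t , P∝)) with paff s t
    ... | inj₁ r             = inj₁ (∝-trans (∝-linear (GL-linear g) P∝) r)
    ... | inj₂ (s′ , t′ , r) = inj₂ (s′ , t′ , ∝-trans (∝-linear (GL-linear g) P∝) r)

    translation-preserves : ∀ a b P → P ∈ std → (translation a b · P) ∈ std
    translation-preserves a b = preserves (translation a b)
      (inj₁ (≡⇒∝ (translation-∞ a b)))
      (λ s t → inj₂ (a + s , b + t + φ a * s , ≡⇒∝ (translation-affine a b s t)))

    swap-preserves : ∀ P → P ∈ std → (swap · P) ∈ std
    swap-preserves = preserves swap
      (inj₂ (0# , 0# , ≡⇒∝ (∷≡ refl refl refl (sym f-00))))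
      affine-image
      where
      affine-image : ∀ s t → GL.to swap (affinePoint s t) ∝ P∞ ⊎
                     (∃[ s′ ] ∃[ t′ ] GL.to swap (affinePoint s t) ∝ affinePoint s′ t′)
      affine-image s t with f s t ≟ 0#
      ... | yes z≡0 = let s≡0 , t≡0 = f≡0⇒ s t z≡0 in inj₁ (≡⇒∝ (∷≡ z≡0 t≡0 s≡0 refl))
      ... | no z≢0 = let z , fz≡1 = invertible (f s t) z≢0 in
        inj₂ (t * z , s * z , z ,
          (λ z≡0 → 1≢0 (trans (sym fz≡1) (trans (cong (f s t *_) z≡0) (zeroʳ _)))) ,
          ∷≡ (trans (*-comm z _) fz≡1) (*-comm z t) (*-comm z s)
             (trans (*-identityʳ z) (sym (f-swap s t z fz≡1))))

  private
    -- If g and a left inverse of g preserve std, then g maps std onto itself.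
    both-preserve : (g h : GL 4) → (∀ v → GL.to h (GL.to g v) ≡ v) → (∀ P → P ∈ std → (g · P) ∈ std) →
                    (∀ P → P ∈ std → (h · P) ∈ std) → g maps std onto std
    both-preserve g h hg g-pres h-pres P = mk⇔ (g-pres P) λ gP∈ →
      PointSet.resp std {h · (g · P)} {P} (≡⇒∝ (hg (rep P))) (h-pres (g · P) gP∈)

    swap-maps : swap maps std onto std
    swap-maps = both-preserve swap swap (λ v → Inverse.strictlyInverseʳ (GL.bijection swap) v)
      swap-preserves swap-preserves

    translation-maps : ∀ a b → translation a b maps std onto std
    translation-maps a b = both-preserve (translation a b) (translation a (b + a * φ a))
      (λ v → Inverse.strictlyInverseʳ (GL.bijection (translation a b)) v)
      (translation-preserves a b) (translation-preserves a (b + a * φ a))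

  -- The Suzuki group is transitive on the points of the standard Tits ovoid.
  ovoid-transitive : ∀ P → P ∈ std → Σ[ g ∈ GL 4 ] (g maps std onto std × GL.to g P∞ ∝ rep P)
  ovoid-transitive P (inj₁ P∝) = translation 0# 0# , translation-maps 0# 0# ,
    ∝-trans (≡⇒∝ (translation-∞ 0# 0#)) (∝-sym P∝)
  ovoid-transitive P (inj₂ (s , t , P∝)) = translation s t ∘ᴳ swap ,
    maps-∘ {U = std} {std} {std} (translation s t) swap (translation-maps s t) swap-maps ,
    ∝-trans (≡⇒∝ image) (∝-sym P∝)
    where
    image : GL.to (translation s t) (1# ∷ 0# ∷ 0# ∷ 0# ∷ []) ≡ affinePoint s t
    image = ∷≡ refl
      (solve 1 (λ s → con false :+ s :* con true := s) refl s)
      (solve 2 (λ t a → con false :+ t :* con true :+ a :* con false := t) refl t (φ s))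
      (solve 3 (λ s b c → con false :+ s :* con false :+ b :* con false :+ c :* con true := c)
        refl s (t + s * φ s) (f s t))

  -- A Tits ovoid has standard equations in coordinates for which any prescribed
  -- point of it is (0,0,0,1).
  ovoid-at-∞ : ∀ {O} → IsTitsOvoid F e O → ∀ X → X ∈ O →
    Σ[ g ∈ GL 4 ] (g maps std onto O × GL.to g P∞ ∝ rep X)
  ovoid-at-∞ {O} (g , g-maps) X X∈O =
    let Y = inverse g · X
        Y∈std = Equivalence.to (maps-inverse {U = std} {O} g g-maps X) X∈O
        h , h-maps , hP∞∝Y = ovoid-transitive Y Y∈std
    in g ∘ᴳ h , maps-∘ {U = std} {std} {O} g h g-maps h-maps ,
       ∝-trans (∝-linear (GL-linear g) hP∞∝Y)
         (≡⇒∝ (Inverse.strictlyInverseˡ (GL.bijection g) (rep X)))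

-- Coordinates adapted to the cone

module Cone (e : ℕ) (F : FiniteField (2 ℕ.^ (2 ℕ.* e ℕ.+ 1)))
            (H : Projective.Flat F 3 4) (cone : TitsCone F e) (axis : Projective.Flat F 1 4)
            (cone∩H : ∀ P → (TitsCone._∈ᶜ cone P × Projective._∈ᶠ_ F P H) ⇔ Projective._∈ᶠ_ F P axis) where
  open FiniteField F
  open FieldProperties F
  open TitsOvoid e F
  open Characteristic2 F 1+1≡0
  open LinearAlgebra F 1+1≡0
  open TitsCone cone
  open ≡-Reasoning

  -- The cone, H and the axis as sets of vectors.
  InCone : Vector 5 → Set
  InCone v = Σ[ X ∈ Point 3 ] (X ∈ ovoid × Span (rep vertex ∷ rep (embed X) ∷ []) v)

  InH InAxis : Vector 5 → Set
  InH    = Span (basis H)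
  InAxis = Span (basis axis)

  -- Linear coordinates (v,w,x,y,z) of PG(4,q) in which H is the hyperplane w = 0, the
  -- axis consists of the points (v,0,0,0,z) and the points of the cone that are not
  -- on H are (v,1,s,t,f(s,t)).
  record ConeCoordinates : Set where
    field
      Φ      : Vector 5 → Vector 5
      linear : IsLinear Φ
      kernel : ∀ x → Φ x ≡ 0ᵥ → x ≡ 0ᵥ
      Φ-H    : ∀ {v w x y z} → InH (Φ (v ∷ w ∷ x ∷ y ∷ z ∷ [])) ⇔ w ≡ 0#
      Φ-axis : ∀ {v w x y z} → InAxis (Φ (v ∷ w ∷ x ∷ y ∷ z ∷ [])) ⇔ (w ≡ 0# × x ≡ 0# × y ≡ 0#)
      Φ-cone : ∀ {v s t z} → InCone (Φ (v ∷ 1# ∷ s ∷ t ∷ z ∷ [])) ⇔ z ≡ tits F e s t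

  private
    f : Carrier → Carrier → Carrier
    f = tits F e

    std : PointSet 3
    std = standardTitsOvoid F e

    V : Vector 5
    V = rep vertex

    cone∩H⇒axis : ∀ {v} → v ≢ 0ᵥ → InCone v → InH v → InAxis v
    cone∩H⇒axis {v} v≢0 v∈C v∈H = Equivalence.to (cone∩H ⟨ v , v≢0 ⟩) (v∈C , v∈H)

    axis⇒cone : ∀ {v} → v ≢ 0ᵥ → InAxis v → InCone v
    axis⇒cone {v} v≢0 v∈ = proj₁ (Equivalence.from (cone∩H ⟨ v , v≢0 ⟩) v∈)

    axis⇒H : ∀ {v} → InAxis v → InH v
    axis⇒H {v} v∈ with v ≟ᵥ 0ᵥ
    ... | yes refl = Span-0 (basis H)
    ... | no v≢0   = proj₂ (Equivalence.from (cone∩H ⟨ v , v≢0 ⟩) v∈)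

    -- The coordinates given by the vertex and by a projectivity onto the base.
    module Coordinates (g : GL 4) (g-maps : g maps std onto ovoid) where
      Φ : Vector 5 → Vector 5
      Φ (v ∷ x) = lincomb (v ∷ GL.to g x) (V ∷ basis hyperplane)

      linear : IsLinear Φ
      linear = record
        { additive    = λ { (v ∷ x) (w ∷ y) →
            trans (cong (λ z → lincomb (v + w ∷ z) bs) (GL.additive g x y))
              (lincomb-⊕ (v ∷ GL.to g x) (w ∷ GL.to g y) bs) }
        ; homogeneous = λ { c (v ∷ x) →
            trans (cong (λ z → lincomb (c * v ∷ z) bs) (GL.homogeneous g c x))
              (lincomb-• c (v ∷ GL.to g x) bs) }
        }
        where
        bs : Vec (Vector 5) 5
        bs = V ∷ basis hyperplane

      kernel : ∀ x → Φ x ≡ 0ᵥ → x ≡ 0ᵥ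
      kernel (v ∷ x) eq = cong₂ _∷_ (Vec.∷-injectiveˡ vgx≡0) (begin
        x                          ≡⟨ GL.strictlyInverseʳ g x ⟨
        GL.from g (GL.to g x)      ≡⟨ cong (GL.from g) (trans (Vec.∷-injectiveʳ vgx≡0) (sym (GL.to-0 g))) ⟩
        GL.from g (GL.to g 0ᵥ)     ≡⟨ GL.strictlyInverseʳ g 0ᵥ ⟩
        0ᵥ                         ∎)
        where
        vgx≡0 : v ∷ GL.to g x ≡ 0ᵥ
        vgx≡0 = independent-∷ vertex∉ (independent hyperplane) _ eq

      Φ-injective : ∀ {x y} → Φ x ≡ Φ y → x ≡ y
      Φ-injective = IsLinear.kernel⇒injective linear kernel

      Φ-≢0 : ∀ {v x} → x ≢ 0ᵥ → Φ (v ∷ x) ≢ 0ᵥ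
      Φ-≢0 x≢0 eq = x≢0 (Vec.∷-injectiveʳ (kernel _ eq))

      std⇒cone : ∀ {v} (Y : Point 3) → Y ∈ std → InCone (Φ (v ∷ rep Y))
      std⇒cone {v} Y Y∈ = g · Y , Equivalence.to (g-maps Y) Y∈ , v ∷ 1# ∷ [] ,
        cong (v • V ⊕_) (trans (⊕-identityʳ _) (1•v≡v _))

      cone⇒std : ∀ {v} (X : Point 3) → InCone (Φ (v ∷ rep X)) → X ∈ std
      cone⇒std {v} X (Z , Z∈ , α ∷ β ∷ [] , eq) =
        PointSet.resp std {Y} {X} (β , β≢0 , sym x≡βy) Y∈std
        where
        Y : Point 3
        Y = inverse g · Z
        Y∈std : Y ∈ std
        Y∈std = Equivalence.to (maps-inverse {U = std} {ovoid} g g-maps Z) Z∈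
        x≡βy : rep X ≡ β • rep Y
        x≡βy = Vec.∷-injectiveʳ (Φ-injective {v ∷ rep X} {α ∷ β • rep Y} (begin
          Φ (v ∷ rep X)                               ≡⟨ eq ⟨
          α • V ⊕ (β • rep (embed Z) ⊕ 0ᵥ)            ≡⟨ cong (α • V ⊕_) (⊕-identityʳ _) ⟩
          α • V ⊕ β • lincomb (rep Z) (basis hyperplane)
            ≡⟨ cong (α • V ⊕_) (lincomb-• β (rep Z) (basis hyperplane)) ⟨
          α • V ⊕ lincomb (β • rep Z) (basis hyperplane)
            ≡⟨ cong (λ z → α • V ⊕ lincomb (β • z) (basis hyperplane))
                 (Inverse.strictlyInverseˡ (GL.bijection g) (rep Z)) ⟨
          α • V ⊕ lincomb (β • GL.to g (rep Y)) (basis hyperplane)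
            ≡⟨ cong (λ z → α • V ⊕ lincomb z (basis hyperplane)) (GL.homogeneous g β (rep Y)) ⟨
          Φ (α ∷ β • rep Y)                           ∎))
        β≢0 : β ≢ 0#
        β≢0 refl = nonzero X (trans x≡βy (0•v≡0 (rep Y)))

      P∞ : Point 3
      P∞ = ⟨ 0# ∷ 0# ∷ 0# ∷ 1# ∷ [] , (λ eq → 1≢0
        (Vec.∷-injectiveˡ (Vec.∷-injectiveʳ (Vec.∷-injectiveʳ (Vec.∷-injectiveʳ eq))))) ⟩

      P∞∈std : P∞ ∈ std
      P∞∈std = inj₁ ∝-refl

      affinePoint : Carrier → Carrier → Carrier → Point 3
      affinePoint s t z = ⟨ 1# ∷ s ∷ t ∷ z ∷ [] , (λ eq → 1≢0 (Vec.∷-injectiveˡ eq)) ⟩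

      affine∈std : ∀ s t → affinePoint s t (f s t) ∈ std
      affine∈std s t = inj₂ (s , t , ∝-refl)

      affine⇒f : ∀ s t z → affinePoint s t z ∈ std → z ≡ f s t
      affine⇒f s t z (inj₁ (c , c≢0 , eq)) =
        contradiction (trans (sym (*-identityʳ c)) (Vec.∷-injectiveˡ eq)) c≢0
      affine⇒f s t z (inj₂ (s′ , t′ , c , c≢0 , eq))
        with trans (sym (*-identityʳ c)) (Vec.∷-injectiveˡ eq)
      ... | refl with trans (sym (1•v≡v _)) eq
      ... | refl = refl

      Φ-cone : ∀ {v s t z} → InCone (Φ (v ∷ 1# ∷ s ∷ t ∷ z ∷ [])) ⇔ z ≡ f s t
      Φ-cone {v} {s} {t} {z} = mk⇔ (affine⇒f s t z ∘ cone⇒std (affinePoint s t z))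
        λ { refl → std⇒cone (affinePoint s t z) (affine∈std s t) }

      -- Otherwise projection from the vertex would map the axis onto a line through
      -- the noncollinear points (0,0,0,1), (1,0,0,0) and (1,1,0,1) of the ovoid.
      vertex∈H : InH V
      vertex∈H with Span? (basis H) V
      ... | yes V∈H = V∈H
      ... | no V∉H  = contradiction
        (dimension-≤ independent₃ (onAxis P∞ P∞∈std ∷ onAxis P₀ (affine∈std 0# 0#)
          ∷ onAxis P₁ (affine∈std 1# 0#) ∷ []))
        λ { (ℕ.s≤s (ℕ.s≤s ())) }
        where
        P₀ P₁ : Point 3
        P₀ = affinePoint 0# 0# (f 0# 0#)
        P₁ = affinePoint 1# 0# (f 1# 0#)
        -- The point of H on the line joining the vertex to Y.
        lift : Point 3 → Carrier
        lift Y = proj₁ (hyperplane-coset (independent H) V∉H (Φ (0# ∷ rep Y)))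
        lift∈H : ∀ Y → InH (Φ (lift Y ∷ rep Y))
        lift∈H Y = subst InH (begin
          (0# • V ⊕ lincomb (GL.to g (rep Y)) _) ⊕ lift Y • V
            ≡⟨ cong (λ u → (u ⊕ lincomb (GL.to g (rep Y)) _) ⊕ lift Y • V) (0•v≡0 V) ⟩
          (0ᵥ ⊕ lincomb (GL.to g (rep Y)) _) ⊕ lift Y • V
            ≡⟨ cong (_⊕ lift Y • V) (⊕-identityˡ _) ⟩
          lincomb (GL.to g (rep Y)) _ ⊕ lift Y • V
            ≡⟨ ⊕-comm _ _ ⟩
          Φ (lift Y ∷ rep Y)  ∎)
          (proj₂ (hyperplane-coset (independent H) V∉H (Φ (0# ∷ rep Y))))
        onAxis : ∀ Y → Y ∈ std → InAxis (Φ (lift Y ∷ rep Y))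
        onAxis Y Y∈ = cone∩H⇒axis (Φ-≢0 (nonzero Y)) (std⇒cone Y Y∈) (lift∈H Y)
        independent₃ : Independent
          (Φ (lift P∞ ∷ rep P∞) ∷ Φ (lift P₀ ∷ rep P₀) ∷ Φ (lift P₁ ∷ rep P₁) ∷ [])
        independent₃ = linear-independent linear kernel (λ
          { (a ∷ b ∷ c ∷ []) eq → conclude a b c (Vec.∷-injectiveʳ eq) })
          where
          conclude : ∀ a b c → a • rep P∞ ⊕ (b • rep P₀ ⊕ (c • rep P₁ ⊕ 0ᵥ)) ≡ 0ᵥ → a ∷ b ∷ c ∷ [] ≡ 0ᵥ
          conclude a b c eq = cong₂ _∷_ a≡0 (cong₂ _∷_ b≡0 (cong₂ _∷_ c≡0 refl))
            where
            c≡0 : c ≡ 0#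
            c≡0 = trans (solve 3 (λ a b c → c := a :* con false :+ (b :* con false :+ (c :* con true :+ con false)))
              refl a b c) (Vec.∷-injectiveˡ (Vec.∷-injectiveʳ eq))
            b≡0 : b ≡ 0#
            b≡0 = trans (solve 2 (λ a b → b := a :* con false :+ (b :* con true :+ (con false :* con true :+ con false)))
              refl a b) (trans (cong (λ c → a * 0# + (b * 1# + (c * 1# + 0#))) (sym c≡0)) (Vec.∷-injectiveˡ eq))
            a≡0 : a ≡ 0#
            a≡0 = trans (solve 3 (λ a z₀ z₁ → a := a :* con true :+
                (con false :* z₀ :+ (con false :* z₁ :+ con false))) refl a (f 0# 0#) (f 1# 0#))
              (trans (cong₂ (λ b c → a * 1# + (b * f 0# 0# + (c * f 1# 0# + 0#))) (sym b≡0) (sym c≡0))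
                (Vec.∷-injectiveˡ (Vec.∷-injectiveʳ (Vec.∷-injectiveʳ (Vec.∷-injectiveʳ eq)))))

      -- From here on (0,0,0,1) is the base point whose generator lies in H.
      module _ (P∞∈H : InH (Φ (0# ∷ rep P∞))) where
        V≡ : Φ (1# ∷ 0ᵥ) ≡ V
        V≡ = begin
          1# • V ⊕ lincomb (GL.to g 0ᵥ) (basis hyperplane)
            ≡⟨ cong₂ (λ a b → a ⊕ lincomb b (basis hyperplane)) (1•v≡v V) (GL.to-0 g) ⟩
          V ⊕ lincomb 0ᵥ (basis hyperplane)   ≡⟨ cong (V ⊕_) (lincomb-0 (basis hyperplane)) ⟩
          V ⊕ 0ᵥ                              ≡⟨ ⊕-identityʳ V ⟩
          V                                   ∎

        axis-frame : Vec (Vector 5) 2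
        axis-frame = Φ (1# ∷ 0ᵥ) ∷ Φ (0# ∷ rep P∞) ∷ []

        axis-frame⊆axis : All InAxis axis-frame
        axis-frame⊆axis =
          cone∩H⇒axis (λ eq → 1≢0 (Vec.∷-injectiveˡ (kernel _ eq)))
            (g · P∞ , Equivalence.to (g-maps P∞) P∞∈std , subst (Span _) (sym V≡) (All.head (Span-basis _)))
            (subst InH (sym V≡) vertex∈H) ∷
          cone∩H⇒axis (Φ-≢0 (nonzero P∞)) (std⇒cone P∞ P∞∈std) P∞∈H ∷ []

        lincomb-axis-frame : ∀ v z → lincomb (v ∷ z ∷ []) axis-frame ≡ Φ (v ∷ 0# ∷ 0# ∷ 0# ∷ z ∷ [])
        lincomb-axis-frame v z = trans (sym (linear-lincomb linear (v ∷ z ∷ []) ((1# ∷ 0ᵥ) ∷ (0# ∷ rep P∞) ∷ [])))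
          (cong Φ (∷≡₅
            (solve 2 (λ v z → v :* con true :+ (z :* con false :+ con false) := v) refl v z)
            (zeros v z) (zeros v z) (zeros v z)
            (solve 2 (λ v z → v :* con false :+ (z :* con true :+ con false) := z) refl v z)))
          where
          zeros : ∀ v z → v * 0# + (z * 0# + 0#) ≡ 0#
          zeros = solve 2 (λ v z → v :* con false :+ (z :* con false :+ con false) := con false) refl

        axis-frame-independent : Independent axis-frame
        axis-frame-independent (v ∷ z ∷ []) eq
          with kernel _ (trans (sym (lincomb-axis-frame v z)) eq)
        ... | refl = refl

        Φ-axis : ∀ {v w x y z} → InAxis (Φ (v ∷ w ∷ x ∷ y ∷ z ∷ [])) ⇔ (w ≡ 0# × x ≡ 0# × y ≡ 0#)
        Φ-axis {v} {w} {x} {y} {z} = mk⇔ forward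
          λ { (refl , refl , refl) → Span-trans axis-frame⊆axis (v ∷ z ∷ [] , lincomb-axis-frame v z) }
          where
          forward : InAxis (Φ (v ∷ w ∷ x ∷ y ∷ z ∷ [])) → w ≡ 0# × x ≡ 0# × y ≡ 0#
          forward ∈axis with Span-exchange axis-frame-independent axis-frame⊆axis ∈axis
          ... | v′ ∷ z′ ∷ [] , eq with Φ-injective (trans (sym (lincomb-axis-frame v′ z′)) eq)
          ... | refl = refl , refl , refl

        -- Adding f(s,t)(0,0,0,0,1) gives a point of the cone that is not on the axis.
        affine∉H : ∀ s t → ¬ InH (Φ (0# ∷ 1# ∷ s ∷ t ∷ 0# ∷ []))
        affine∉H s t ∈H = 1≢0 (proj₁ (Equivalence.to Φ-axis
          (cone∩H⇒axis (Φ-≢0 (nonzero P)) (std⇒cone P (affine∈std s t))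
            (subst InH (sum s t (f s t)) (Span-⊕ (basis H) ∈H (Span-• (basis H) (f s t) P∞∈H))))))
          where
          P : Point 3
          P = affinePoint s t (f s t)
          sum : ∀ s t z → Φ (0# ∷ 1# ∷ s ∷ t ∷ 0# ∷ []) ⊕ z • Φ (0# ∷ rep P∞) ≡ Φ (0# ∷ 1# ∷ s ∷ t ∷ z ∷ [])
          sum s t z = trans (cong (_ ⊕_) (sym (IsLinear.homogeneous linear z (0# ∷ rep P∞))))
            (trans (sym (IsLinear.additive linear (0# ∷ 1# ∷ s ∷ t ∷ 0# ∷ []) (z • (0# ∷ rep P∞)))) (cong Φ (∷≡₅ (drop 0#) (drop 1#) (drop s) (drop t)
              (solve 1 (λ z → con false :+ z :* con true := z) refl z))))
            where
            drop : ∀ a → a + z * 0# ≡ a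
            drop a = solve 2 (λ a z → a :+ z :* con false := a) refl a z

        -- Otherwise H meets the line through (0,1,0,0,0) with direction a, in a
        -- vector of the form (0,1,p,r,0).
        inH : ∀ a → (∀ s → ∃[ p ] ∃[ r ] (0# ∷ 1# ∷ 0# ∷ 0# ∷ 0# ∷ []) ⊕ s • a ≡ 0# ∷ 1# ∷ p ∷ r ∷ 0# ∷ []) →
              InH (Φ a)
        inH a shape with Span? (basis H) (Φ a)
        ... | yes ∈H = ∈H
        ... | no ∉H  =
          let s , ∈H = hyperplane-coset (independent H) ∉H (Φ (0# ∷ 1# ∷ 0# ∷ 0# ∷ 0# ∷ []))
              p , r , eq = shape s
          in contradiction (subst InH (trans (cong (_ ⊕_) (sym (IsLinear.homogeneous linear s a)))
               (trans (sym (IsLinear.additive linear (0# ∷ 1# ∷ 0# ∷ 0# ∷ 0# ∷ []) (s • a))) (cong Φ eq))) ∈H) (affine∉H p r)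

        column₁ : InH (Φ (0# ∷ 0# ∷ 1# ∷ 0# ∷ 0# ∷ []))
        column₁ = inH _ λ s → s , 0# , ∷≡₅ (zero+ s) (one+ s)
          (solve 1 (λ s → con false :+ s :* con true := s) refl s) (zero+ s) (zero+ s)
          where
          zero+ : ∀ s → 0# + s * 0# ≡ 0#
          zero+ = solve 1 (λ s → con false :+ s :* con false := con false) refl
          one+ : ∀ s → 1# + s * 0# ≡ 1#
          one+ = solve 1 (λ s → con true :+ s :* con false := con true) refl

        column₂ : InH (Φ (0# ∷ 0# ∷ 0# ∷ 1# ∷ 0# ∷ []))
        column₂ = inH _ λ s → 0# , s , ∷≡₅ (zero+ s) (one+ s) (zero+ s)
          (solve 1 (λ s → con false :+ s :* con true := s) refl s) (zero+ s)
          where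
          zero+ : ∀ s → 0# + s * 0# ≡ 0#
          zero+ = solve 1 (λ s → con false :+ s :* con false := con false) refl
          one+ : ∀ s → 1# + s * 0# ≡ 1#
          one+ = solve 1 (λ s → con true :+ s :* con false := con true) refl

        w≡0⇒H : ∀ v x y z → InH (Φ (v ∷ 0# ∷ x ∷ y ∷ z ∷ []))
        w≡0⇒H v x y z = subst InH
          (trans (sym (linear-lincomb linear (v ∷ x ∷ y ∷ z ∷ []) us))
            (cong Φ (∷≡₅
              (e₄ v x y z)
              (solve 4 (λ v x y z → v :* con false :+ (x :* con false :+ (y :* con false :+ (z :* con false :+ con false))) := con false) refl v x y z)
              (solve 4 (λ v x y z → v :* con false :+ (x :* con true :+ (y :* con false :+ (z :* con false :+ con false))) := x) refl v x y z)
              (solve 4 (λ v x y z → v :* con false :+ (x :* con false :+ (y :* con true :+ (z :* con false :+ con false))) := y) refl v x y z)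
              (solve 4 (λ v x y z → v :* con false :+ (x :* con false :+ (y :* con false :+ (z :* con true :+ con false))) := z) refl v x y z))))
          (Span-trans (axis⇒H (All.head axis-frame⊆axis) ∷ column₁ ∷ column₂ ∷ P∞∈H ∷ [])
            (v ∷ x ∷ y ∷ z ∷ [] , refl))
          where
          us : Vec (Vector 5) 4
          us = (1# ∷ 0ᵥ) ∷ (0# ∷ 0# ∷ 1# ∷ 0# ∷ 0# ∷ []) ∷ (0# ∷ 0# ∷ 0# ∷ 1# ∷ 0# ∷ []) ∷ (0# ∷ rep P∞) ∷ []
          e₄ : ∀ v x y z → v * 1# + (x * 0# + (y * 0# + (z * 0# + 0#))) ≡ v
          e₄ = solve 4 (λ v x y z → v :* con true :+ (x :* con false :+ (y :* con false :+ (z :* con false :+ con false))) := v) refl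

        Φ-H : ∀ {v w x y z} → InH (Φ (v ∷ w ∷ x ∷ y ∷ z ∷ [])) ⇔ w ≡ 0#
        Φ-H {v} {w} {x} {y} {z} = mk⇔ forward λ { refl → w≡0⇒H v x y z }
          where
          forward : InH (Φ (v ∷ w ∷ x ∷ y ∷ z ∷ [])) → w ≡ 0#
          forward ∈H with w ≟ 0#
          ... | yes w≡0 = w≡0
          ... | no w≢0  = contradiction
            (Span-•-cancel (basis H) w≢0 (subst InH (trans (sym (IsLinear.additive linear _ _))
              (trans (cong Φ (∷≡₅ (cancel v w) (solve 1 (λ w → w :+ con false := w :* con true) refl w)
                 (cancel x w) (cancel y w) (cancel z w))) (IsLinear.homogeneous linear w _)))
              (Span-⊕ (basis H) ∈H (w≡0⇒H v x y z))))
            (affine∉H 0# 0#)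
            where
            cancel : ∀ x w → x + x ≡ w * 0#
            cancel = solve 2 (λ x w → x :+ x := w :* con false) refl

        coordinates : ConeCoordinates
        coordinates = record { Φ = Φ ; linear = linear ; kernel = kernel
                             ; Φ-H = Φ-H ; Φ-axis = Φ-axis ; Φ-cone = Φ-cone }

  -- The axis contains a point other than the vertex.
  axis-point : ∃[ v ] (InAxis v × ¬ Span (rep vertex ∷ []) v)
  axis-point with finite-any? (vectors 5) (λ v → Span? (basis axis) v ×-dec ¬? (Span? (rep vertex ∷ []) v))
  ... | yes found = found
  ... | no ¬found = contradiction
    (dimension-≤ (independent axis) (All.map inVertex (Span-basis (basis axis))))
    λ { (ℕ.s≤s ()) }
    where
    inVertex : ∀ {v} → InAxis v → Span (rep vertex ∷ []) v
    inVertex {v} v∈ with Span? (rep vertex ∷ []) v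
    ... | yes ∈V = ∈V
    ... | no ∉V  = contradiction (v , v∈ , ∉V) ¬found

  private
    -- The point of the ovoid below a point of the axis other than the vertex.
    ovoid-point∈H : ∀ {v} → InAxis v → ¬ Span (rep vertex ∷ []) v → InCone v →
                    Σ[ X ∈ Point 3 ] (X ∈ ovoid × InH (rep (embed X)))
    ovoid-point∈H v∈axis v∉V (X , X∈O , α ∷ β ∷ [] , refl) = X , X∈O ,
      Span-•-cancel (basis H) β≢0 (subst InH (⊕-identityʳ _)
        (Span-cancel (basis H) (Span-• (basis H) α V∈H) (axis⇒H v∈axis)))
      where
      V∈H : InH V
      V∈H = Coordinates.vertex∈H (proj₁ isTitsOvoid) (proj₂ isTitsOvoid)
      β≢0 : β ≢ 0#
      β≢0 refl = v∉V (α ∷ [] , cong (α • V ⊕_) (sym (trans (⊕-identityʳ _) (0•v≡0 _))))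

    fromPoint : (X : Point 3) → InH (rep (embed X)) →
      Σ[ g ∈ GL 4 ] (g maps std onto ovoid × GL.to g (0# ∷ 0# ∷ 0# ∷ 1# ∷ []) ∝ rep X) → ConeCoordinates
    fromPoint X X∈H (g , g-maps , gP∞∝X) = C.coordinates (Span-resp (basis H) X∝P∞ X∈H)
      where
      module C = Coordinates g g-maps
      X∝P∞ : rep (embed X) ∝ C.Φ (0# ∷ rep C.P∞)
      X∝P∞ = ∝-trans (∝-sym (∝-linear (lincomb-linear (basis hyperplane)) gP∞∝X))
        (≡⇒∝ (sym (trans (cong (_⊕ lincomb (GL.to g (rep C.P∞)) (basis hyperplane)) (0•v≡0 V))
          (⊕-identityˡ _))))

  coneCoordinates : ConeCoordinates
  coneCoordinates =
    let v , v∈axis , v∉V = axis-point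
        v≢0 = λ v≡0 → v∉V (subst (Span (rep vertex ∷ [])) (sym v≡0) (Span-0 _))
        X , X∈O , X∈H = ovoid-point∈H v∈axis v∉V (axis⇒cone v≢0 v∈axis)
    in fromPoint X X∈H (ovoid-at-∞ {ovoid} isTitsOvoid X X∈O)

-- Quadratic extensions and field reduction

module QuadraticExtension {q : ℕ} {F : FiniteField q} {K : FiniteField (q ℕ.^ 2)} (ι : Embedding F K)
    (1+1≡0 : FiniteField._+_ F (FiniteField.1# F) (FiniteField.1# F) ≡ FiniteField.0# F) where
  private
    module F = FiniteField F
    module FP = FieldProperties F
    module F₂ = Characteristic2 F 1+1≡0
    module FL = LinearAlgebra F 1+1≡0
  open EmbeddingProperties ι public

  K-1+1≡0 : FiniteField._+_ K (FiniteField.1# K) (FiniteField.1# K) ≡ FiniteField.0# K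
  K-1+1≡0 = characteristic-2 1+1≡0

  open FiniteField K
  open FieldProperties K
  open Characteristic2 K K-1+1≡0
  open ≡-Reasoning

  -- The element ω of K is not in the subfield F.
  OutsideF : Carrier → Set
  OutsideF ω = ∀ a → ⟦ a ⟧ ≢ ω

  opaque
    outsideF : ∃[ ω ] OutsideF ω
    outsideF =
      let ω , ω∉ = finite-counterexample enumeration (λ k → finite-any? F.enumeration (λ a → ⟦ a ⟧ ≟ k)) λ all →
            ℕ.<⇒≱ q<q² (finite-≤ enumeration F.enumeration (proj₁ ∘ all) λ {x} {y} eq →
              trans (sym (proj₂ (all x))) (trans (cong ⟦_⟧ eq) (proj₂ (all y))))
      in ω , λ a eq → ω∉ (a , eq)
      where
      q<q² : q < q ℕ.^ 2
      q<q² = subst (_< q ℕ.^ 2) (ℕ.*-identityʳ q) (ℕ.^-monoʳ-< q FP.1<q {1} {2} (ℕ.s≤s (ℕ.s≤s ℕ.z≤n)))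

  module Basis (ω : Carrier) (ω∉F : OutsideF ω) where
    -- The element a + bω of K.
    infix 6 _+ω_
    _+ω_ : F.Carrier → F.Carrier → Carrier
    a +ω b = ⟦ a ⟧ + ⟦ b ⟧ * ω

    +ω-0 : ∀ a b → a +ω b ≡ 0# → a ≡ F.0# × b ≡ F.0#
    +ω-0 a b eq with b FP.≟ F.0#
    ... | yes refl = injective (begin
      ⟦ a ⟧                 ≡⟨ solve 2 (λ a ω → a := a :+ con false :* ω) refl ⟦ a ⟧ ω ⟩
      ⟦ a ⟧ + 0# * ω        ≡⟨ cong (λ z → ⟦ a ⟧ + z * ω) 0#-homo ⟨
      ⟦ a ⟧ + ⟦ F.0# ⟧ * ω  ≡⟨ eq ⟩
      0#                    ≡⟨ 0#-homo ⟨
      ⟦ F.0# ⟧              ∎) , refl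
    ... | no b≢0 = let c , bc≡1 = F.invertible b b≢0 in contradiction (begin
      ⟦ a F.* c ⟧               ≡⟨ *-homo a c ⟩
      ⟦ a ⟧ * ⟦ c ⟧             ≡⟨ cong (_* ⟦ c ⟧) (+≡0⇒≡ eq) ⟩
      ⟦ b ⟧ * ω * ⟦ c ⟧         ≡⟨ solve 3 (λ b w c → b :* w :* c := b :* c :* w) refl ⟦ b ⟧ ω ⟦ c ⟧ ⟩
      ⟦ b ⟧ * ⟦ c ⟧ * ω         ≡⟨ cong (_* ω) (trans (sym (*-homo b c)) (trans (cong ⟦_⟧ bc≡1) 1#-homo)) ⟩
      1# * ω                    ≡⟨ *-identityˡ ω ⟩
      ω                         ∎) (ω∉F (a F.* c))

    +ω-+ : ∀ a b c d → (a F.+ c) +ω (b F.+ d) ≡ (a +ω b) + (c +ω d)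
    +ω-+ a b c d = trans (cong₂ (λ u v → u + v * ω) (+-homo a c) (+-homo b d))
      (solve 5 (λ a b c d w → (a :+ c) :+ (b :+ d) :* w := (a :+ b :* w) :+ (c :+ d :* w)) refl
        ⟦ a ⟧ ⟦ b ⟧ ⟦ c ⟧ ⟦ d ⟧ ω)

    +ω-injective : ∀ {a b c d} → a +ω b ≡ c +ω d → a ≡ c × b ≡ d
    +ω-injective {a} {b} {c} {d} eq =
      let a+c≡0 , b+d≡0 = +ω-0 (a F.+ c) (b F.+ d)
            (trans (+ω-+ a b c d) (trans (cong (_+ (c +ω d)) eq) (x+x≡0 _)))
      in F₂.+≡0⇒≡ a+c≡0 , F₂.+≡0⇒≡ b+d≡0

    +ω-surjective : ∀ k → ∃[ a ] ∃[ b ] a +ω b ≡ k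
    +ω-surjective k with injective⇒surjective (FL.vectors 2) enumeration
      (λ { (a ∷ b ∷ []) → a +ω b })
      (λ { {_ ∷ _ ∷ []} {_ ∷ _ ∷ []} eq → let p , r = +ω-injective eq in cong₂ _∷_ p (cong (_∷ []) r) }) k
    ... | a ∷ b ∷ [] , eq = a , b , eq

module FieldReduction {q : ℕ} {F : FiniteField q} {K : FiniteField (q ℕ.^ 2)} (ι : Embedding F K)
    (1+1≡0 : FiniteField._+_ F (FiniteField.1# F) (FiniteField.1# F) ≡ FiniteField.0# F)
    (H : Projective.Flat F 3 4) (S : Pred (Projective.Flat F 1 4) 0ℓ)
    (desarguesian : IsDesarguesian F K ι H S) where
  open QuadraticExtension {F = F} {K} ι 1+1≡0
  open LinearAlgebra F 1+1≡0
  open IsDesarguesian desarguesian renaming (additive to θ-⊕; homogeneous to θ-•; injective to θ-injective) public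
  private
    module F = FiniteField F
    module K = FiniteField K
    module KP = FieldProperties K
    module K₂ = Characteristic2 K K-1+1≡0
    module KL = LinearAlgebra K K-1+1≡0

  θ-0 : θ KL.0ᵥ ≡ 0ᵥ
  θ-0 = trans (cong θ (sym (KL.v⊕v≡0 KL.0ᵥ))) (trans (θ-⊕ KL.0ᵥ KL.0ᵥ) (v⊕v≡0 _))

  θ-kernel : ∀ {w} → θ w ≡ 0ᵥ → w ≡ KL.0ᵥ
  θ-kernel eq = θ-injective (trans eq (sym θ-0))

  θ∈H : ∀ w → Span (basis H) (θ w)
  θ∈H w = Equivalence.from (image (θ w)) (w , refl)

  θ⁻¹ : ∀ {v} → Span (basis H) v → ∃[ w ] θ w ≡ v
  θ⁻¹ {v} = Equivalence.to (image v)

  -- v lies on the spread line θ(K w).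
  OnSpreadLine : KL.Vector 2 → Vector 5 → Set
  OnSpreadLine w v = ∃[ k ] θ (k KL.• w) ≡ v

  OnSpreadLine-θ : ∀ {w x} → OnSpreadLine w (θ x) → ∃[ k ] k KL.• w ≡ x
  OnSpreadLine-θ (k , eq) = k , θ-injective eq

  OnSpreadLine-scale : ∀ {w x} k → OnSpreadLine w (θ x) → OnSpreadLine w (θ (k KL.• x))
  OnSpreadLine-scale {w} k on with OnSpreadLine-θ on
  ... | l , refl = k K.* l , cong θ (KL.•-assoc k l w)

  -- A spread line is determined by any of its points.
  OnSpreadLine-rebase : ∀ {w x} → x ≢ KL.0ᵥ → OnSpreadLine w (θ x) → ∀ v → OnSpreadLine w v ⇔ OnSpreadLine x v
  OnSpreadLine-rebase {w} x≢0 on with OnSpreadLine-θ on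
  ... | l , refl = λ v → mk⇔ to λ { (k , refl) → k K.* l , cong θ (KL.•-assoc k l w) }
    where
    l≢0 : l ≢ K.0#
    l≢0 refl = x≢0 (KL.0•v≡0 w)
    to : ∀ {v} → OnSpreadLine w v → OnSpreadLine (l KL.• w) v
    to (k , refl) = let l⁻¹ , ll⁻¹≡1 = K.invertible l l≢0 in
      k K.* l⁻¹ , cong θ (trans (sym (KL.•-assoc (k K.* l⁻¹) l w))
        (cong (KL._• w) (trans (K.*-assoc k l⁻¹ l)
          (trans (cong (k K.*_) (trans (K.*-comm l⁻¹ l) ll⁻¹≡1)) (KP.*-identityʳ k)))))

  module _ (ω : K.Carrier) (ω∉F : OutsideF ω) where
    open Basis ω ω∉F

    θ-+ω : ∀ a b w → θ ((a +ω b) KL.• w) ≡ a • θ w ⊕ b • θ (ω KL.• w)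
    θ-+ω a b w = trans (cong θ (KL.•-distribʳ ⟦ a ⟧ (⟦ b ⟧ K.* ω) w)) (trans (θ-⊕ _ _)
      (cong₂ _⊕_ (θ-• a w) (trans (cong θ (KL.•-assoc ⟦ b ⟧ ω w)) (θ-• b _))))

    ω+F≢0 : ∀ a → ω K.+ ⟦ a ⟧ ≢ K.0#
    ω+F≢0 a eq = ω∉F a (sym (K₂.+≡0⇒≡ eq))

-- Coordinates adapted to the cone and to the multiplication by ω

module NormalForm (e : ℕ) (F : FiniteField (2 ℕ.^ (2 ℕ.* e ℕ.+ 1)))
    (K : FiniteField ((2 ℕ.^ (2 ℕ.* e ℕ.+ 1)) ℕ.^ 2)) (ι : Embedding F K)
    (H : Projective.Flat F 3 4) (S : Pred (Projective.Flat F 1 4) 0ℓ)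
    (desarguesian : IsDesarguesian F K ι H S)
    (cone : TitsCone F e) (axis : Projective.Flat F 1 4) (axis∈S : S axis)
    (cone∩H : ∀ P → (TitsCone._∈ᶜ cone P × Projective._∈ᶠ_ F P H) ⇔ Projective._∈ᶠ_ F P axis) where
  open FiniteField F
  open FieldProperties F
  open TitsOvoid e F
  open Characteristic2 F 1+1≡0
  open LinearAlgebra F 1+1≡0
  open Cone e F H cone axis cone∩H
  open QuadraticExtension {F = F} {K} ι 1+1≡0 using (⟦_⟧; 0#-homo; OutsideF; K-1+1≡0; module Basis)
  open FieldReduction ι 1+1≡0 H S desarguesian
  open ≡-Reasoning
  private
    module K = FiniteField K
    module KL = LinearAlgebra K K-1+1≡0

    f : Carrier → Carrier → Carrier
    f = tits F e

  module _ (ω : K.Carrier) (ω∉F : OutsideF ω) where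
    open Basis ω ω∉F

    -- In the coordinates f₀ + θ(xu + yw) the affine points of the cone are
    -- those with x = t + sω and y = v + f(s,t)ω.
    record Normalised : Set where
      field
        f₀            : Vector 5
        f₀∉H          : ¬ InH f₀
        u w           : KL.Vector 2
        u,w-independent : KL.Independent (u ∷ w ∷ [])
        axis⇔         : ∀ v → InAxis v ⇔ OnSpreadLine w v
        cone⇔         : ∀ s t v z →
          InCone (f₀ ⊕ θ ((t +ω s) KL.• u KL.⊕ (v +ω z) KL.• w)) ⇔ z ≡ f s t

    module _ (C : ConeCoordinates) where
      open ConeCoordinates C
      open IsLinear linear

      Φ-inverse : ∀ x → ∃[ v ] ∃[ w ] ∃[ a ] ∃[ b ] ∃[ z ] Φ (v ∷ w ∷ a ∷ b ∷ z ∷ []) ≡ x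
      Φ-inverse x with GL.from g x | Inverse.strictlyInverseˡ (GL.bijection g) x
        where
        g : GL 5
        g = linear⇒GL linear kernel
      ... | v ∷ w ∷ a ∷ b ∷ z ∷ [] | eq = v , w , a , b , z , eq

      Φ-injective : ∀ {x y} → Φ x ≡ Φ y → x ≡ y
      Φ-injective = kernel⇒injective kernel

      -- The axis is the spread line of w₀.
      w₀ : KL.Vector 2
      w₀ = KL.rep (proj₁ (Equivalence.to (spread axis) axis∈S))

      axis-w₀ : ∀ v → InAxis v ⇔ OnSpreadLine w₀ v
      axis-w₀ = proj₂ (Equivalence.to (spread axis) axis∈S)

      axis-scale : ∀ {x} k → InAxis (θ x) → InAxis (θ (k KL.• x))
      axis-scale k = Equivalence.from (axis-w₀ _) ∘ OnSpreadLine-scale k ∘ Equivalence.to (axis-w₀ _)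

      H-coordinates : ∀ x → ∃[ v ] ∃[ a ] ∃[ b ] ∃[ z ] Φ (v ∷ 0# ∷ a ∷ b ∷ z ∷ []) ≡ θ x
      H-coordinates x =
        let v , w , a , b , z , eq = Φ-inverse (θ x)
            w≡0 = Equivalence.to (Φ-H {v} {w} {a} {b} {z}) (subst InH (sym eq) (θ∈H x))
        in v , a , b , z , trans (cong (λ w → Φ (v ∷ w ∷ a ∷ b ∷ z ∷ [])) (sym w≡0)) eq

      axis-coordinates : ∀ x → InAxis (θ x) → ∃[ v ] ∃[ z ] Φ (v ∷ 0# ∷ 0# ∷ 0# ∷ z ∷ []) ≡ θ x
      axis-coordinates x x∈ =
        let v , w , a , b , z , eq = Φ-inverse (θ x)
            w≡0 , a≡0 , b≡0 = Equivalence.to (Φ-axis {v} {w} {a} {b} {z}) (subst InAxis (sym eq) x∈)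
        in v , z , trans (cong Φ (∷≡₅ refl (sym w≡0) (sym a≡0) (sym b≡0) refl)) eq

      -- The preimages under θ of three of the coordinate vectors.
      θ₂ : ∃[ w₂ ] θ w₂ ≡ Φ (0# ∷ 0# ∷ 0# ∷ 1# ∷ 0# ∷ [])
      θ₂ = θ⁻¹ (Equivalence.from Φ-H refl)
      θ₃ : ∃[ w₃ ] θ w₃ ≡ Φ (0# ∷ 0# ∷ 0# ∷ 0# ∷ 1# ∷ [])
      θ₃ = θ⁻¹ (Equivalence.from Φ-H refl)
      θ₄ : ∃[ w₄ ] θ w₄ ≡ Φ (1# ∷ 0# ∷ 0# ∷ 0# ∷ 0# ∷ [])
      θ₄ = θ⁻¹ (Equivalence.from Φ-H refl)

      w₂ w₃ w₄ : KL.Vector 2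
      w₂ = proj₁ θ₂
      w₃ = proj₁ θ₃
      w₄ = proj₁ θ₄

      w₃∈axis : InAxis (θ w₃)
      w₃∈axis = subst InAxis (sym (proj₂ θ₃)) (Equivalence.from Φ-axis (refl , refl , refl))

      w₄∈axis : InAxis (θ w₄)
      w₄∈axis = subst InAxis (sym (proj₂ θ₄)) (Equivalence.from Φ-axis (refl , refl , refl))

      w₄≢0 : w₄ ≢ KL.0ᵥ
      w₄≢0 eq = 1≢0 (Vec.∷-injectiveˡ (kernel _ (trans (sym (proj₂ θ₄)) (trans (cong θ eq) θ-0))))

      -- If θ(ωx) is an F-multiple of θ(x) modulo the axis, then θ(x) is on the axis,
      -- since ω + a is invertible in K.
      absorb : ∀ {x} a → InAxis (θ (ω KL.• x) ⊕ a • θ x) → InAxis (θ x)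
      absorb {x} a ∈axis = subst (InAxis ∘ θ) undo (axis-scale k⁻¹ (subst InAxis combine ∈axis))
        where
        k k⁻¹ : K.Carrier
        k = ω K.+ ⟦ a ⟧
        k⁻¹ = proj₁ (K.invertible k (ω+F≢0 ω ω∉F a))
        combine : θ (ω KL.• x) ⊕ a • θ x ≡ θ (k KL.• x)
        combine = trans (cong (θ (ω KL.• x) ⊕_) (sym (θ-• a x)))
          (trans (sym (θ-⊕ _ _)) (cong θ (sym (KL.•-distribʳ ω ⟦ a ⟧ x))))
        undo : k⁻¹ KL.• k KL.• x ≡ x
        undo = trans (sym (KL.•-assoc k⁻¹ k x)) (trans (cong (KL._• x)
          (trans (K.*-comm k⁻¹ k) (proj₂ (K.invertible k (ω+F≢0 ω ω∉F a))))) (KL.1•v≡v x))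

      -- Write V, f₁, f₂, f₃ for the images under Φ of all unit vectors but the second.
      -- The K-structure is given by ωV = dV + cf₃, ωf₃ = d′V + c′f₃ and
      -- ωf₂ = rV + nf₁ + mf₂ + pf₃, where c and n are not zero.
      d c r n m p d′ c′ : Carrier
      ωw₄ : Φ (d ∷ 0# ∷ 0# ∷ 0# ∷ c ∷ []) ≡ θ (ω KL.• w₄)
      ωw₃ : Φ (d′ ∷ 0# ∷ 0# ∷ 0# ∷ c′ ∷ []) ≡ θ (ω KL.• w₃)
      ωw₂ : Φ (r ∷ 0# ∷ n ∷ m ∷ p ∷ []) ≡ θ (ω KL.• w₂)
      d   = proj₁ (axis-coordinates _ (axis-scale ω w₄∈axis))
      c   = proj₁ (proj₂ (axis-coordinates _ (axis-scale ω w₄∈axis)))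
      ωw₄ = proj₂ (proj₂ (axis-coordinates _ (axis-scale ω w₄∈axis)))
      d′  = proj₁ (axis-coordinates _ (axis-scale ω w₃∈axis))
      c′  = proj₁ (proj₂ (axis-coordinates _ (axis-scale ω w₃∈axis)))
      ωw₃ = proj₂ (proj₂ (axis-coordinates _ (axis-scale ω w₃∈axis)))
      r   = proj₁ (H-coordinates (ω KL.• w₂))
      n   = proj₁ (proj₂ (H-coordinates (ω KL.• w₂)))
      m   = proj₁ (proj₂ (proj₂ (H-coordinates (ω KL.• w₂))))
      p   = proj₁ (proj₂ (proj₂ (proj₂ (H-coordinates (ω KL.• w₂)))))
      ωw₂ = proj₂ (proj₂ (proj₂ (proj₂ (H-coordinates (ω KL.• w₂)))))

      c≢0 : c ≢ 0#
      c≢0 c≡0 = w₄≢0 (KL.•-cancel (ω+F≢0 ω ω∉F d) (θ-kernel (begin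
        θ ((ω K.+ ⟦ d ⟧) KL.• w₄)                ≡⟨ cong θ (KL.•-distribʳ ω ⟦ d ⟧ w₄) ⟩
        θ (ω KL.• w₄ KL.⊕ ⟦ d ⟧ KL.• w₄)         ≡⟨ θ-⊕ _ _ ⟩
        θ (ω KL.• w₄) ⊕ θ (⟦ d ⟧ KL.• w₄)        ≡⟨ cong₂ _⊕_ (sym ωw₄) (trans (θ-• d w₄) (cong (d •_) (proj₂ θ₄))) ⟩
        Φ (d ∷ 0# ∷ 0# ∷ 0# ∷ c ∷ []) ⊕ d • Φ (1# ∷ 0# ∷ 0# ∷ 0# ∷ 0# ∷ [])
          ≡⟨ combination (d ∷ 0# ∷ 0# ∷ 0# ∷ c ∷ []) d (1# ∷ 0# ∷ 0# ∷ 0# ∷ 0# ∷ []) ⟩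
        Φ (d + d * 1# ∷ 0# + d * 0# ∷ 0# + d * 0# ∷ 0# + d * 0# ∷ c + d * 0# ∷ [])
          ≡⟨ cong Φ (∷≡₅ (solve 1 (λ d → d :+ d :* con true := con false) refl d) (zeros d) (zeros d) (zeros d)
               (trans (cong (_+ d * 0#) c≡0) (zeros d))) ⟩
        Φ 0ᵥ                                     ≡⟨ zero-homo ⟩
        0ᵥ                                       ∎)))
        where
        combination : ∀ x k y → Φ x ⊕ k • Φ y ≡ Φ (x ⊕ k • y)
        combination x k y = trans (cong (Φ x ⊕_) (sym (homogeneous k y))) (sym (additive x (k • y)))
        zeros : ∀ d → 0# + d * 0# ≡ 0#
        zeros = solve 1 (λ d → con false :+ d :* con false := con false) refl

      n≢0 : n ≢ 0#
      n≢0 n≡0 = 1≢0 (proj₂ (proj₂ (Equivalence.to (Φ-axis {0#} {0#} {0#} {1#} {0#})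
        (subst InAxis (proj₂ θ₂) (absorb m (subst InAxis
          (trans (additive (r ∷ 0# ∷ n ∷ m ∷ p ∷ []) (m • (0# ∷ 0# ∷ 0# ∷ 1# ∷ 0# ∷ [])))
            (cong₂ _⊕_ ωw₂ (trans (homogeneous m _) (cong (m •_) (sym (proj₂ θ₂))))))
          (Equivalence.from Φ-axis (zeros m , trans (cong (_+ m * 0#) n≡0) (zeros m) ,
            solve 1 (λ m → m :+ m :* con true := con false) refl m))))))))
        where
        zeros : ∀ d → 0# + d * 0# ≡ 0#
        zeros = solve 1 (λ d → con false :+ d :* con false := con false) refl

      n⁻¹ c⁻¹ : Carrier
      n⁻¹ = proj₁ (invertible n n≢0)
      c⁻¹ = proj₁ (invertible c c≢0)

      -- Modulo the axis, ωf₂ is nf₁ + mf₂. The map given by a and κ sends f₁ and f₂ to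
      -- κ(f₁ + a^σ f₂) and μf₂ with μ = κ^(σ+1); modulo the axis these are ωu and u
      -- exactly when nκ^σ = 1 and na^σ = m.
      a κ : Carrier
      a = proj₁ (φ-surjective (n⁻¹ * m))
      κ = proj₁ (φ-surjective n⁻¹)

      nφκ≡1 : n * φ κ ≡ 1#
      nφκ≡1 = trans (cong (n *_) (proj₂ (φ-surjective n⁻¹))) (proj₂ (invertible n n≢0))

      nφa≡m : n * φ a ≡ m
      nφa≡m = trans (cong (n *_) (proj₂ (φ-surjective (n⁻¹ * m)))) (trans (sym (*-assoc n n⁻¹ m))
        (trans (cong (_* m) (proj₂ (invertible n n≢0))) (*-identityˡ m)))

      κ≢0 : κ ≢ 0#
      κ≢0 κ≡0 = 1≢0 (trans (sym nφκ≡1) (trans (cong (n *_) (trans (cong φ κ≡0) φ-0)) (zeroʳ n)))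

      κ⁻¹ : Carrier
      κ⁻¹ = proj₁ (invertible κ κ≢0)

      φκ≢0 : φ κ ≢ 0#
      φκ≢0 eq = 1≢0 (trans (sym nφκ≡1) (trans (cong (n *_) eq) (zeroʳ n)))

      -- P and R are the remaining coordinates of ωu. The parameter b absorbs P, and λ′
      -- scales V so that the f₃-coordinate of ωw is κ^(σ+2).
      μ λ′ P R b : Carrier
      μ  = κ * φ κ
      λ′ = κ * κ * φ κ * c⁻¹
      P  = μ * (p + a * c′)
      R  = μ * (r + a * d′)
      b  = P * κ⁻¹ + a * φ a

      -- θ(u) is μ(f₂ + af₃) and θ(w) is λ′V.
      u w : KL.Vector 2
      u = ⟦ μ ⟧ KL.• (w₂ KL.⊕ ⟦ a ⟧ KL.• w₃)
      w = ⟦ λ′ ⟧ KL.• w₄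

      -- K-multiplication commutes with the F-linear structure.
      slide : ∀ k x (y : KL.Vector 2) → k KL.• (⟦ x ⟧ KL.• y) ≡ ⟦ x ⟧ KL.• (k KL.• y)
      slide k x y = trans (sym (KL.•-assoc k ⟦ x ⟧ y)) (trans (cong (KL._• y) (K.*-comm k ⟦ x ⟧)) (KL.•-assoc ⟦ x ⟧ k y))

      θu : θ u ≡ Φ (0# ∷ 0# ∷ 0# ∷ μ ∷ μ * a ∷ [])
      θu = begin
        θ u                                          ≡⟨ θ-• μ _ ⟩
        μ • θ (w₂ KL.⊕ ⟦ a ⟧ KL.• w₃)                ≡⟨ cong (μ •_) (trans (θ-⊕ _ _) (cong₂ _⊕_ (proj₂ θ₂)
                                                          (trans (θ-• a w₃) (trans (cong (a •_) (proj₂ θ₃)) (sym (homogeneous a _)))))) ⟩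
        μ • (Φ (0# ∷ 0# ∷ 0# ∷ 1# ∷ 0# ∷ []) ⊕ Φ (a • (0# ∷ 0# ∷ 0# ∷ 0# ∷ 1# ∷ [])))
                                                     ≡⟨ trans (cong (μ •_) (sym (additive _ _))) (sym (homogeneous μ _)) ⟩
        Φ (μ • ((0# ∷ 0# ∷ 0# ∷ 1# ∷ 0# ∷ []) ⊕ a • (0# ∷ 0# ∷ 0# ∷ 0# ∷ 1# ∷ [])))
          ≡⟨ cong Φ (∷≡₅ (zeros μ a) (zeros μ a) (zeros μ a)
               (solve 2 (λ μ a → μ :* (con true :+ a :* con false) := μ) refl μ a)
               (solve 2 (λ μ a → μ :* (con false :+ a :* con true) := μ :* a) refl μ a)) ⟩
        Φ (0# ∷ 0# ∷ 0# ∷ μ ∷ μ * a ∷ [])            ∎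
        where
        zeros : ∀ μ a → μ * (0# + a * 0#) ≡ 0#
        zeros = solve 2 (λ μ a → μ :* (con false :+ a :* con false) := con false) refl

      θωu : θ (ω KL.• u) ≡ Φ (R ∷ 0# ∷ κ ∷ κ * φ a ∷ P ∷ [])
      θωu = begin
        θ (ω KL.• u)                                 ≡⟨ cong θ (trans (slide ω μ _) (cong (⟦ μ ⟧ KL.•_)
                                                          (trans (KL.•-distrib-⊕ ω w₂ _) (cong (ω KL.• w₂ KL.⊕_) (slide ω a w₃))))) ⟩
        θ (⟦ μ ⟧ KL.• (ω KL.• w₂ KL.⊕ ⟦ a ⟧ KL.• (ω KL.• w₃))) ≡⟨ θ-• μ _ ⟩
        μ • θ (ω KL.• w₂ KL.⊕ ⟦ a ⟧ KL.• (ω KL.• w₃)) ≡⟨ cong (μ •_) (trans (θ-⊕ _ _) (cong₂ _⊕_ (sym ωw₂)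
                                                          (trans (θ-• a _) (trans (cong (a •_) (sym ωw₃)) (sym (homogeneous a _)))))) ⟩
        μ • (Φ (r ∷ 0# ∷ n ∷ m ∷ p ∷ []) ⊕ Φ (a • (d′ ∷ 0# ∷ 0# ∷ 0# ∷ c′ ∷ [])))
                                                     ≡⟨ trans (cong (μ •_) (sym (additive _ _))) (sym (homogeneous μ _)) ⟩
        Φ (μ • ((r ∷ 0# ∷ n ∷ m ∷ p ∷ []) ⊕ a • (d′ ∷ 0# ∷ 0# ∷ 0# ∷ c′ ∷ [])))
          ≡⟨ cong Φ (∷≡₅ refl
               (solve 2 (λ μ a → μ :* (con false :+ a :* con false) := con false) refl μ a)
               (trans (solve 4 (λ κ κ′ n a → κ :* κ′ :* (n :+ a :* con false) := κ :* (n :* κ′)) refl κ (φ κ) n a)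
                 (trans (cong (κ *_) nφκ≡1) (*-identityʳ κ)))
               (trans (cong (λ m → κ * φ κ * (m + a * 0#)) (sym nφa≡m))
                 (trans (solve 5 (λ κ κ′ n a a′ → κ :* κ′ :* (n :* a′ :+ a :* con false) := κ :* (n :* κ′) :* a′)
                          refl κ (φ κ) n a (φ a))
                   (cong (_* φ a) (trans (cong (κ *_) nφκ≡1) (*-identityʳ κ)))))
               refl) ⟩
        Φ (R ∷ 0# ∷ κ ∷ κ * φ a ∷ P ∷ [])            ∎

      θw : θ w ≡ Φ (λ′ • (1# ∷ 0# ∷ 0# ∷ 0# ∷ 0# ∷ []))
      θw = trans (θ-• λ′ w₄) (trans (cong (λ′ •_) (proj₂ θ₄)) (sym (homogeneous λ′ _)))

      θωw : θ (ω KL.• w) ≡ Φ (λ′ • (d ∷ 0# ∷ 0# ∷ 0# ∷ c ∷ []))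
      θωw = trans (cong θ (slide ω λ′ w₄)) (trans (θ-• λ′ _) (trans (cong (λ′ •_) (sym ωw₄)) (sym (homogeneous λ′ _))))

      f₀ : Vector 5
      f₀ = Φ (0# ∷ 1# ∷ a ∷ b ∷ f a b ∷ [])

      -- Coordinates of a general point; the first one is along V and does not
      -- affect membership in the cone.
      expand : ∀ s t v z → f₀ ⊕ θ ((t +ω s) KL.• u KL.⊕ (v +ω z) KL.• w) ≡
        Φ (s * R + (v * λ′ + z * (λ′ * d)) ∷ 1# ∷ a + κ * s ∷ b + κ * φ κ * t + φ a * (κ * s) ∷
           (a * (κ * φ κ * t) + P * s + f a b) + κ * κ * φ κ * z ∷ [])
      expand s t v z = begin
        f₀ ⊕ θ ((t +ω s) KL.• u KL.⊕ (v +ω z) KL.• w)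
          ≡⟨ cong (f₀ ⊕_) (trans (θ-⊕ _ _) (cong₂ _⊕_ (θ-+ω ω ω∉F t s u) (θ-+ω ω ω∉F v z w))) ⟩
        f₀ ⊕ ((t • θ u ⊕ s • θ (ω KL.• u)) ⊕ (v • θ w ⊕ z • θ (ω KL.• w)))
          ≡⟨ cong (f₀ ⊕_) (cong₂ _⊕_ (pair t s θu θωu) (pair v z θw θωw)) ⟩
        f₀ ⊕ (Φ (t • U ⊕ s • U′) ⊕ Φ (v • W ⊕ z • W′))
          ≡⟨ trans (cong (f₀ ⊕_) (sym (additive _ _))) (sym (additive _ _)) ⟩
        Φ ((0# ∷ 1# ∷ a ∷ b ∷ f a b ∷ []) ⊕ ((t • U ⊕ s • U′) ⊕ (v • W ⊕ z • W′)))
          ≡⟨ cong Φ (∷≡₅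
               (solve 7 (λ t s v z R l d → con false :+ ((t :* con false :+ s :* R) :+ (v :* (l :* con true) :+ z :* (l :* d))) :=
                  s :* R :+ (v :* l :+ z :* (l :* d))) refl t s v z R λ′ d)
               (solve 5 (λ t s v z l → con true :+ ((t :* con false :+ s :* con false) :+ (v :* (l :* con false) :+ z :* (l :* con false))) :=
                  con true) refl t s v z λ′)
               (solve 7 (λ t s v z l a κ → a :+ ((t :* con false :+ s :* κ) :+ (v :* (l :* con false) :+ z :* (l :* con false))) :=
                  a :+ κ :* s) refl t s v z λ′ a κ)
               (solve 9 (λ t s v z l b κ κ′ a′ → b :+ ((t :* (κ :* κ′) :+ s :* (κ :* a′)) :+ (v :* (l :* con false) :+ z :* (l :* con false))) :=
                  b :+ κ :* κ′ :* t :+ a′ :* (κ :* s)) refl t s v z λ′ b κ (φ κ) (φ a))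
               (trans (solve 11 (λ t s v z a κ κ′ P f c i →
                    f :+ ((t :* (κ :* κ′ :* a) :+ s :* P) :+ (v :* (κ :* κ :* κ′ :* i :* con false) :+ z :* (κ :* κ :* κ′ :* i :* c))) :=
                    (a :* (κ :* κ′ :* t) :+ P :* s :+ f) :+ κ :* κ :* κ′ :* z :* (c :* i)) refl t s v z a κ (φ κ) P (f a b) c c⁻¹)
                 (cong ((a * (κ * φ κ * t) + P * s + f a b) +_)
                   (trans (cong (κ * κ * φ κ * z *_) (proj₂ (invertible c c≢0))) (*-identityʳ _))))) ⟩
        Φ (s * R + (v * λ′ + z * (λ′ * d)) ∷ 1# ∷ a + κ * s ∷ b + κ * φ κ * t + φ a * (κ * s) ∷
           (a * (κ * φ κ * t) + P * s + f a b) + κ * κ * φ κ * z ∷ [])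
          ∎
        where
        U U′ W W′ : Vector 5
        U  = 0# ∷ 0# ∷ 0# ∷ μ ∷ μ * a ∷ []
        U′ = R ∷ 0# ∷ κ ∷ κ * φ a ∷ P ∷ []
        W  = λ′ • (1# ∷ 0# ∷ 0# ∷ 0# ∷ 0# ∷ [])
        W′ = λ′ • (d ∷ 0# ∷ 0# ∷ 0# ∷ c ∷ [])
        pair : ∀ x y {v w X Y} → v ≡ Φ X → w ≡ Φ Y → x • v ⊕ y • w ≡ Φ (x • X ⊕ y • Y)
        pair x y refl refl = trans (sym (cong₂ _⊕_ (homogeneous x _) (homogeneous y _))) (sym (additive _ _))

      f-coordinates : ∀ s t → f (a + κ * s) (b + κ * φ κ * t + φ a * (κ * s)) ≡
                      (a * (κ * φ κ * t) + P * s + f a b) + κ * κ * φ κ * f s t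
      f-coordinates s t = begin
        f (a + κ * s) (b + κ * φ κ * t + φ a * (κ * s))
          ≡⟨ f-shift a b (κ * s) (κ * φ κ * t) ⟩
        f (κ * s) (κ * φ κ * t) + (a * (κ * φ κ * t) + (b + a * φ a) * (κ * s) + f a b)
          ≡⟨ cong₂ (λ x y → x + (a * (κ * φ κ * t) + y + f a b)) (f-scale κ s t) shear ⟩
        κ * κ * φ κ * f s t + (a * (κ * φ κ * t) + P * s + f a b)
          ≡⟨ +-comm _ _ ⟩
        (a * (κ * φ κ * t) + P * s + f a b) + κ * κ * φ κ * f s t  ∎
        where
        shear : (b + a * φ a) * (κ * s) ≡ P * s
        shear = trans (solve 5 (λ P i c κ s → (P :* i :+ c :+ c) :* (κ :* s) := P :* (κ :* i) :* s) refl P κ⁻¹ (a * φ a) κ s)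
          (cong (_* s) (trans (cong (P *_) (proj₂ (invertible κ κ≢0))) (*-identityʳ P)))

      μ≢0 : μ ≢ 0#
      μ≢0 = *-≢0 κ≢0 φκ≢0

      λ′≢0 : λ′ ≢ 0#
      λ′≢0 = *-≢0 (*-≢0 (*-≢0 κ≢0 κ≢0) φκ≢0) λ eq →
        1≢0 (trans (sym (proj₂ (invertible c c≢0))) (trans (cong (c *_) eq) (zeroʳ c)))

      w≢0 : w ≢ KL.0ᵥ
      w≢0 eq = w₄≢0 (KL.•-cancel (⟦⟧-≢0 λ′≢0) eq)
        where open EmbeddingProperties ι using (⟦⟧-≢0)

      w∈axis : InAxis (θ w)
      w∈axis = axis-scale ⟦ λ′ ⟧ w₄∈axis

      axis⇔ : ∀ v → InAxis v ⇔ OnSpreadLine w v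
      axis⇔ v = mk⇔ (Equivalence.to rebase ∘ Equivalence.to (axis-w₀ v))
                     (Equivalence.from (axis-w₀ v) ∘ Equivalence.from rebase)
        where
        rebase : OnSpreadLine w₀ v ⇔ OnSpreadLine w v
        rebase = OnSpreadLine-rebase w≢0 (Equivalence.to (axis-w₀ _) w∈axis) v

      u∉Kw : ¬ KL.Span (w ∷ []) u
      u∉Kw (k ∷ [] , eq) = μ≢0 (proj₂ (proj₂ (Equivalence.to (Φ-axis {0#} {0#} {0#} {μ} {μ * a})
        (subst InAxis θu (Equivalence.from (axis⇔ _) (k , cong θ (trans (sym (KL.⊕-identityʳ _)) eq)))))))

      normalised : Normalised
      normalised = record
        { f₀ = f₀
        ; f₀∉H = λ ∈H → 1≢0 (Equivalence.to Φ-H ∈H)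
        ; u = u
        ; w = w
        ; u,w-independent = KL.independent-∷ u∉Kw (KL.independent-singleton w≢0)
        ; axis⇔ = axis⇔
        ; cone⇔ = λ s t v z → mk⇔
            (λ ∈C → *-cancelˡ (*-≢0 (*-≢0 κ≢0 κ≢0) φκ≢0) (+-cancelˡ _ (trans
              (Equivalence.to Φ-cone (subst InCone (expand s t v z) ∈C)) (f-coordinates s t))))
            (λ { refl → subst InCone (sym (expand s t v (f s t))) (Equivalence.from Φ-cone (sym (f-coordinates s t))) })
        }

-- The André/Bruck-Bose plane in coordinates over K

module ABBCoordinates {q : ℕ} {F : FiniteField q} {K : FiniteField (q ℕ.^ 2)} (ι : Embedding F K)
    (1+1≡0 : FiniteField._+_ F (FiniteField.1# F) (FiniteField.1# F) ≡ FiniteField.0# F)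
    (H : Projective.Flat F 3 4) (S : Pred (Projective.Flat F 1 4) 0ℓ)
    (desarguesian : IsDesarguesian F K ι H S) where
  open FiniteField F
  open FieldProperties F
  open Characteristic2 F 1+1≡0
  open LinearAlgebra F 1+1≡0
  open QuadraticExtension {F = F} {K} ι 1+1≡0 using (⟦_⟧; OutsideF; outsideF; K-1+1≡0; module Basis)
  open FieldReduction ι 1+1≡0 H S desarguesian
  open ≡-Reasoning
  private
    module K = FiniteField K
    module KP = FieldProperties K
    module KL = LinearAlgebra K K-1+1≡0

    ω : K.Carrier
    ω = proj₁ outsideF
    ω∉F : OutsideF ω
    ω∉F = proj₂ outsideF

  open Basis ω ω∉F

  InH : Vector 5 → Set
  InH = Span (basis H)

  opaque
    outsideH : ∃[ v ] ¬ InH v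
    outsideH = finite-counterexample (vectors 5) (Span? (basis H)) λ all →
      ℕ.1+n≰n (dimension-≤ {bs = units} units-independent (All.universal all units))
      where
      units : Vec (Vector 5) 5
      units = columns {5} {5} id
      units-independent : Independent units
      units-independent c eq = trans (sym (lincomb-columns {T = id}
        (record { additive = λ _ _ → refl ; homogeneous = λ _ _ → refl }) c)) eq

  -- A vector off H, the origin of the affine plane.
  e₀ : Vector 5
  e₀ = proj₁ outsideH

  e₀∉H : ¬ InH e₀
  e₀∉H = proj₂ outsideH

  -- Every vector has a unique expression ce₀ + θ(w) with c in F and w in K².
  coordinates : ∀ v → ∃[ c ] ∃[ w ] v ≡ c • e₀ ⊕ θ w
  coordinates v with independent⇒spanning (independent-∷ e₀∉H (independent H)) v
  ... | c ∷ cs , refl = let w , eq = θ⁻¹ (cs , refl) in c , w , cong (c • e₀ ⊕_) (sym eq)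

  coordinates∈H : ∀ {c h} → InH h → InH (c • e₀ ⊕ h) → c ≡ 0#
  coordinates∈H {c} {h} h∈ ∈H with c ≟ 0#
  ... | yes c≡0 = c≡0
  ... | no c≢0  = contradiction (Span-•-cancel (basis H) c≢0
    (Span-cancel (basis H) h∈ (subst InH (⊕-comm (c • e₀) h) ∈H))) e₀∉H

  coordinates-unique : ∀ {c c′ w w′} → c • e₀ ⊕ θ w ≡ c′ • e₀ ⊕ θ w′ → c ≡ c′ × w ≡ w′
  coordinates-unique {c} {c′} {w} {w′} eq = +≡0⇒≡ c+c′≡0 , KL.⊕≡0⇒≡ (θ-kernel (begin
    θ (w KL.⊕ w′)                    ≡⟨ ⊕-identityˡ _ ⟨
    0ᵥ ⊕ θ (w KL.⊕ w′)               ≡⟨ cong (_⊕ θ (w KL.⊕ w′)) (trans (cong (_• e₀) c+c′≡0) (0•v≡0 e₀)) ⟨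
    (c + c′) • e₀ ⊕ θ (w KL.⊕ w′)    ≡⟨ sum≡0 ⟩
    0ᵥ                               ∎))
    where
    sum≡0 : (c + c′) • e₀ ⊕ θ (w KL.⊕ w′) ≡ 0ᵥ
    sum≡0 = begin
      (c + c′) • e₀ ⊕ θ (w KL.⊕ w′)              ≡⟨ cong₂ _⊕_ (•-distribʳ c c′ e₀) (θ-⊕ w w′) ⟩
      (c • e₀ ⊕ c′ • e₀) ⊕ (θ w ⊕ θ w′)          ≡⟨ ⊕-interchange _ _ _ _ ⟩
      (c • e₀ ⊕ θ w) ⊕ (c′ • e₀ ⊕ θ w′)          ≡⟨ cong (_⊕ (c′ • e₀ ⊕ θ w′)) eq ⟩
      (c′ • e₀ ⊕ θ w′) ⊕ (c′ • e₀ ⊕ θ w′)        ≡⟨ v⊕v≡0 _ ⟩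
      0ᵥ                                         ∎
    c+c′≡0 : c + c′ ≡ 0#
    c+c′≡0 = coordinates∈H (θ∈H (w KL.⊕ w′)) (subst InH (sym sum≡0) (Span-0 (basis H)))

  opaque
    e₀+θ∉H : ∀ w → ¬ InH (e₀ ⊕ θ w)
    e₀+θ∉H w ∈H = e₀∉H (Span-cancel (basis H) (θ∈H w) (subst InH (⊕-comm e₀ (θ w)) ∈H))

    e₀+θ≢0 : ∀ w → e₀ ⊕ θ w ≢ 0ᵥ
    e₀+θ≢0 w eq = e₀+θ∉H w (subst InH (sym eq) (Span-0 (basis H)))

  -- The affine point with coordinates w ∈ K².
  affinePoint : KL.Vector 2 → Point 4
  affinePoint w = ⟨ e₀ ⊕ θ w , e₀+θ≢0 w ⟩

  A : KL.Vector 2 → ABBPoint F H S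
  A w = affine (affinePoint w) (e₀+θ∉H w)

  lineBasis : KL.Point 1 → Vec (Vector 5) 2
  lineBasis u = θ (KL.rep u) ∷ θ (ω KL.• KL.rep u) ∷ []

  lincomb-line : ∀ a b u → lincomb (a ∷ b ∷ []) (lineBasis u) ≡ θ ((a +ω b) KL.• KL.rep u)
  lincomb-line a b u = trans (cong (a • θ (KL.rep u) ⊕_) (⊕-identityʳ _)) (sym (θ-+ω ω ω∉F a b (KL.rep u)))

  opaque
    line-independent : ∀ u → Independent (lineBasis u)
    line-independent u (a ∷ b ∷ []) eq = zero-coefficients (trans (sym (lincomb-line a b u)) eq)
      where
      zero-coefficients : θ ((a +ω b) KL.• KL.rep u) ≡ 0ᵥ → a ∷ b ∷ [] ≡ 0ᵥ
      zero-coefficients eq with (a +ω b) KP.≟ K.0#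
      ... | yes ab≡0 = let a≡0 , b≡0 = +ω-0 a b ab≡0 in cong₂ _∷_ a≡0 (cong (_∷ []) b≡0)
      ... | no ab≢0  = contradiction (KL.•-cancel ab≢0 (θ-kernel eq)) (KL.nonzero u)

  -- The spread line θ(K u).
  line : KL.Point 1 → Flat 1 4
  line u = record { basis = lineBasis u ; independent = line-independent u }

  line⇔ : ∀ u v → Span (basis (line u)) v ⇔ OnSpreadLine (KL.rep u) v
  line⇔ u v = mk⇔ (λ { (a ∷ b ∷ [] , refl) → (a +ω b) , sym (lincomb-line a b u) }) from
    where
    from : OnSpreadLine (KL.rep u) v → Span (basis (line u)) v
    from (k , refl) with +ω-surjective k
    ... | a , b , refl = a ∷ b ∷ [] , lincomb-line a b u

  opaque
    line∈S : ∀ u → S (line u)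
    line∈S u = Equivalence.from (spread (line u)) (u , line⇔ u)

  -- The point at infinity with direction u.
  I : KL.Point 1 → ABBPoint F H S
  I u = ideal (line u) (line∈S u)

  line⊆H : ∀ u → All InH (basis (line u))
  line⊆H u = θ∈H _ ∷ θ∈H _ ∷ []

  planeBasis : KL.Vector 2 → KL.Point 1 → Vec (Vector 5) 3
  planeBasis w u = (e₀ ⊕ θ w) ∷ lineBasis u

  opaque
    plane-independent : ∀ w u → Independent (planeBasis w u)
    plane-independent w u =
      independent-∷ (λ ∈line → e₀+θ∉H w (Span-trans (line⊆H u) ∈line)) (line-independent u)

    plane∩H : ∀ w u P → (Span (planeBasis w u) (rep P) × P ∈ᶠ H) ⇔ P ∈ᶠ line u
    plane∩H w u P = mk⇔ to from
      where
      to : Span (planeBasis w u) (rep P) × P ∈ᶠ H → P ∈ᶠ line u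
      to ((c ∷ cs , eq) , P∈H) with c ≟ 0#
      ... | yes refl = cs , trans (trans (sym (⊕-identityˡ _))
              (cong (_⊕ lincomb cs (lineBasis u)) (sym (0•v≡0 (e₀ ⊕ θ w))))) eq
      ... | no c≢0   = contradiction (Span-•-cancel (basis H) c≢0 (Span-cancel (basis H)
        (Span-trans (line⊆H u) (cs , refl)) (subst InH (trans (sym eq) (⊕-comm _ _)) P∈H))) (e₀+θ∉H w)
      from : P ∈ᶠ line u → Span (planeBasis w u) (rep P) × P ∈ᶠ H
      from (cs , eq) = (0# ∷ cs , trans (cong₂ _⊕_ (0•v≡0 _) eq) (⊕-identityˡ _)) ,
        Span-trans (line⊆H u) (cs , eq)

  -- The affine line of K² through w with direction u.
  L : KL.Vector 2 → KL.Point 1 → ABBLine F H S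
  L w u = planar (record
    { plane      = record { basis = planeBasis w u ; independent = plane-independent w u }
    ; ⊈H         = λ ⊆H → e₀+θ∉H w (⊆H (affinePoint w) (All.head (Span-basis (planeBasis w u))))
    ; spreadLine = line u
    ; inSpread   = line∈S u
    ; meet       = plane∩H w u
    })

  infix 4 _on_
  _on_ : ABBPoint F H S → ABBLine F H S → Set
  _on_ = _incident_ F H S

  A-on-L : ∀ w u k → A (w KL.⊕ k KL.• KL.rep u) on L w u
  A-on-L w u k with +ω-surjective k
  ... | a , b , refl = 1# ∷ a ∷ b ∷ [] , (begin
    1# • (e₀ ⊕ θ w) ⊕ lincomb (a ∷ b ∷ []) (basis (line u))
      ≡⟨ cong₂ _⊕_ (1•v≡v _) (lincomb-line a b u) ⟩
    (e₀ ⊕ θ w) ⊕ θ ((a +ω b) KL.• KL.rep u)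
      ≡⟨ trans (⊕-assoc _ _ _) (cong (e₀ ⊕_) (sym (θ-⊕ w _))) ⟩
    e₀ ⊕ θ (w KL.⊕ (a +ω b) KL.• KL.rep u)  ∎)

  on-L⇒A : ∀ w u w′ → A w′ on L w u → ∃[ k ] w′ ≡ w KL.⊕ k KL.• KL.rep u
  on-L⇒A w u w′ (c ∷ a ∷ b ∷ [] , eq) = a +ω b , (begin
    w′                                        ≡⟨ proj₂ unique ⟩
    ⟦ c ⟧ KL.• w KL.⊕ (a +ω b) KL.• KL.rep u  ≡⟨ cong (λ z → ⟦ z ⟧ KL.• w KL.⊕ (a +ω b) KL.• KL.rep u) (proj₁ unique) ⟨
    ⟦ 1# ⟧ KL.• w KL.⊕ (a +ω b) KL.• KL.rep u ≡⟨ cong (λ z → z KL.• w KL.⊕ (a +ω b) KL.• KL.rep u) 1#-homo ⟩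
    K.1# KL.• w KL.⊕ (a +ω b) KL.• KL.rep u   ≡⟨ cong (KL._⊕ (a +ω b) KL.• KL.rep u) (KL.1•v≡v w) ⟩
    w KL.⊕ (a +ω b) KL.• KL.rep u             ∎)
    where
    open EmbeddingProperties ι using (1#-homo)
    unique : 1# ≡ c × w′ ≡ ⟦ c ⟧ KL.• w KL.⊕ (a +ω b) KL.• KL.rep u
    unique = coordinates-unique (begin
      1# • e₀ ⊕ θ w′        ≡⟨ cong (_⊕ θ w′) (1•v≡v e₀) ⟩
      e₀ ⊕ θ w′             ≡⟨ eq ⟨
      c • (e₀ ⊕ θ w) ⊕ lincomb (a ∷ b ∷ []) (basis (line u))
        ≡⟨ cong₂ _⊕_ (trans (•-distrib-⊕ c e₀ (θ w)) (cong (c • e₀ ⊕_) (sym (θ-• c w)))) (lincomb-line a b u) ⟩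
      (c • e₀ ⊕ θ (⟦ c ⟧ KL.• w)) ⊕ θ ((a +ω b) KL.• KL.rep u)
        ≡⟨ trans (⊕-assoc _ _ _) (cong (c • e₀ ⊕_) (sym (θ-⊕ _ _))) ⟩
      c • e₀ ⊕ θ (⟦ c ⟧ KL.• w KL.⊕ (a +ω b) KL.• KL.rep u)  ∎)

  I-on-L : ∀ w u → I u on L w u
  I-on-L w u P (cs , eq) = 0# ∷ cs , trans (cong₂ _⊕_ (0•v≡0 _) eq) (⊕-identityˡ _)

  A-injective : ∀ {w w′} → affinePoint w ~ affinePoint w′ → w ≡ w′
  A-injective {w} {w′} (c , c≢0 , eq) = begin
    w              ≡⟨ KL.1•v≡v w ⟨
    K.1# KL.• w    ≡⟨ cong (KL._• w) (trans (sym 1#-homo) (cong ⟦_⟧ (sym (proj₁ unique)))) ⟩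
    ⟦ c ⟧ KL.• w   ≡⟨ proj₂ unique ⟩
    w′             ∎
    where
    open EmbeddingProperties ι using (1#-homo)
    unique : c ≡ 1# × ⟦ c ⟧ KL.• w ≡ w′
    unique = coordinates-unique (begin
      c • e₀ ⊕ θ (⟦ c ⟧ KL.• w)  ≡⟨ cong (c • e₀ ⊕_) (θ-• c w) ⟩
      c • e₀ ⊕ c • θ w           ≡⟨ •-distrib-⊕ c e₀ (θ w) ⟨
      c • (e₀ ⊕ θ w)             ≡⟨ eq ⟩
      e₀ ⊕ θ w′                  ≡⟨ cong (_⊕ θ w′) (1•v≡v e₀) ⟨
      1# • e₀ ⊕ θ w′             ∎)

-- Isomorphisms of the André/Bruck-Bose plane onto PG(2,q²) are semilinear

module Fundamental {q : ℕ} {F : FiniteField q} {K : FiniteField (q ℕ.^ 2)} (ι : Embedding F K)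
    (1+1≡0 : FiniteField._+_ F (FiniteField.1# F) (FiniteField.1# F) ≡ FiniteField.0# F)
    (H : Projective.Flat F 3 4) (S : Pred (Projective.Flat F 1 4) 0ℓ)
    (desarguesian : IsDesarguesian F K ι H S)
    (model : IncidenceIsomorphism (ABB F H S) (Projective.PG2 K)) where
  private
    module F = FiniteField F
    module FP = FieldProperties F
    module FL = LinearAlgebra F 1+1≡0
  open EmbeddingProperties ι using (⟦⟧-≢0) renaming (⟦_⟧ to ⟦_⟧ι; *-homo to ι-*; 1#-homo to ι-1)
  open ABBCoordinates ι 1+1≡0 H S desarguesian
  open FieldReduction ι 1+1≡0 H S desarguesian
  open QuadraticExtension {F = F} {K} ι 1+1≡0 using (K-1+1≡0)
  open FiniteField K
  open FieldProperties K
  open Characteristic2 K K-1+1≡0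
  open LinearAlgebra K K-1+1≡0
  open IncidenceIsomorphism model
  open ≡-Reasoning
  private
    module P = Setoid (IncidenceStructure.points (ABB F H S))

    -- A vector representing the image of a point.
    μ : ABBPoint F H S → Vector 3
    μ x = rep (onPoints x)

    μ-cong : ∀ {x y} → x P.≈ y → μ x ∝ μ y
    μ-cong {x} {y} = Inverse.to-cong pointBijection {x} {y}

    μ-injective : ∀ {x y} → μ x ∝ μ y → x P.≈ y
    μ-injective {x} {y} eq = P.trans {x} {from (onPoints x)} {y}
      (P.sym {from (onPoints x)} {x} (strictlyInverseʳ x))
      (P.trans {from (onPoints x)} {from (onPoints y)} {y} (from-cong eq) (strictlyInverseʳ y))
      where open Inverse pointBijection using (from; from-cong; strictlyInverseʳ)

    -- Images of collinear points are collinear, and conversely.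
    collinear : ∀ {l} x y z → x on l → y on l → z on l → ¬ x P.≈ y → Span (μ x ∷ μ y ∷ []) (μ z)
    collinear {l} x y z x∈ y∈ z∈ x≉y = Span-exchange {bs = μ x ∷ μ y ∷ []} {basis (onLines l)}
      (independent-∷ distinct (independent-singleton (nonzero (onPoints y))))
      (Equivalence.to (preservesIncidence x l) x∈ ∷ Equivalence.to (preservesIncidence y l) y∈ ∷ [])
      (Equivalence.to (preservesIncidence z l) z∈)
      where
      distinct : ¬ Span (μ y ∷ []) (μ x)
      distinct (c ∷ [] , eq) = x≉y (P.sym {y} {x} (μ-injective {y} {x} (c ,
        (λ { refl → nonzero (onPoints x) (trans (sym eq) (trans (⊕-identityʳ _) (0•v≡0 _))) }) ,
        trans (sym (⊕-identityʳ _)) eq)))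

    noncollinear : ∀ {l} x y z → x on l → y on l → ¬ z on l → ¬ Span (μ x ∷ μ y ∷ []) (μ z)
    noncollinear {l} x y z x∈ y∈ z∉ ∈span = z∉ (Equivalence.from (preservesIncidence z l) (Span-trans
      (Equivalence.to (preservesIncidence x l) x∈ ∷ Equivalence.to (preservesIncidence y l) y∈ ∷ []) ∈span))

    X̂ Ŷ Ê : Point 1
    X̂ = ⟨ 1# ∷ 0# ∷ [] , (λ eq → 1≢0 (Vec.∷-injectiveˡ eq)) ⟩
    Ŷ = ⟨ 0# ∷ 1# ∷ [] , (λ eq → 1≢0 (Vec.∷-injectiveˡ (Vec.∷-injectiveʳ eq))) ⟩
    Ê = ⟨ 1# ∷ 1# ∷ [] , (λ eq → 1≢0 (Vec.∷-injectiveˡ eq)) ⟩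

    -- The origin, the directions of the axes and the unit point.
    O X Y E : ABBPoint F H S
    O = A (0# ∷ 0# ∷ [])
    X = I X̂
    Y = I Ŷ
    E = A (1# ∷ 1# ∷ [])

    on-line : ∀ x y u v k {x′ y′} (nz : u ∷ v ∷ [] ≢ 0ᵥ) → x + k * u ≡ x′ → y + k * v ≡ y′ →
              A (x′ ∷ y′ ∷ []) on L (x ∷ y ∷ []) ⟨ u ∷ v ∷ [] , nz ⟩
    on-line x y u v k nz refl refl = A-on-L (x ∷ y ∷ []) ⟨ u ∷ v ∷ [] , nz ⟩ k

    through : ∀ x y u v (nz : u ∷ v ∷ [] ≢ 0ᵥ) → A (x ∷ y ∷ []) on L (x ∷ y ∷ []) ⟨ u ∷ v ∷ [] , nz ⟩
    through x y u v nz = on-line x y u v 0# nz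
      (solve 2 (λ x u → x :+ con false :* u := x) refl x u) (solve 2 (λ x u → x :+ con false :* u := x) refl y v)

    X≉Y : ¬ X P.≈ Y
    X≉Y (X⊆Y , _) with Equivalence.to (line⇔ Ŷ _) (X⊆Y ⟨X⟩ (FL.Span-basis₀ _))
      where
      ⟨X⟩ : FL.Point 4
      ⟨X⟩ = FL.⟨ θ (rep X̂) , (λ eq → nonzero X̂ (θ-kernel eq)) ⟩
    ... | k , eq = 1≢0 (trans (sym (Vec.∷-injectiveˡ (θ-injective eq))) (zeroʳ k))

    frame₀ : Vec (Vector 3) 3
    frame₀ = μ O ∷ μ X ∷ μ Y ∷ []

    opaque
      frame₀-independent : Independent frame₀
      frame₀-independent = independent-∷
        (noncollinear {ℓ∞} X Y O tt tt id)
        (independent-∷ (λ { (c ∷ [] , eq) → X≉Y (P.sym {Y} {X} (μ-injective {Y} {X} (c ,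
            (λ { refl → nonzero (onPoints X) (trans (sym eq) (trans (⊕-identityʳ _) (0•v≡0 _))) }) ,
            trans (sym (⊕-identityʳ _)) eq))) })
          (independent-singleton (nonzero (onPoints Y))))

    opaque
      E-span : ∃[ α ] ∃[ β ] ∃[ γ ] lincomb (α ∷ β ∷ γ ∷ []) frame₀ ≡ μ E
      E-span = split (independent⇒spanning frame₀-independent (μ E))
        where
        split : Span frame₀ (μ E) → ∃[ α ] ∃[ β ] ∃[ γ ] lincomb (α ∷ β ∷ γ ∷ []) frame₀ ≡ μ E
        split (α ∷ β ∷ γ ∷ [] , eq) = α , β , γ , eq

    -- Coordinates of the unit point E; none of them is zero.
    α β γ : Carrier
    E-coordinates : lincomb (α ∷ β ∷ γ ∷ []) frame₀ ≡ μ E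

    α = proj₁ E-span
    β = proj₁ (proj₂ E-span)
    γ = proj₁ (proj₂ (proj₂ E-span))
    E-coordinates = proj₂ (proj₂ (proj₂ E-span))

    α≢0 : α ≢ 0#
    α≢0 α≡0 = noncollinear {ℓ∞} X Y E tt tt id (β ∷ γ ∷ [] , (begin
      lincomb (β ∷ γ ∷ []) (μ X ∷ μ Y ∷ [])             ≡⟨ ⊕-identityˡ _ ⟨
      0ᵥ ⊕ lincomb (β ∷ γ ∷ []) (μ X ∷ μ Y ∷ [])
        ≡⟨ cong (_⊕ lincomb (β ∷ γ ∷ []) (μ X ∷ μ Y ∷ [])) (trans (cong (_• μ O) α≡0) (0•v≡0 (μ O))) ⟨
      lincomb (α ∷ β ∷ γ ∷ []) frame₀                   ≡⟨ E-coordinates ⟩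
      μ E                                               ∎))

    β≢0 : β ≢ 0#
    β≢0 β≡0 = noncollinear {L (0# ∷ 0# ∷ []) Ŷ} O Y E (through 0# 0# 0# 1# (nonzero Ŷ)) (I-on-L _ Ŷ)
      (λ ∈L → let k , eq = on-L⇒A (0# ∷ 0# ∷ []) Ŷ (1# ∷ 1# ∷ []) ∈L in
        1≢0 (trans (Vec.∷-injectiveˡ eq) (solve 1 (λ k → con false :+ k :* con false := con false) refl k)))
      (α ∷ γ ∷ [] , trans (cong (α • μ O ⊕_) (trans (sym (⊕-identityˡ _))
        (cong (_⊕ (γ • μ Y ⊕ 0ᵥ)) (sym (trans (cong (_• μ X) β≡0) (0•v≡0 (μ X))))))) E-coordinates)

    γ≢0 : γ ≢ 0#
    γ≢0 γ≡0 = noncollinear {L (0# ∷ 0# ∷ []) X̂} O X E (through 0# 0# 1# 0# (nonzero X̂)) (I-on-L _ X̂)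
      (λ ∈L → let k , eq = on-L⇒A (0# ∷ 0# ∷ []) X̂ (1# ∷ 1# ∷ []) ∈L in
        1≢0 (trans (Vec.∷-injectiveˡ (Vec.∷-injectiveʳ eq)) (solve 1 (λ k → con false :+ k :* con false := con false) refl k)))
      (α ∷ β ∷ [] , trans (cong (λ v → α • μ O ⊕ (β • μ X ⊕ v)) (sym (trans (⊕-identityʳ _)
        (trans (cong (_• μ Y) γ≡0) (0•v≡0 (μ Y)))))) E-coordinates)

  -- The coordinate frame of PG(2,q²) in which O, X, Y, E have their standard coordinates.
  frame : Vec (Vector 3) 3
  frame = α • μ O ∷ β • μ X ∷ γ • μ Y ∷ []

  frame-independent : Independent frame
  frame-independent (a ∷ b ∷ c ∷ []) eq = cong₂ _∷_ (cancel α≢0 (Vec.∷-injectiveˡ zeros))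
    (cong₂ _∷_ (cancel β≢0 (Vec.∷-injectiveˡ (Vec.∷-injectiveʳ zeros)))
      (cong (_∷ []) (cancel γ≢0 (Vec.∷-injectiveˡ (Vec.∷-injectiveʳ (Vec.∷-injectiveʳ zeros))))))
    where
    cancel : ∀ {x y} → y ≢ 0# → x * y ≡ 0# → x ≡ 0#
    cancel y≢0 eq = *-≡0 (trans (*-comm _ _) eq) y≢0
    zeros : a * α ∷ b * β ∷ c * γ ∷ [] ≡ 0ᵥ
    zeros = frame₀-independent (a * α ∷ b * β ∷ c * γ ∷ []) (trans (cong₂ _⊕_ (•-assoc a α _)
      (cong₂ _⊕_ (•-assoc b β _) (cong (_⊕ 0ᵥ) (•-assoc c γ _)))) eq)

  private
    -- x has homogeneous coordinates k with respect to the frame.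
    infix 4 _≋_
    record _≋_ (x : ABBPoint F H S) (k : Vector 3) : Set where
      constructor coords
      field
        proportional : lincomb k frame ∝ μ x
    open _≋_

    ∷≡₃ : ∀ {x y z x′ y′ z′ : Carrier} → x ≡ x′ → y ≡ y′ → z ≡ z′ →
          _≡_ {A = Vector 3} (x ∷ y ∷ z ∷ []) (x′ ∷ y′ ∷ z′ ∷ [])
    ∷≡₃ refl refl refl = refl

    ≋-unique : ∀ {x k l} → x ≋ k → x ≋ l → k ∝ l
    ≋-unique {x} {k} {l} x≋k x≋l = recover (∝-trans (proportional x≋k) (∝-sym (proportional x≋l)))
      where
      recover : lincomb k frame ∝ lincomb l frame → k ∝ l
      recover (c , c≢0 , eq) = c , c≢0 , lincomb-injective frame-independent (trans (lincomb-• c k frame) eq)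

    ≋-cong : ∀ {x k l} → k ≡ l → x ≋ k → x ≋ l
    ≋-cong refl x≋k = x≋k

    ≋-scale : ∀ {x k l} → l ∝ k → x ≋ k → x ≋ l
    ≋-scale l∝k x≋k = coords (∝-trans (∝-linear (lincomb-linear frame) l∝k) (proportional x≋k))

    ≋-≢0 : ∀ {x k} → x ≋ k → k ≢ 0ᵥ
    ≋-≢0 {x} x≋k refl = zero-rep (proportional x≋k)
      where
      zero-rep : ¬ lincomb 0ᵥ frame ∝ μ x
      zero-rep (c , c≢0 , eq) = nonzero (onPoints x)
        (trans (sym eq) (trans (cong (c •_) (lincomb-0 frame)) (c•0≡0 c)))

    -- The points of the line joining x and y.
    join : ∀ l {x y z j k} → x on l → y on l → z on l → ¬ x P.≈ y → x ≋ j → y ≋ k →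
           ∃[ a ] ∃[ b ] z ≋ a • j ⊕ b • k
    join l {x} {y} {z} {j} {k} x∈ y∈ z∈ x≉y x≋j y≋k =
      combine (collinear x y z x∈ y∈ z∈ x≉y) (proportional x≋j) (proportional y≋k)
      where
      scaled : ∀ a c j {v} → c • lincomb j frame ≡ v → lincomb ((a * c) • j) frame ≡ a • v
      scaled a c j eq = trans (lincomb-• (a * c) j frame) (trans (•-assoc a c _) (cong (a •_) eq))
      combine : Span (μ x ∷ μ y ∷ []) (μ z) → lincomb j frame ∝ μ x → lincomb k frame ∝ μ y →
                ∃[ a ] ∃[ b ] z ≋ a • j ⊕ b • k
      combine (a ∷ b ∷ [] , eq) (c , c≢0 , cx) (d , d≢0 , dy) = a * c , b * d , coords (≡⇒∝ (begin
        lincomb ((a * c) • j ⊕ (b * d) • k) frame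
          ≡⟨ lincomb-⊕ ((a * c) • j) ((b * d) • k) frame ⟩
        lincomb ((a * c) • j) frame ⊕ lincomb ((b * d) • k) frame
          ≡⟨ cong₂ _⊕_ (scaled a c j cx) (scaled b d k dy) ⟩
        a • μ x ⊕ b • μ y
          ≡⟨ cong (a • μ x ⊕_) (⊕-identityʳ _) ⟨
        a • μ x ⊕ (b • μ y ⊕ 0ᵥ)
          ≡⟨ eq ⟩
        μ z  ∎))

    O≋ : O ≋ 1# ∷ 0# ∷ 0# ∷ []
    O≋ = coords (∝-trans (≡⇒∝ (begin
      1# • α • μ O ⊕ (0# • β • μ X ⊕ (0# • γ • μ Y ⊕ 0ᵥ))
        ≡⟨ cong₂ _⊕_ (1•v≡v _) (cong₂ _⊕_ (0•v≡0 _) (trans (⊕-identityʳ _) (0•v≡0 _))) ⟩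
      α • μ O ⊕ (0ᵥ ⊕ 0ᵥ)   ≡⟨ trans (cong (α • μ O ⊕_) (⊕-identityʳ 0ᵥ)) (⊕-identityʳ _) ⟩
      α • μ O               ∎)) (∝-sym (α , α≢0 , refl)))

    X≋ : X ≋ 0# ∷ 1# ∷ 0# ∷ []
    X≋ = coords (∝-trans (≡⇒∝ (begin
      0# • α • μ O ⊕ (1# • β • μ X ⊕ (0# • γ • μ Y ⊕ 0ᵥ))
        ≡⟨ cong₂ _⊕_ (0•v≡0 _) (cong₂ _⊕_ (1•v≡v _) (trans (⊕-identityʳ _) (0•v≡0 _))) ⟩
      0ᵥ ⊕ (β • μ X ⊕ 0ᵥ)   ≡⟨ trans (⊕-identityˡ _) (⊕-identityʳ _) ⟩
      β • μ X               ∎)) (∝-sym (β , β≢0 , refl)))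

    Y≋ : Y ≋ 0# ∷ 0# ∷ 1# ∷ []
    Y≋ = coords (∝-trans (≡⇒∝ (begin
      0# • α • μ O ⊕ (0# • β • μ X ⊕ (1# • γ • μ Y ⊕ 0ᵥ))
        ≡⟨ cong₂ _⊕_ (0•v≡0 _) (cong₂ _⊕_ (0•v≡0 _) (trans (⊕-identityʳ _) (1•v≡v _))) ⟩
      0ᵥ ⊕ (0ᵥ ⊕ γ • μ Y)   ≡⟨ trans (⊕-identityˡ _) (⊕-identityˡ _) ⟩
      γ • μ Y               ∎)) (∝-sym (γ , γ≢0 , refl)))

    E≋ : E ≋ 1# ∷ 1# ∷ 1# ∷ []
    E≋ = coords (≡⇒∝ (trans (cong₂ _⊕_ (1•v≡v _) (cong₂ _⊕_ (1•v≡v _) (cong (_⊕ 0ᵥ) (1•v≡v _)))) E-coordinates))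

    -- Comparison of normalised coordinates with arbitrary ones.
    compare : ∀ {x a b k l m} → x ≋ 1# ∷ a ∷ b ∷ [] → x ≋ k ∷ l ∷ m ∷ [] → k ≢ 0# × k * a ≡ l × k * b ≡ m
    compare {x} {a} {b} {k} {l} {m} x≋ x≋′ = extract (≋-unique x≋ x≋′)
      where
      extract : 1# ∷ a ∷ b ∷ [] ∝ k ∷ l ∷ m ∷ [] → k ≢ 0# × k * a ≡ l × k * b ≡ m
      extract (c , c≢0 , eq) with trans (sym (*-identityʳ c)) (Vec.∷-injectiveˡ eq)
      ... | refl = c≢0 , Vec.∷-injectiveˡ (Vec.∷-injectiveʳ eq) ,
                   Vec.∷-injectiveˡ (Vec.∷-injectiveʳ (Vec.∷-injectiveʳ eq))

    normalise : ∀ {x k l m} → k ≢ 0# → x ≋ k ∷ l ∷ m ∷ [] →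
                ∃[ a ] ∃[ b ] (x ≋ 1# ∷ a ∷ b ∷ [] × k * a ≡ l × k * b ≡ m)
    normalise {x} {k} {l} {m} k≢0 x≋ =
      let k⁻¹ , kk⁻¹≡1 = invertible k k≢0
          undo : ∀ l → k * (k⁻¹ * l) ≡ l
          undo l = trans (sym (*-assoc k k⁻¹ l)) (trans (cong (_* l) kk⁻¹≡1) (*-identityˡ l))
      in k⁻¹ * l , k⁻¹ * m , ≋-scale (k , k≢0 , ∷≡₃ (*-identityʳ k) (undo l) (undo m)) x≋ , undo l , undo m

    -- Otherwise the image of A(w) is on the image of ℓ∞.
    affine-≢0 : ∀ {w k l m} → A w ≋ k ∷ l ∷ m ∷ [] → k ≢ 0#
    affine-≢0 {w} {k} {l} {m} A≋ refl = noncollinear {ℓ∞} X Y (A w) tt tt id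
      (in-span (proportional A≋))
      where
      in-span : lincomb (0# ∷ l ∷ m ∷ []) frame ∝ μ (A w) → Span (μ X ∷ μ Y ∷ []) (μ (A w))
      in-span prop = Span-resp _ prop (subst (Span _) (sym (begin
        0# • α • μ O ⊕ (l • β • μ X ⊕ (m • γ • μ Y ⊕ 0ᵥ))
          ≡⟨ trans (cong (_⊕ (l • β • μ X ⊕ (m • γ • μ Y ⊕ 0ᵥ))) (0•v≡0 _)) (⊕-identityˡ _) ⟩
        l • β • μ X ⊕ (m • γ • μ Y ⊕ 0ᵥ)
          ≡⟨ cong₂ _⊕_ (•-assoc l β _) (cong (_⊕ 0ᵥ) (•-assoc m γ _)) ⟨
        (l * β) • μ X ⊕ ((m * γ) • μ Y ⊕ 0ᵥ)  ∎)) (l * β ∷ m * γ ∷ [] , refl))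

    opaque
      -- The points A(x,0) and A(0,y).
      horizontal : ∀ x → ∃[ a ] A (x ∷ 0# ∷ []) ≋ 1# ∷ a ∷ 0# ∷ []
      horizontal x = fromJoin (join (L (0# ∷ 0# ∷ []) X̂) {O} {X} {A (x ∷ 0# ∷ [])}
          (through 0# 0# 1# 0# (nonzero X̂)) (I-on-L (0# ∷ 0# ∷ []) X̂)
          (on-line 0# 0# 1# 0# x (nonzero X̂) (solve 1 (λ x → con false :+ x :* con true := x) refl x)
            (solve 1 (λ x → con false :+ x :* con false := con false) refl x))
          id O≋ X≋)
        where
        fromJoin : ∃[ a ] ∃[ b ] A (x ∷ 0# ∷ []) ≋ a • (1# ∷ 0# ∷ 0# ∷ []) ⊕ b • (0# ∷ 1# ∷ 0# ∷ []) →
                   ∃[ a ] A (x ∷ 0# ∷ []) ≋ 1# ∷ a ∷ 0# ∷ []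
        fromJoin (a , b , J) =
          let y , z , J′ , _ , kz≡0 = normalise (affine-≢0 J) J in
          y , ≋-cong (∷≡₃ refl refl (*-≡0 (trans kz≡0
            (solve 2 (λ a b → a :* con false :+ b :* con false := con false) refl a b)) (affine-≢0 J))) J′

      vertical : ∀ y → ∃[ b ] A (0# ∷ y ∷ []) ≋ 1# ∷ 0# ∷ b ∷ []
      vertical y = fromJoin (join (L (0# ∷ 0# ∷ []) Ŷ) {O} {Y} {A (0# ∷ y ∷ [])}
          (through 0# 0# 0# 1# (nonzero Ŷ)) (I-on-L (0# ∷ 0# ∷ []) Ŷ)
          (on-line 0# 0# 0# 1# y (nonzero Ŷ) (solve 1 (λ x → con false :+ x :* con false := con false) refl y)
            (solve 1 (λ x → con false :+ x :* con true := x) refl y))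
          id O≋ Y≋)
        where
        fromJoin : ∃[ a ] ∃[ b ] A (0# ∷ y ∷ []) ≋ a • (1# ∷ 0# ∷ 0# ∷ []) ⊕ b • (0# ∷ 0# ∷ 1# ∷ []) →
                   ∃[ b ] A (0# ∷ y ∷ []) ≋ 1# ∷ 0# ∷ b ∷ []
        fromJoin (a , b , J) =
          let z , x , J′ , kz≡0 , _ = normalise (affine-≢0 J) J in
          x , ≋-cong (∷≡₃ refl (*-≡0 (trans kz≡0
            (solve 2 (λ a b → a :* con false :+ b :* con false := con false) refl a b)) (affine-≢0 J)) refl) J′

    -- The maps induced on the two coordinate axes.
    φ ψ : Carrier → Carrier
    φ x = proj₁ (horizontal x)
    ψ y = proj₁ (vertical y)

    A-on-horizontal : ∀ x y → A (x ∷ y ∷ []) on L (0# ∷ y ∷ []) X̂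
    A-on-horizontal x y = on-line 0# y 1# 0# x (nonzero X̂)
      (solve 1 (λ x → con false :+ x :* con true := x) refl x)
      (solve 2 (λ x y → y :+ x :* con false := y) refl x y)

    A-on-vertical : ∀ x y → A (x ∷ y ∷ []) on L (x ∷ 0# ∷ []) Ŷ
    A-on-vertical x y = on-line x 0# 0# 1# y (nonzero Ŷ)
      (solve 2 (λ x y → x :+ y :* con false := x) refl x y)
      (solve 1 (λ y → con false :+ y :* con true := y) refl y)

    -- A(x,y) is the intersection of a horizontal and a vertical line.
    A≋ : ∀ x y → A (x ∷ y ∷ []) ≋ 1# ∷ φ x ∷ ψ y ∷ []
    A≋ x y = fromJoins
      (join (L (x ∷ 0# ∷ []) Ŷ) {A (x ∷ 0# ∷ [])} {Y} {A (x ∷ y ∷ [])} (A-on-vertical x 0#)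
        (I-on-L (x ∷ 0# ∷ []) Ŷ) (A-on-vertical x y) id (proj₂ (horizontal x)) Y≋)
      (join (L (0# ∷ y ∷ []) X̂) {A (0# ∷ y ∷ [])} {X} {A (x ∷ y ∷ [])} (A-on-horizontal 0# y)
        (I-on-L (0# ∷ y ∷ []) X̂) (A-on-horizontal x y) id (proj₂ (vertical y)) X≋)
      where
      e₁ : ∀ a b → a * 1# + b * 0# ≡ a
      e₁ = solve 2 (λ a b → a :* con true :+ b :* con false := a) refl
      e₂ : ∀ a b c → a * c + b * 0# ≡ a * c
      e₂ = solve 3 (λ a b c → a :* c :+ b :* con false := a :* c) refl
      fromJoins : ∃[ a ] ∃[ b ] A (x ∷ y ∷ []) ≋ a • (1# ∷ φ x ∷ 0# ∷ []) ⊕ b • (0# ∷ 0# ∷ 1# ∷ []) →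
                  ∃[ c ] ∃[ d ] A (x ∷ y ∷ []) ≋ c • (1# ∷ 0# ∷ ψ y ∷ []) ⊕ d • (0# ∷ 1# ∷ 0# ∷ []) →
                  A (x ∷ y ∷ []) ≋ 1# ∷ φ x ∷ ψ y ∷ []
      fromJoins (a , b , V) (c , d , U) =
        let V′ = ≋-cong (∷≡₃ (e₁ a b) (e₂ a b (φ x)) refl) V
            U′ = ≋-cong (∷≡₃ (e₁ c d) refl (e₂ c d (ψ y))) U
            p , r , W , ap≡ , _ = normalise (affine-≢0 V′) V′
            c≢0 , _ , cr≡ = compare W U′
        in ≋-cong (∷≡₃ refl (*-cancelˡ (affine-≢0 V′) ap≡) (*-cancelˡ c≢0 cr≡)) W

    compare₁ : ∀ {x a b a′ b′} → x ≋ 1# ∷ a ∷ b ∷ [] → x ≋ 1# ∷ a′ ∷ b′ ∷ [] → a ≡ a′ × b ≡ b′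
    compare₁ x≋ x≋′ = let _ , p , r = compare x≋ x≋′ in
      trans (sym (*-identityˡ _)) p , trans (sym (*-identityˡ _)) r

    φ-0 : φ 0# ≡ 0#
    φ-0 = proj₁ (compare₁ (A≋ 0# 0#) O≋)
    φ-1 : φ 1# ≡ 1#
    φ-1 = proj₁ (compare₁ (A≋ 1# 1#) E≋)

    O≉E : ¬ O P.≈ E
    O≉E O~E = 1≢0 (sym (Vec.∷-injectiveˡ (A-injective O~E)))

    -- The diagonal joins O to E.
    φ≡ψ : ∀ x → φ x ≡ ψ x
    φ≡ψ x = fromJoin (join (L (0# ∷ 0# ∷ []) Ê) {O} {E} {A (x ∷ x ∷ [])} (through 0# 0# 1# 1# (nonzero Ê))
        (diagonal 1#) (diagonal x) O≉E O≋ E≋)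
      where
      diagonal : ∀ x → A (x ∷ x ∷ []) on L (0# ∷ 0# ∷ []) Ê
      diagonal x = on-line 0# 0# 1# 1# x (nonzero Ê) (e x) (e x)
        where
        e : ∀ x → 0# + x * 1# ≡ x
        e = solve 1 (λ x → con false :+ x :* con true := x) refl
      fromJoin : ∃[ a ] ∃[ b ] A (x ∷ x ∷ []) ≋ a • (1# ∷ 0# ∷ 0# ∷ []) ⊕ b • (1# ∷ 1# ∷ 1# ∷ []) → φ x ≡ ψ x
      fromJoin (a , b , D) = let k≢0 , p , r = compare (A≋ x x) D in *-cancelˡ k≢0 (trans p (sym r))

    Aφ : ∀ x y → A (x ∷ y ∷ []) ≋ 1# ∷ φ x ∷ φ y ∷ []
    Aφ x y = ≋-cong (∷≡₃ refl refl (sym (φ≡ψ y))) (A≋ x y)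

    -- I(u,v) is the intersection of ℓ∞ with the line joining O to A(u,v).
    Iφ : ∀ u v (nz : u ∷ v ∷ [] ≢ 0ᵥ) → I ⟨ u ∷ v ∷ [] , nz ⟩ ≋ 0# ∷ φ u ∷ φ v ∷ []
    Iφ u v nz = fromJoins
      (join (L (0# ∷ 0# ∷ []) û) {O} {A (u ∷ v ∷ [])} {I û} (through 0# 0# u v nz)
        (on-line 0# 0# u v 1# nz (e u) (e v)) (I-on-L (0# ∷ 0# ∷ []) û)
        (λ O~A → nz (sym (A-injective O~A))) O≋ (Aφ u v))
      (join ℓ∞ {X} {Y} {I û} tt tt tt X≉Y X≋ Y≋)
      where
      û : Point 1
      û = ⟨ u ∷ v ∷ [] , nz ⟩
      e : ∀ u → 0# + 1# * u ≡ u
      e = solve 1 (λ u → con false :+ con true :* u := u) refl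
      fromJoins : ∃[ a ] ∃[ b ] I û ≋ a • (1# ∷ 0# ∷ 0# ∷ []) ⊕ b • (1# ∷ φ u ∷ φ v ∷ []) →
                  ∃[ c ] ∃[ d ] I û ≋ c • (0# ∷ 1# ∷ 0# ∷ []) ⊕ d • (0# ∷ 0# ∷ 1# ∷ []) →
                  I û ≋ 0# ∷ φ u ∷ φ v ∷ []
      fromJoins (a , b , J) (c , d , ℓ) = ≋-scale (b , b≢0 , sym shape) J
        where
        a+b≡0 : a * 1# + b * 1# ≡ 0#
        a+b≡0 = let k , k≢0 , eq = ≋-unique ℓ J in trans (sym (Vec.∷-injectiveˡ eq))
          (solve 3 (λ k c d → k :* (c :* con false :+ d :* con false) := con false) refl k c d)
        shape : a • (1# ∷ 0# ∷ 0# ∷ []) ⊕ b • (1# ∷ φ u ∷ φ v ∷ []) ≡ b • (0# ∷ φ u ∷ φ v ∷ [])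
        shape = ∷≡₃ (trans a+b≡0 (sym (zeroʳ b))) (drop (φ u)) (drop (φ v))
          where
          drop : ∀ x → a * 0# + b * x ≡ b * x
          drop = solve 3 (λ a b x → a :* con false :+ b :* x := b :* x) refl a b
        b≢0 : b ≢ 0#
        b≢0 refl = ≋-≢0 J (trans shape (0•v≡0 _))

    -- The line of slope 1 through A(0,b) contains A(x, x + b).
    φ-+ : ∀ x b → φ (x + b) ≡ φ x + φ b
    φ-+ x b = fromJoin (join (L (0# ∷ b ∷ []) Ê) {A (0# ∷ b ∷ [])} {I Ê} {A (x ∷ x + b ∷ [])}
        (through 0# b 1# 1# (nonzero Ê)) (I-on-L (0# ∷ b ∷ []) Ê)
        (on-line 0# b 1# 1# x (nonzero Ê) (solve 1 (λ x → con false :+ x :* con true := x) refl x)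
          (solve 2 (λ x b → b :+ x :* con true := x :+ b) refl x b))
        id (Aφ 0# b) (Iφ 1# 1# (nonzero Ê)))
      where
      fromJoin : ∃[ a ] ∃[ c ] A (x ∷ x + b ∷ []) ≋ a • (1# ∷ φ 0# ∷ φ b ∷ []) ⊕ c • (0# ∷ φ 1# ∷ φ 1# ∷ []) →
                 φ (x + b) ≡ φ x + φ b
      fromJoin (a , c , J) =
        let k≢0 , p , r = compare (Aφ x (x + b)) J
        in *-cancelˡ k≢0 (begin
          (a * 1# + c * 0#) * φ (x + b)     ≡⟨ r ⟩
          a * φ b + c * φ 1#                ≡⟨ solve 3 (λ a b c → a :* b :+ c := (a :* con false :+ c) :+ a :* b) refl a (φ b) (c * φ 1#) ⟩
          (a * 0# + c * φ 1#) + a * φ b     ≡⟨ cong (λ z → (a * z + c * φ 1#) + a * φ b) φ-0 ⟨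
          (a * φ 0# + c * φ 1#) + a * φ b   ≡⟨ cong (_+ a * φ b) p ⟨
          (a * 1# + c * 0#) * φ x + a * φ b
            ≡⟨ solve 4 (λ a c x b → (a :* con true :+ c :* con false) :* x :+ a :* b :=
                 (a :* con true :+ c :* con false) :* (x :+ b)) refl a c (φ x) (φ b) ⟩
          (a * 1# + c * 0#) * (φ x + φ b)   ∎)

    -- The line of slope m through the origin contains A(x, xm).
    φ-* : ∀ x m → φ (x * m) ≡ φ x * φ m
    φ-* x m = fromJoin (join (L (0# ∷ 0# ∷ []) m̂) {O} {I m̂} {A (x ∷ x * m ∷ [])}
        (through 0# 0# 1# m (nonzero m̂)) (I-on-L (0# ∷ 0# ∷ []) m̂)
        (on-line 0# 0# 1# m x (nonzero m̂) (solve 1 (λ x → con false :+ x :* con true := x) refl x)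
          (+-identityˡ _))
        id O≋ (Iφ 1# m (nonzero m̂)))
      where
      m̂ : Point 1
      m̂ = ⟨ 1# ∷ m ∷ [] , (λ eq → 1≢0 (Vec.∷-injectiveˡ eq)) ⟩
      fromJoin : ∃[ a ] ∃[ c ] A (x ∷ x * m ∷ []) ≋ a • (1# ∷ 0# ∷ 0# ∷ []) ⊕ c • (0# ∷ φ 1# ∷ φ m ∷ []) →
                 φ (x * m) ≡ φ x * φ m
      fromJoin (a , c , J) =
        let k≢0 , p , r = compare (Aφ x (x * m)) J in
        *-cancelˡ k≢0 (begin
          (a * 1# + c * 0#) * φ (x * m)          ≡⟨ r ⟩
          a * 0# + c * φ m
            ≡⟨ solve 3 (λ a c m → a :* con false :+ c :* m := (a :* con false :+ c :* con true) :* m) refl a c (φ m) ⟩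
          (a * 0# + c * 1#) * φ m                ≡⟨ cong (λ z → (a * 0# + c * z) * φ m) φ-1 ⟨
          (a * 0# + c * φ 1#) * φ m              ≡⟨ cong (_* φ m) p ⟨
          (a * 1# + c * 0#) * φ x * φ m          ≡⟨ *-assoc _ _ _ ⟩
          (a * 1# + c * 0#) * (φ x * φ m)        ∎)

  -- The companion automorphism of the model.
  τ : Embedding K K
  τ = record
    { ⟦_⟧ = φ
    ; isHomomorphism = record
      { isSemiringHomomorphism = record
        { isNearSemiringHomomorphism = record
          { +-isMonoidHomomorphism = record
            { isMagmaHomomorphism = record
              { isRelHomomorphism = record { cong = cong φ } ; homo = φ-+ }
            ; ε-homo = φ-0
            }
          ; *-homo = φ-*
          }
        ; 1#-homo = φ-1
        }
      ; -‿homo = λ x → trans (cong φ (-x≡x x)) (sym (-x≡x (φ x)))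
      }
    }
    where
    -x≡x : ∀ x → - x ≡ x
    -x≡x x = +-cancelˡ x (trans (-‿inverseʳ x) (sym (x+x≡0 x)))

  -- The semilinear map that the model induces on coordinates.
  semilinear : Vector 3 → Vector 3
  semilinear k = lincomb (map φ k) frame

  model-affine : ∀ P P∉H c w → FL.rep P ≡ c FL.• e₀ FL.⊕ θ w →
                 semilinear (⟦ c ⟧ι ∷ w) ∝ rep (onPoints (affine P P∉H))
  model-affine P P∉H c (x ∷ y ∷ []) eq =
    ∝-trans (proportional (≋-scale (d , d≢0 , ∷≡₃ (φ-inverse) (sym (φ-* _ x)) (sym (φ-* _ y))) (Aφ (⟦ c⁻¹ ⟧ι * x) (⟦ c⁻¹ ⟧ι * y))))
      (μ-cong {A (⟦ c⁻¹ ⟧ι • (x ∷ y ∷ []))} {affine P P∉H} (c , c≢0 , scaled))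
    where
    c≢0 : c ≢ F.0#
    c≢0 refl = P∉H (subst InH (trans (sym (FL.⊕-identityˡ _))
      (trans (cong (FL._⊕ θ (x ∷ y ∷ [])) (sym (FL.0•v≡0 e₀))) (sym eq))) (θ∈H (x ∷ y ∷ [])))
    c⁻¹ : F.Carrier
    c⁻¹ = proj₁ (F.invertible c c≢0)
    cc⁻¹≡1 : ⟦ c ⟧ι * ⟦ c⁻¹ ⟧ι ≡ 1#
    cc⁻¹≡1 = trans (sym (ι-* c c⁻¹)) (trans (cong ⟦_⟧ι (proj₂ (F.invertible c c≢0))) ι-1)
    d : Carrier
    d = φ ⟦ c⁻¹ ⟧ι
    φ-inverse : d * φ ⟦ c ⟧ι ≡ 1#
    φ-inverse = trans (sym (φ-* _ _)) (trans (cong φ (trans (*-comm _ _) cc⁻¹≡1)) φ-1)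
    d≢0 : d ≢ 0#
    d≢0 d≡0 = 1≢0 (trans (sym φ-inverse) (trans (cong (_* φ ⟦ c ⟧ι) d≡0) (zeroˡ _)))
    scaled : c FL.• (e₀ FL.⊕ θ (⟦ c⁻¹ ⟧ι • (x ∷ y ∷ []))) ≡ FL.rep P
    scaled = trans (FL.•-distrib-⊕ c e₀ _) (trans (cong (c FL.• e₀ FL.⊕_) (trans (sym (θ-• c _))
      (cong θ (trans (sym (•-assoc ⟦ c ⟧ι ⟦ c⁻¹ ⟧ι _)) (trans (cong (_• (x ∷ y ∷ [])) cc⁻¹≡1) (1•v≡v _)))))) (sym eq))

  model-ideal : ∀ l l∈S w → w ≢ 0ᵥ → (∀ v → FL.Span (FL.basis l) v ⇔ OnSpreadLine w v) →
                semilinear (0# ∷ w) ∝ rep (onPoints (ideal l l∈S))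
  model-ideal l l∈S (x ∷ y ∷ []) w≢0 l⇔ =
    ∝-trans (proportional (≋-cong (∷≡₃ (sym φ-0) refl refl) (Iφ x y w≢0)))
      (μ-cong {I ŵ} {ideal l l∈S}
        ((λ P → Equivalence.from (l⇔ (FL.rep P)) ∘ Equivalence.to (line⇔ ŵ (FL.rep P))) ,
         (λ P → Equivalence.from (line⇔ ŵ (FL.rep P)) ∘ Equivalence.to (l⇔ (FL.rep P)))))
    where
    ŵ : Point 1
    ŵ = ⟨ x ∷ y ∷ [] , w≢0 ⟩

-- Semilinear maps

module Semilinear {q : ℕ} {K : FiniteField q} (1+1≡0 : FiniteField._+_ K (FiniteField.1# K) (FiniteField.1# K) ≡ FiniteField.0# K)
                  (τ : Embedding K K) where
  open FiniteField K
  open FieldProperties K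
  open LinearAlgebra K 1+1≡0
  open EmbeddingProperties τ public

  surjective : ∀ y → ∃[ x ] ⟦ x ⟧ ≡ y
  surjective = injective⇒surjective enumeration enumeration ⟦_⟧ injective

  -- Application of τ to the coordinates.
  conjugate : ∀ {n} → Vector n → Vector n
  conjugate = map ⟦_⟧

  conjugate-⊕ : ∀ {n} (v w : Vector n) → conjugate (v ⊕ w) ≡ conjugate v ⊕ conjugate w
  conjugate-⊕ []      []      = refl
  conjugate-⊕ (x ∷ v) (y ∷ w) = cong₂ _∷_ (+-homo x y) (conjugate-⊕ v w)

  conjugate-• : ∀ {n} c (v : Vector n) → conjugate (c • v) ≡ ⟦ c ⟧ • conjugate v
  conjugate-• c []      = refl
  conjugate-• c (x ∷ v) = cong₂ _∷_ (*-homo c x) (conjugate-• c v)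

  conjugate-0 : ∀ {n} → conjugate {n} 0ᵥ ≡ 0ᵥ
  conjugate-0 {ℕ.zero}  = refl
  conjugate-0 {ℕ.suc n} = cong₂ _∷_ 0#-homo conjugate-0

  conjugate-injective : ∀ {n} {v w : Vector n} → conjugate v ≡ conjugate w → v ≡ w
  conjugate-injective {v = []}    {[]}    _  = refl
  conjugate-injective {v = x ∷ v} {y ∷ w} eq =
    cong₂ _∷_ (injective (Vec.∷-injectiveˡ eq)) (conjugate-injective (Vec.∷-injectiveʳ eq))

  conjugate-surjective : ∀ {n} (v : Vector n) → ∃[ w ] conjugate w ≡ v
  conjugate-surjective []      = [] , refl
  conjugate-surjective (x ∷ v) =
    let y , y≡ = surjective x ; w , w≡ = conjugate-surjective v in y ∷ w , cong₂ _∷_ y≡ w≡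

  conjugate-lincomb : ∀ {m n} (c : Vector m) (bs : Vec (Vector n) m) →
                      conjugate (lincomb c bs) ≡ lincomb (conjugate c) (map conjugate bs)
  conjugate-lincomb []      []       = conjugate-0
  conjugate-lincomb (x ∷ c) (b ∷ bs) =
    trans (conjugate-⊕ (x • b) (lincomb c bs)) (cong₂ _⊕_ (conjugate-• x b) (conjugate-lincomb c bs))

  conjugate-independent : ∀ {m n} {bs : Vec (Vector n) m} → Independent bs → Independent (map conjugate bs)
  conjugate-independent {bs = bs} ind c eq with conjugate-surjective c
  ... | d , refl = trans (cong conjugate
    (ind d (conjugate-injective (trans (conjugate-lincomb d bs) (trans eq (sym conjugate-0)))))) conjugate-0

-- The standard Buekenhout-Tits unital

module StandardUnital (e : ℕ) (F : FiniteField (2 ℕ.^ (2 ℕ.* e ℕ.+ 1)))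
    (K : FiniteField ((2 ℕ.^ (2 ℕ.* e ℕ.+ 1)) ℕ.^ 2)) (ι : Embedding F K) where
  private
    module F = FiniteField F
    module FP = FieldProperties F
    F-1+1≡0 : F.1# F.+ F.1# ≡ F.0#
    F-1+1≡0 = TitsOvoid.1+1≡0 e F
    module FL = LinearAlgebra F F-1+1≡0
  open QuadraticExtension {F = F} {K} ι F-1+1≡0
  open FiniteField K
  open FieldProperties K
  open Characteristic2 K K-1+1≡0
  open LinearAlgebra K K-1+1≡0
  open ≡-Reasoning

  ω₀ : Carrier
  ω₀ = proj₁ outsideF

  ω₀∉F : OutsideF ω₀
  ω₀∉F = proj₂ outsideF

  open Basis ω₀ ω₀∉F renaming (_+ω_ to _+ω₀_; +ω-injective to +ω₀-injective; +ω-surjective to +ω₀-surjective)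

  -- The points (0,0,1) and (1, t + sω₀, v + f(s,t)ω₀) with s, t, v in F.
  standardUnital : PointSet 2
  standardUnital = record
    { mem  = λ P → (rep P ∝ 0# ∷ 0# ∷ 1# ∷ []) ⊎
        (∃[ s ] ∃[ t ] ∃[ v ] rep P ∝ 1# ∷ (t +ω₀ s) ∷ (v +ω₀ tits F e s t) ∷ [])
    ; resp = λ where
        P~Q (inj₁ p)               → inj₁ (∝-trans (∝-sym P~Q) p)
        P~Q (inj₂ (s , t , v , p)) → inj₂ (s , t , v , ∝-trans (∝-sym P~Q) p)
    }

  -- Elements of F are the solutions of x^q = x, so every automorphism of K
  -- restricts to F.
  module _ (τ : Embedding K K) where
    private
      module T = Semilinear {K = K} K-1+1≡0 τ

    restricts : ∀ a → ∃[ b ] ⟦ b ⟧ ≡ T.⟦ ⟦ a ⟧ ⟧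
    restricts a = ^m≡id⇒∈image FP.1<q F.enumeration ⟦_⟧ injective fixed T.⟦ ⟦ a ⟧ ⟧
      (trans (sym (T.^-homo ⟦ a ⟧ (2 ℕ.^ (2 ℕ.* e ℕ.+ 1)))) (cong T.⟦_⟧ (fixed a)))
      where
      fixed : ∀ a → ⟦ a ⟧ ^ (2 ℕ.^ (2 ℕ.* e ℕ.+ 1)) ≡ ⟦ a ⟧
      fixed a = trans (sym (^-homo a (2 ℕ.^ (2 ℕ.* e ℕ.+ 1)))) (cong ⟦_⟧ (FP.^q≡id a))

    -- The restriction of τ to F; it commutes with f because f is a polynomial over
    -- the prime field.
    ρ : F.Carrier → F.Carrier
    ρ a = proj₁ (restricts a)

    ρ≡ : ∀ a → ⟦ ρ a ⟧ ≡ T.⟦ ⟦ a ⟧ ⟧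
    ρ≡ a = proj₂ (restricts a)

    ρ-injective : ∀ {a b} → ρ a ≡ ρ b → a ≡ b
    ρ-injective {a} {b} eq = injective (T.injective (trans (sym (ρ≡ a)) (trans (cong ⟦_⟧ eq) (ρ≡ b))))

    ρ-tits : ∀ s t → ρ (tits F e s t) ≡ tits F e (ρ s) (ρ t)
    ρ-tits s t = injective (begin
      ⟦ ρ (tits F e s t) ⟧                        ≡⟨ ρ≡ _ ⟩
      T.⟦ ⟦ tits F e s t ⟧ ⟧                      ≡⟨ cong T.⟦_⟧ (tits-homo {F = F} {K} ι e s t) ⟩
      T.⟦ tits K e ⟦ s ⟧ ⟦ t ⟧ ⟧                  ≡⟨ tits-homo {F = K} {K} τ e ⟦ s ⟧ ⟦ t ⟧ ⟩
      tits K e T.⟦ ⟦ s ⟧ ⟧ T.⟦ ⟦ t ⟧ ⟧            ≡⟨ cong₂ (tits K e) (ρ≡ s) (ρ≡ t) ⟨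
      tits K e ⟦ ρ s ⟧ ⟦ ρ t ⟧                    ≡⟨ tits-homo {F = F} {K} ι e (ρ s) (ρ t) ⟨
      ⟦ tits F e (ρ s) (ρ t) ⟧                    ∎)

  module _ {U : PointSet 2} (isBT : IsBuekenhoutTitsUnital e F K ι U) where
    open IsBuekenhoutTitsUnital isBT
    open IncidenceIsomorphism model using (onPoints)
    open Fundamental ι F-1+1≡0 H S isDesarguesian model
    open ABBCoordinates ι F-1+1≡0 H S isDesarguesian using (e₀; coordinates; coordinates-unique; coordinates∈H; line; line∈S; line⇔)
    open FieldReduction ι F-1+1≡0 H S isDesarguesian using (θ; θ-⊕; θ-•; θ∈H; OnSpreadLine; θ-injective)
    private
      module T = Semilinear {K = K} K-1+1≡0 τ
      module C = Cone e F H cone axis cone∩H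
      module N = NormalForm e F K ι H S isDesarguesian cone axis axis∈S cone∩H

    -- ω is chosen so that its image under the companion automorphism is ω₀.
    ω : Carrier
    ω = proj₁ (T.surjective ω₀)

    τω≡ω₀ : T.⟦ ω ⟧ ≡ ω₀
    τω≡ω₀ = proj₂ (T.surjective ω₀)

    ω∉F : OutsideF ω
    ω∉F a eq = ω₀∉F (ρ τ a) (trans (ρ≡ τ a) (trans (cong T.⟦_⟧ eq) τω≡ω₀))

    open Basis ω ω∉F using (_+ω_; +ω-surjective)

    opaque
      normalForm : N.Normalised ω ω∉F
      normalForm = N.normalised ω ω∉F C.coneCoordinates

    open N.Normalised normalForm

    c₀ : F.Carrier
    c₀ = proj₁ (coordinates f₀)
    w₀ : Vector 2
    w₀ = proj₁ (proj₂ (coordinates f₀))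
    f₀≡ : f₀ ≡ c₀ FL.• e₀ FL.⊕ θ w₀
    f₀≡ = proj₂ (proj₂ (coordinates f₀))

    c₀≢0 : ⟦ c₀ ⟧ ≢ 0#
    c₀≢0 = ⟦⟧-≢0 λ c₀≡0 → f₀∉H (subst C.InH (sym (trans f₀≡ (trans
      (cong (FL._⊕ θ w₀) (trans (cong (FL._• e₀) c₀≡0) (FL.0•v≡0 e₀))) (FL.⊕-identityˡ _)))) (θ∈H w₀))

    -- Coordinates of f₀, u and w with respect to e₀ and θ.
    source : Vec (Vector 3) 3
    source = (⟦ c₀ ⟧ ∷ w₀) ∷ (0# ∷ u) ∷ (0# ∷ w) ∷ []

    lincomb-source : ∀ a b c → lincomb (a ∷ b ∷ c ∷ []) source ≡ a * ⟦ c₀ ⟧ ∷ a • w₀ ⊕ (b • u ⊕ c • w)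
    lincomb-source a b c = cong₂ _∷_
      (solve 4 (λ a b c d → a :* d :+ (b :* con false :+ (c :* con false :+ con false)) := a :* d) refl a b c ⟦ c₀ ⟧)
      (cong (λ z → a • w₀ ⊕ (b • u ⊕ z)) (⊕-identityʳ (c • w)))

    source-independent : Independent source
    source-independent (a ∷ b ∷ c ∷ []) eq = cong₂ _∷_ a≡0 (u,w-independent (b ∷ c ∷ []) (begin
      b • u ⊕ (c • w ⊕ 0ᵥ)          ≡⟨ cong (b • u ⊕_) (⊕-identityʳ _) ⟩
      b • u ⊕ c • w                 ≡⟨ ⊕-identityˡ _ ⟨
      0ᵥ ⊕ (b • u ⊕ c • w)          ≡⟨ cong (_⊕ (b • u ⊕ c • w)) (trans (cong (_• w₀) a≡0) (0•v≡0 w₀)) ⟨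
      a • w₀ ⊕ (b • u ⊕ c • w)      ≡⟨ Vec.∷-injectiveʳ eq′ ⟩
      0ᵥ                            ∎))
      where
      eq′ : a * ⟦ c₀ ⟧ ∷ a • w₀ ⊕ (b • u ⊕ c • w) ≡ 0ᵥ
      eq′ = trans (sym (lincomb-source a b c)) eq
      a≡0 : a ≡ 0#
      a≡0 = *-≡0 (trans (*-comm _ _) (Vec.∷-injectiveˡ eq′)) c₀≢0

    -- The columns of the projectivity g. If a vector has coordinates k with respect
    -- to source, then g maps the conjugate of k to the semilinear image of the vector.
    target : Vec (Vector 3) 3
    target = map semilinear source

    semilinear-lincomb : ∀ k → lincomb (T.conjugate k) target ≡ semilinear (lincomb k source)
    semilinear-lincomb k = begin
      lincomb (T.conjugate k) target
        ≡⟨ linear-lincomb (lincomb-linear frame) (T.conjugate k) (map T.conjugate source) ⟨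
      lincomb (lincomb (T.conjugate k) (map T.conjugate source)) frame
        ≡⟨ cong (λ z → lincomb z frame) (T.conjugate-lincomb k source) ⟨
      semilinear (lincomb k source)  ∎

    target-independent : Independent target
    target-independent c eq = T.conjugate-independent source-independent c (frame-independent _
      (trans (linear-lincomb (lincomb-linear frame) c (map T.conjugate source)) eq))

    g : GL 3
    g = linear⇒GL (lincomb-linear target) target-independent

    -- Points at infinity.
    ideal⇔ : ∀ b c (nz : b • u ⊕ c • w ≢ 0ᵥ) P → semilinear (0# ∷ b • u ⊕ c • w) ≡ rep P → P ∈ U ⇔ b ≡ 0#
    ideal⇔ b c nz P eq = mk⇔
      (λ P∈U → b≡0 (Equivalence.to (axis⇔ _) (proj₁ (Equivalence.to (idealPart l l∈S)
        (PointSet.resp U {P} {onPoints (ideal l l∈S)} P~ P∈U)) ⟨l⟩ (FL.Span-basis₀ _))))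
      (λ { refl → PointSet.resp U {onPoints (ideal l l∈S)} {P} (∝-sym P~)
        (Equivalence.from (idealPart l l∈S) (l≈axis refl)) })
      where
      x : Vector 2
      x = b • u ⊕ c • w
      l : FL.Flat 1 4
      l = line ⟨ x , nz ⟩
      l∈S : S l
      l∈S = line∈S ⟨ x , nz ⟩
      ⟨l⟩ : FL.Point 4
      ⟨l⟩ = FL.⟨ θ x , (λ eq → nz (FieldReduction.θ-kernel ι F-1+1≡0 H S isDesarguesian eq)) ⟩
      P~ : rep P ∝ rep (onPoints (ideal l l∈S))
      P~ = ∝-trans (≡⇒∝ (sym eq)) (model-ideal l l∈S x nz (line⇔ ⟨ x , nz ⟩))
      b≡0 : OnSpreadLine w (θ x) → b ≡ 0#
      b≡0 (k , θkw≡θx) = Vec.∷-injectiveˡ (u,w-independent (b ∷ c + k ∷ []) (begin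
        b • u ⊕ ((c + k) • w ⊕ 0ᵥ)          ≡⟨ cong (b • u ⊕_) (trans (⊕-identityʳ _) (•-distribʳ c k w)) ⟩
        b • u ⊕ (c • w ⊕ k • w)             ≡⟨ ⊕-assoc _ _ _ ⟨
        x ⊕ k • w                           ≡⟨ cong (x ⊕_) (θ-injective θkw≡θx) ⟩
        x ⊕ x                               ≡⟨ v⊕v≡0 x ⟩
        0ᵥ                                  ∎))
      l≈axis : b ≡ 0# → l FL.≈ᶠ axis
      l≈axis b≡0 = (λ Q Q∈ → Equivalence.from (axis⇔ _) (onto (Equivalence.to (line⇔ ⟨ x , nz ⟩ _) Q∈))) ,
                   (λ Q Q∈ → Equivalence.from (line⇔ ⟨ x , nz ⟩ _) (back (Equivalence.to (axis⇔ _) Q∈)))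
        where
        open FieldReduction ι F-1+1≡0 H S isDesarguesian using (OnSpreadLine-rebase)
        x≡cw : c • w ≡ x
        x≡cw = trans (sym (⊕-identityˡ _)) (cong (_⊕ c • w) (sym (trans (cong (_• u) b≡0) (0•v≡0 u))))
        rebase : ∀ v → OnSpreadLine w v ⇔ OnSpreadLine x v
        rebase = OnSpreadLine-rebase nz (c , cong θ x≡cw)
        onto : ∀ {v} → OnSpreadLine x v → OnSpreadLine w v
        onto = Equivalence.from (rebase _)
        back : ∀ {v} → OnSpreadLine w v → OnSpreadLine x v
        back = Equivalence.to (rebase _)

    -- Affine points.
    affine⇔ : ∀ s t v z P → semilinear (⟦ c₀ ⟧ ∷ w₀ ⊕ ((t +ω s) • u ⊕ (v +ω z) • w)) ≡ rep P →
              P ∈ U ⇔ z ≡ tits F e s t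
    affine⇔ s t v z P eq = mk⇔
      (λ P∈U → Equivalence.to (cone⇔ s t v z) (Equivalence.to (affinePart Q Q∉H)
        (PointSet.resp U {P} {onPoints (affine Q Q∉H)} P~ P∈U)))
      (λ z≡ → PointSet.resp U {onPoints (affine Q Q∉H)} {P} (∝-sym P~)
        (Equivalence.from (affinePart Q Q∉H) (Equivalence.from (cone⇔ s t v z) z≡)))
      where
      x : Vector 2
      x = (t +ω s) • u ⊕ (v +ω z) • w
      f₀+θx∉H : ¬ C.InH (f₀ FL.⊕ θ x)
      f₀+θx∉H ∈H = f₀∉H (FL.Span-cancel (FL.basis H) (θ∈H x) (subst C.InH (FL.⊕-comm _ _) ∈H))
      Q : FL.Point 4
      Q = FL.⟨ f₀ FL.⊕ θ x , (λ ≡0 → f₀+θx∉H (subst C.InH (sym ≡0) (FL.Span-0 (FL.basis H)))) ⟩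
      Q∉H : ¬ C.InH (FL.rep Q)
      Q∉H = f₀+θx∉H
      P~ : rep P ∝ rep (onPoints (affine Q Q∉H))
      P~ = ∝-trans (≡⇒∝ (sym eq)) (model-affine Q Q∉H c₀ (w₀ ⊕ x)
        (trans (cong (FL._⊕ θ x) f₀≡) (trans (FL.⊕-assoc _ _ _) (cong (c₀ FL.• e₀ FL.⊕_) (sym (θ-⊕ w₀ x))))))

    τ-+ω : ∀ a b → T.⟦ a +ω b ⟧ ≡ ρ τ a +ω₀ ρ τ b
    τ-+ω a b = trans (T.+-homo _ _) (cong₂ _+_ (sym (ρ≡ τ a))
      (trans (T.*-homo _ _) (cong₂ _*_ (sym (ρ≡ τ b)) τω≡ω₀)))

    affine∈standard⇔ : ∀ s t v z nz →
      ⟨ 1# ∷ (ρ τ t +ω₀ ρ τ s) ∷ (ρ τ v +ω₀ ρ τ z) ∷ [] , nz ⟩ ∈ standardUnital ⇔ z ≡ tits F e s t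
    affine∈standard⇔ s t v z nz = mk⇔ to λ { refl → inj₂ (ρ τ s , ρ τ t , ρ τ v , ≡⇒∝
      (cong (λ a → 1# ∷ (ρ τ t +ω₀ ρ τ s) ∷ (ρ τ v +ω₀ a) ∷ []) (ρ-tits τ s t))) }
      where
      to : ⟨ 1# ∷ (ρ τ t +ω₀ ρ τ s) ∷ (ρ τ v +ω₀ ρ τ z) ∷ [] , nz ⟩ ∈ standardUnital → z ≡ tits F e s t
      to (inj₁ (c , c≢0 , eq)) = contradiction (trans (sym (*-identityʳ c)) (Vec.∷-injectiveˡ eq)) c≢0
      to (inj₂ (s′ , t′ , v′ , c , _ , eq)) = ρ-injective τ (begin
        ρ τ z                        ≡⟨ proj₂ (+ω₀-injective (unscale (Vec.∷-injectiveˡ (Vec.∷-injectiveʳ (Vec.∷-injectiveʳ eq))))) ⟩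
        tits F e s′ t′               ≡⟨ cong₂ (tits F e) (proj₂ s,t) (proj₁ s,t) ⟨
        tits F e (ρ τ s) (ρ τ t)     ≡⟨ ρ-tits τ s t ⟨
        ρ τ (tits F e s t)           ∎)
        where
        unscale : ∀ {a b} → c * a ≡ b → a ≡ b
        unscale ca≡b = trans (sym (*-identityˡ _)) (trans (cong (_* _)
          (sym (trans (sym (*-identityʳ c)) (Vec.∷-injectiveˡ eq)))) ca≡b)
        s,t : ρ τ t ≡ t′ × ρ τ s ≡ s′
        s,t = +ω₀-injective (unscale (Vec.∷-injectiveˡ (Vec.∷-injectiveʳ eq)))

    ideal∈standard⇔ : ∀ b c nz → ⟨ 0# ∷ T.⟦ b ⟧ ∷ c ∷ [] , nz ⟩ ∈ standardUnital ⇔ b ≡ 0#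
    ideal∈standard⇔ b c nz = mk⇔ to from
      where
      to : ⟨ 0# ∷ T.⟦ b ⟧ ∷ c ∷ [] , nz ⟩ ∈ standardUnital → b ≡ 0#
      to (inj₁ (d , d≢0 , eq)) = T.injective (trans (*-≡0 (Vec.∷-injectiveˡ (Vec.∷-injectiveʳ eq)) d≢0) (sym T.0#-homo))
      to (inj₂ (_ , _ , _ , d , _ , eq)) = contradiction (trans (sym (zeroʳ d)) (Vec.∷-injectiveˡ eq)) 0≢1
      from : b ≡ 0# → ⟨ 0# ∷ T.⟦ b ⟧ ∷ c ∷ [] , nz ⟩ ∈ standardUnital
      from b≡0 = inj₁ (∝-sym (c , c≢0 , cong₂ _∷_ (zeroʳ c) (cong₂ _∷_ (trans (zeroʳ c) (sym τb≡0))
        (cong (_∷ []) (*-identityʳ c)))))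
        where
        τb≡0 : T.⟦ b ⟧ ≡ 0#
        τb≡0 = trans (cong T.⟦_⟧ b≡0) T.0#-homo
        c≢0 : c ≢ 0#
        c≢0 c≡0 = nz (cong₂ _∷_ refl (cong₂ _∷_ τb≡0 (cong (_∷ []) c≡0)))

    maps-affine′ : ∀ s t v z {x y} nz → T.⟦ t +ω s ⟧ ≡ x → T.⟦ v +ω z ⟧ ≡ y →
      ⟨ 1# ∷ x ∷ y ∷ [] , nz ⟩ ∈ standardUnital ⇔ (g · ⟨ 1# ∷ x ∷ y ∷ [] , nz ⟩) ∈ U
    maps-affine′ s t v z nz refl refl = mk⇔
      (Equivalence.from P∈U⇔ ∘ Equivalence.to (affine∈standard⇔ s t v z nz′) ∘ PointSet.resp standardUnital {P} {P′} (≡⇒∝ P≡P′))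
      (PointSet.resp standardUnital {P′} {P} (≡⇒∝ (sym P≡P′)) ∘ Equivalence.from (affine∈standard⇔ s t v z nz′) ∘ Equivalence.to P∈U⇔)
      where
      P P′ : Point 2
      P = ⟨ 1# ∷ T.⟦ t +ω s ⟧ ∷ T.⟦ v +ω z ⟧ ∷ [] , nz ⟩
      nz′ : 1# ∷ (ρ τ t +ω₀ ρ τ s) ∷ (ρ τ v +ω₀ ρ τ z) ∷ [] ≢ 0ᵥ
      nz′ eq = 1≢0 (Vec.∷-injectiveˡ eq)
      P′ = ⟨ 1# ∷ (ρ τ t +ω₀ ρ τ s) ∷ (ρ τ v +ω₀ ρ τ z) ∷ [] , nz′ ⟩
      P≡P′ : rep P ≡ rep P′
      P≡P′ = cong₂ (λ a b → 1# ∷ a ∷ b ∷ []) (τ-+ω t s) (τ-+ω v z)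
      P∈U⇔ : (g · P) ∈ U ⇔ z ≡ tits F e s t
      P∈U⇔ = affine⇔ s t v z (g · P) (begin
        semilinear (⟦ c₀ ⟧ ∷ w₀ ⊕ ((t +ω s) • u ⊕ (v +ω z) • w))
          ≡⟨ cong₂ (λ a b → semilinear (a ∷ b ⊕ ((t +ω s) • u ⊕ (v +ω z) • w))) (*-identityˡ ⟦ c₀ ⟧) (1•v≡v w₀) ⟨
        semilinear (1# * ⟦ c₀ ⟧ ∷ 1# • w₀ ⊕ ((t +ω s) • u ⊕ (v +ω z) • w))
          ≡⟨ cong semilinear (lincomb-source 1# (t +ω s) (v +ω z)) ⟨
        semilinear (lincomb (1# ∷ (t +ω s) ∷ (v +ω z) ∷ []) source)
          ≡⟨ semilinear-lincomb (1# ∷ (t +ω s) ∷ (v +ω z) ∷ []) ⟨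
        lincomb (T.⟦ 1# ⟧ ∷ T.⟦ t +ω s ⟧ ∷ T.⟦ v +ω z ⟧ ∷ []) target
          ≡⟨ cong (λ a → lincomb (a ∷ T.⟦ t +ω s ⟧ ∷ T.⟦ v +ω z ⟧ ∷ []) target) T.1#-homo ⟩
        lincomb (1# ∷ T.⟦ t +ω s ⟧ ∷ T.⟦ v +ω z ⟧ ∷ []) target  ∎)

    maps-affine : ∀ x y nz → ⟨ 1# ∷ x ∷ y ∷ [] , nz ⟩ ∈ standardUnital ⇔ (g · ⟨ 1# ∷ x ∷ y ∷ [] , nz ⟩) ∈ U
    maps-affine x y nz =
      let x′ , x≡ = T.surjective x ; t , s , x′≡ = +ω-surjective x′
          y′ , y≡ = T.surjective y ; v , z , y′≡ = +ω-surjective y′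
      in maps-affine′ s t v z nz (trans (cong T.⟦_⟧ x′≡) x≡) (trans (cong T.⟦_⟧ y′≡) y≡)
    maps-ideal′ : ∀ b c {x y} nz → T.⟦ b ⟧ ≡ x → T.⟦ c ⟧ ≡ y →
      ⟨ 0# ∷ x ∷ y ∷ [] , nz ⟩ ∈ standardUnital ⇔ (g · ⟨ 0# ∷ x ∷ y ∷ [] , nz ⟩) ∈ U
    maps-ideal′ b c nz refl refl = mk⇔
      (Equivalence.from P∈U⇔ ∘ Equivalence.to (ideal∈standard⇔ b T.⟦ c ⟧ nz))
      (Equivalence.from (ideal∈standard⇔ b T.⟦ c ⟧ nz) ∘ Equivalence.to P∈U⇔)
      where
      P : Point 2
      P = ⟨ 0# ∷ T.⟦ b ⟧ ∷ T.⟦ c ⟧ ∷ [] , nz ⟩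
      nz′ : b • u ⊕ c • w ≢ 0ᵥ
      nz′ eq = nz (cong (0# ∷_) (trans (cong T.conjugate
        (u,w-independent (b ∷ c ∷ []) (trans (cong (b • u ⊕_) (⊕-identityʳ _)) eq))) T.conjugate-0))
      P∈U⇔ : (g · P) ∈ U ⇔ b ≡ 0#
      P∈U⇔ = ideal⇔ b c nz′ (g · P) (begin
        semilinear (0# ∷ b • u ⊕ c • w)
          ≡⟨ cong₂ (λ a v → semilinear (a ∷ v)) (zeroˡ ⟦ c₀ ⟧)
               (trans (cong (_⊕ (b • u ⊕ c • w)) (0•v≡0 w₀)) (⊕-identityˡ _)) ⟨
        semilinear (0# * ⟦ c₀ ⟧ ∷ 0# • w₀ ⊕ (b • u ⊕ c • w))
          ≡⟨ cong semilinear (lincomb-source 0# b c) ⟨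
        semilinear (lincomb (0# ∷ b ∷ c ∷ []) source)
          ≡⟨ semilinear-lincomb (0# ∷ b ∷ c ∷ []) ⟨
        lincomb (T.⟦ 0# ⟧ ∷ T.⟦ b ⟧ ∷ T.⟦ c ⟧ ∷ []) target
          ≡⟨ cong (λ a → lincomb (a ∷ T.⟦ b ⟧ ∷ T.⟦ c ⟧ ∷ []) target) T.0#-homo ⟩
        lincomb (0# ∷ T.⟦ b ⟧ ∷ T.⟦ c ⟧ ∷ []) target  ∎)

    maps-ideal : ∀ x y nz → ⟨ 0# ∷ x ∷ y ∷ [] , nz ⟩ ∈ standardUnital ⇔ (g · ⟨ 0# ∷ x ∷ y ∷ [] , nz ⟩) ∈ U
    maps-ideal x y nz = let b , x≡ = T.surjective x ; c , y≡ = T.surjective y in maps-ideal′ b c nz x≡ y≡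

    maps : g maps standardUnital onto U
    maps ⟨ k ∷ x ∷ y ∷ [] , nz ⟩ = byCases (k ≟ 0#)
      where
      P : Point 2
      P = ⟨ k ∷ x ∷ y ∷ [] , nz ⟩

      byCases : Dec (k ≡ 0#) → P ∈ standardUnital ⇔ (g · P) ∈ U
      byCases (yes refl) = maps-ideal x y nz
      byCases (no k≢0)   = mk⇔
        (PointSet.resp U {g · P′} {g · P} (∝-linear (lincomb-linear target) P′~P) ∘
          Equivalence.to (maps-affine (k⁻¹ * x) (k⁻¹ * y) nz′) ∘
          PointSet.resp standardUnital {P} {P′} (∝-sym P′~P))
        (PointSet.resp standardUnital {P′} {P} P′~P ∘
          Equivalence.from (maps-affine (k⁻¹ * x) (k⁻¹ * y) nz′) ∘
          PointSet.resp U {g · P} {g · P′} (∝-sym (∝-linear (lincomb-linear target) P′~P)))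
        where
        k⁻¹ : Carrier
        k⁻¹ = proj₁ (invertible k k≢0)
        undo : ∀ x → k * (k⁻¹ * x) ≡ x
        undo x = trans (sym (*-assoc k k⁻¹ x)) (trans (cong (_* x) (proj₂ (invertible k k≢0))) (*-identityˡ x))
        nz′ : 1# ∷ k⁻¹ * x ∷ k⁻¹ * y ∷ [] ≢ 0ᵥ
        nz′ eq = 1≢0 (Vec.∷-injectiveˡ eq)
        P′ : Point 2
        P′ = ⟨ 1# ∷ k⁻¹ * x ∷ k⁻¹ * y ∷ [] , nz′ ⟩
        P′~P : P′ ~ P
        P′~P = k , k≢0 , cong₂ _∷_ (*-identityʳ k) (cong₂ _∷_ (undo x) (cong (_∷ []) (undo y)))

  equivalent : ∀ {U₁ U₂} → IsBuekenhoutTitsUnital e F K ι U₁ → IsBuekenhoutTitsUnital e F K ι U₂ →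
               PGL-Equivalent U₁ U₂
  equivalent {U₁} {U₂} BT₁ BT₂ = g BT₂ ∘ᴳ inverse (g BT₁) ,
    maps-∘ {U = U₁} {standardUnital} {U₂} (g BT₂) (inverse (g BT₁)) (maps BT₂)
      (maps-inverse {U = standardUnital} {U₁} (g BT₁) (maps BT₁))

open import Data.Nat.Base using (_+_; _*_; _^_)

theorem1 : ∀ (e : ℕ) → 1 ≤ e →
    (F : FiniteField (2 ^ (2 * e + 1))) (K : FiniteField ((2 ^ (2 * e + 1)) ^ 2))
    (ι : Embedding F K) (U₁ U₂ : Projective.PointSet K 2) →
    IsBuekenhoutTitsUnital e F K ι U₁ → IsBuekenhoutTitsUnital e F K ι U₂ →
    Projective.PGL-Equivalent K U₁ U₂
theorem1 e _ F K ι U₁ U₂ = StandardUnital.equivalent e F K ι
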